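{- Let $v$ be a leaf of the path $P_n$, and let $c_\lambda$ be the coefficient of $e_\lambda z^{|\lambda|}$ in $\mathcal{X}_{P_v}(z)=\sum_{n\ge 1}X_{P_{n,v}}z^{n+1}$, i.e. $\mathcal{X}_{P_v}(z)=\sum_\lambda c_\lambda e_\lambda z^{|\lambda|}$. Then: (a) $c_{(k)}=2k$ for $k\ge 3$, and $c_{(2)}=2$; (b) $c_{(k-1,1)}=2(k-2)$ for $k\ge 4$; (c) $c_{(k-2,2)}=4(k-3)$ for $k\ge 5$; (d) $c_{(i,j)}=2i(j-1)+2j(i-1)=2(2ij-i-j)$ for $i>j\ge 3$; (e) $c_{(i,i)}=2i(i-1)$ for $i\ge 3$; (f) $c_{(3,2^k)}=8$ and $c_{(3,2^k,1)}=4$ for $k\ge 2$; (g) if $\ell(\mu)\ge 2$ and $c_{1\cup\mu}\ne 0$, then $1\notin\mathrm{supp}(\mu)$ and there exists $a\ge 3$ with $a\in\mathrm{supp}(\mu)$; in particular $c_{(2^k,1)}=0$. For $\ell(\mu)\ge 2$, $c_{1\cup\mu}$ equals twice the coefficient of $e_\mu z^{|\mu|}$ in $G(z)\,G_{\ge 3}(z)\,G(z)^{\ell(\mu)-2}$, and it equals $$2\sum_{\substack{(a,b):\ a,b\in\mathrm{supp}(\mu)\\ a\ge 2,\ b\ge 3}}(a-1)(b-1)\,\varepsilon((\mu-a)-b);$$ (h) assume $1\notin\mathrm{supp}(\lambda)$ and $\ell(\lambda)\ge 2$. If $c_\lambda\ne 0$, then $\lambda$ contains at least one part of size at least $3$;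 in particular $c_{(2^k)}=0$ (for $k\ge 2$). The coefficient $c_\lambda$ equals twice the coefficient of $e_\lambda z^{|\lambda|}$ in $K(z)\,G_{\ge 3}(z)\,G(z)^{\ell(\lambda)-2}$, and it equals $$2\sum_{\substack{(a,b):\ a,b\in\mathrm{supp}(\lambda)\\ a\ge 2,\ b\ge 3}}a(b-1)\,\varepsilon((\lambda-a)-b).$$
   Context: The chromatic symmetric function of a finite simple graph $H=(V,E)$ is $X_H=\sum_\kappa\prod_{u\in V}x_{\kappa(u)}$, the sum over all proper colorings $\kappa:V\to\mathbb{Z}_{>0}$. $P_n$ is the path on $n$ vertices. The twin of a graph at a vertex $v$ is obtained by adding a new vertex $v'$ joined to $v$ and to all neighbors of $v$; $P_{n,v}$ is $P_n$ twinned at an end vertex $v$ (for $n=1$, the only vertex). $e_\lambda$ are the elementary symmetric functions. For a partition $\lambda$: $\ell(\lambda)$ is its number of parts, $m_j(\lambda)$ the multiplicity of $j$, $\mathrm{supp}(\lambda)=\{j: m_j(\lambda)\ge 1\}$, $\lambda\cup\mu$ the partition whose multiset of parts is the union of those of $\lambda$ and $\mu$ (so $1\cup\mu$ adds a part $1$), and $2^k$ denotes $k$ parts equal to $2$. Define $$\varepsilon(\lambda)=\ell(\lambda)!\prod_{j\in\mathrm{supp}(\lambda)}\frac{(j-1)^{m_j(\lambda)}}{m_j(\lambda)!},\qquad \varepsilon(\emptyset)=1.$$ If $a$ is a part of $\lambda$, $\lambda-a$ is $\lambda$ with one part equal to $a$ removed; if $a$ is not a part of $\lambda$, $\varepsilon(\lambda-a)=0$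 by convention (so $\varepsilon((\lambda-a)-b)=0$ if $b$ is not a part of $\lambda-a$). The sums are over ordered pairs $(a,b)$. Notation: $K(z)=\sum_{i\ge 2}ie_iz^i$, $G(z)=\sum_{i\ge 2}(i-1)e_iz^i$, $G_{\ge 3}(z)=\sum_{i\ge 3}(i-1)e_iz^i$. -}

module Defs where

open import Data.Bool.Base using (if_then_else_)
open import Data.Empty using (⊥)
open import Data.Fin.Base using (Fin; zero; suc; toℕ; fromℕ)
open import Data.Fin.Properties using () renaming (_≟_ to _≟ᶠ_; all? to allFin?)
open import Data.Integer.Base using (ℤ; +_; 0ℤ; 1ℤ) renaming (_+_ to _+ᶻ_; _*_ to _*ᶻ_)
open import Data.List.Base using (List; []; _∷_; _++_; map; foldr; filter; length; concatMap; upTo; allFin; cartesianProductWith; deduplicate; applyUpTo)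
import Data.List.Base as List
open import Data.List.Membership.DecPropositional using () renaming (_∈?_ to mem?)
open import Data.List.Membership.Propositional using (_∈_; find; lose)
open import Data.List.Membership.Propositional.Properties using (∈-map⁺; ∈-map⁻; ∈-filter⁺; ∈-filter⁻; ∈-concatMap⁺; ∈-concatMap⁻; ∈-applyUpTo⁺; ∈-applyUpTo⁻)
open import Data.List.Properties using (≡-dec; filter-all; map-∘; map-id-local; map-cong-local)
open import Data.List.Relation.Binary.Permutation.Propositional using (↭-sym; ↭⇒↭ₛ)
open import Data.List.Relation.Binary.Permutation.Propositional.Properties using (All-resp-↭)
import Data.List.Relation.Binary.Pointwise as Pointwise
open import Data.List.Relation.Unary.All as All using (All; []; _∷_; all?)
import Data.List.Relation.Unary.All.Properties as All
open import Data.List.Relation.Unary.AllPairs using ([]; _∷_)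
open import Data.List.Relation.Unary.Any using (here; there) renaming (_─_ to _removeAt_)
open import Data.List.Relation.Unary.Linked as Linked using (Linked; []; [-]; _∷_)
import Data.List.Relation.Unary.Unique.Propositional.Properties as Unique
open import Data.List.Relation.Unary.Unique.DecPropositional.Properties using (deduplicate-!)
open import Data.List.Relation.Unary.Unique.Propositional using (Unique)
import Data.List.Relation.Unary.Sorted.TotalOrder.Properties as Sorted
open import Data.Maybe.Base using (Maybe; just; nothing; maybe′; _>>=_)
open import Data.Nat.Base using (ℕ; zero; suc; _+_; _*_; _∸_; _^_; _≤_; _≥_; _≤ᵇ_; z≤n; s≤s; NonZero; _!; _/_)
open import Data.Nat.Combinatorics using (k![n∸k]!∣n!)
open import Data.Nat.Divisibility using (_∣_; ∣-trans; *-monoʳ-∣; ∣m⇒∣m*n; 1∣_)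
open import Data.Nat.DivMod using (m/n*n≡m)
open import Data.Nat.ListAction using (sum; product)
open import Data.Nat.ListAction.Properties using (product≢0)
open import Data.Nat.Properties using (_≟_; _≤?_; ≤-refl; ≤-trans; ≤-decTotalOrder; +-suc; suc-injective; <-irrefl; m≤m+n; m≤n+m; m+n∸m≡n; 1+n≢n; _!≢0)
open import Data.Product.Base using (_×_; _,_; proj₁)
open import Data.Sum.Base using (_⊎_; inj₁; inj₂; swap)
open import Data.Vec.Base using (Vec; []; _∷_; lookup; count)
open import Function.Base using (_∘_; id; case_of_)
open import Level using (0ℓ)
open import Relation.Binary.Bundles using (DecTotalOrder)
open import Relation.Binary.Construct.Flip.EqAndOrd using () renaming (decTotalOrder to flipOrder)
open import Relation.Binary.Core using (Rel)
open import Relation.Binary.Definitions using (Symmetric; Irreflexive; Decidable)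
open import Relation.Binary.PropositionalEquality using (_≡_; _≢_; _≗_; refl; sym; trans; cong; subst)
open import Relation.Nullary using (Dec; yes; no; does; ¬_; ¬?; contradiction)
open import Relation.Nullary.Decidable using (_×-dec_; _⊎-dec_; _→-dec_; recompute)

∑ : {A : Set} → List A → (A → ℤ) → ℤ
∑ xs f = foldr (λ x s → f x +ᶻ s) 0ℤ xs

≥-decTotalOrder : DecTotalOrder 0ℓ 0ℓ 0ℓ
≥-decTotalOrder = flipOrder ≤-decTotalOrder

open import Data.List.Sort.InsertionSort ≥-decTotalOrder using (sort; insertionSort)
open import Data.List.Sort.Base (DecTotalOrder.totalOrder ≥-decTotalOrder) using (module SortingAlgorithm)
open SortingAlgorithm insertionSort using (sort-↭; sort-↗)

record Partition : Set where
  constructor mkPartition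
  field
    parts      : List ℕ
    .isSorted  : Linked _≥_ parts
    .positive  : All (1 ≤_) parts

open Partition public using (parts)

-- The partition whose multiset of (positive) parts is the given list;
-- entries equal to 0 are dropped.
partition : List ℕ → Partition
partition xs = mkPartition (sort xs⁺) (sort-↗ xs⁺)
  (All-resp-↭ (↭-sym (sort-↭ xs⁺)) (All.all-filter (1 ≤?_) xs))
  where xs⁺ = filter (1 ≤?_) xs

size : Partition → ℕ
size μ = sum (parts μ)

ℓ : Partition → ℕ
ℓ μ = length (parts μ)

multiplicity : ℕ → Partition → ℕ
multiplicity j μ = length (filter (j ≟_) (parts μ))

supp : Partition → List ℕ
supp μ = deduplicate _≟_ (parts μ)

_∪_ : Partition → Partition → Partition
μ ∪ ν = partition (parts μ ++ parts ν)

-- `nothing` records the removal of a part that was not there.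
_⊖_ : Partition → ℕ → Maybe Partition
μ ⊖ a = case mem? _≟_ a (parts μ) of λ where
  (yes p) → just (partition (parts μ removeAt p))
  (no _)  → nothing

∏mult! : Partition → ℕ
∏mult! μ = product (map (λ j → multiplicity j μ !) (supp μ))

∏mult!≢0 : ∀ μ → NonZero (∏mult! μ)
∏mult!≢0 μ = product≢0 (All.map⁺ (All.universal (λ j → multiplicity j μ !≢0) (supp μ)))

-- ℓ(μ)! ∏ (j-1)^{m_j} / m_j! over a common denominator; the division is
-- exact, see ε-exact.
ε : Partition → ℕ
ε μ = (ℓ μ ! * product (map (λ j → (j ∸ 1) ^ multiplicity j μ) (supp μ))) / ∏mult! μ
  where instance _ = ∏mult!≢0 μ

-- ε((μ - a) - b), zero if one of the removals is impossible.
ε[_-_-_] : Partition → ℕ → ℕ → ℕ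
ε[ μ - a - b ] = maybe′ ε 0 ((μ ⊖ a) >>= (_⊖ b))

-- Weakly decreasing lists of length at most n with entries in {1,…,b}.
decreasing : ℕ → ℕ → List (List ℕ)
decreasing zero    b = [] ∷ []
decreasing (suc n) b = [] ∷ concatMap (λ a → map (a ∷_) (decreasing n a)) (applyUpTo suc b)

-- Every partition of m exactly once, see partitionsOf-sound, -complete, -unique.
partitionsOf : ℕ → List Partition
partitionsOf m = map partition (filter (λ xs → sum xs ≟ m) (decreasing m m))

-- α = α₁ ∷ … ∷ α_N ∷ [] stands for the monomial x₁^α₁ ⋯ x_N^α_N; every
-- monomial is of this form (not uniquely: trailing zeros are immaterial).
Monomial : Set
Monomial = List ℕ

-- Formal power series in x₁, x₂, …, by their coefficients.
Series : Set
Series = Monomial → ℤ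

0ˢ : Series
0ˢ _ = 0ℤ

1ˢ : Series
1ˢ α = if does (sum α ≟ 0) then 1ℤ else 0ℤ

_•_ : ℤ → Series → Series
(k • f) α = k *ᶻ f α

-- All factorisations x^α = x^β x^γ.
splits : Monomial → List (Monomial × Monomial)
splits []      = ([] , []) ∷ []
splits (a ∷ α) = concatMap
  (λ i → map (λ (β , γ) → i ∷ β , (a ∸ i) ∷ γ) (splits α))
  (upTo (suc a))

_·_ : Series → Series → Series
(f · g) α = ∑ (splits α) λ (β , γ) → f β *ᶻ g γ

-- e_k is the sum of all squarefree monomials of degree k.
elementary : ℕ → Series
elementary k α = if does (all? (_≤? 1) α ×-dec (sum α ≟ k)) then 1ℤ else 0ℤ

e : Partition → Series
e μ = foldr (λ k f → elementary k · f) 1ˢ (parts μ)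

-- Power series in z with coefficients in Series.
Seriesᶻ : Set
Seriesᶻ = ℕ → Series

1ᶻ : Seriesᶻ
1ᶻ zero    = 1ˢ
1ᶻ (suc _) = 0ˢ

_⊛_ : Seriesᶻ → Seriesᶻ → Seriesᶻ
(F ⊛ H) m α = ∑ (upTo (suc m)) λ i → (F i · H (m ∸ i)) α

infixl 7 _⊛_

_^ᶻ_ : Seriesᶻ → ℕ → Seriesᶻ
F ^ᶻ zero  = 1ᶻ
F ^ᶻ suc n = F ⊛ (F ^ᶻ n)

infixr 8 _^ᶻ_

K : Seriesᶻ
K i = if 2 ≤ᵇ i then (+ i) • elementary i else 0ˢ

G : Seriesᶻ
G i = if 2 ≤ᵇ i then (+ (i ∸ 1)) • elementary i else 0ˢ

G≥3 : Seriesᶻ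
G≥3 i = if 3 ≤ᵇ i then (+ (i ∸ 1)) • elementary i else 0ˢ

-- F(z) = Σ_μ c_μ e_μ z^|μ|
EExpansion : Seriesᶻ → (Partition → ℤ) → Set
EExpansion F c = ∀ m α → F m α ≡ ∑ (partitionsOf m) λ μ → c μ *ᶻ e μ α

-- c_μ is the coefficient of e_μ z^|μ| in F(z), for every μ.
record _HasECoefficients_ (F : Seriesᶻ) (c : Partition → ℤ) : Set where
  field
    expansion : EExpansion F c
    unique    : ∀ c′ → EExpansion F c′ → c′ ≗ c

record Graph (n : ℕ) : Set₁ where
  field
    _~_      : Rel (Fin n) 0ℓ
    ~-sym    : Symmetric _~_
    ~-irrefl : Irreflexive _≡_ _~_
    _~?_     : Decidable _~_

module _ {n : ℕ} (H : Graph n) where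
  open Graph H

  Proper : {N : ℕ} → Vec (Fin N) n → Set
  Proper κ = ∀ u w → u ~ w → lookup κ u ≢ lookup κ w

  proper? : {N : ℕ} (κ : Vec (Fin N) n) → Dec (Proper κ)
  proper? κ = allFin? λ u → allFin? λ w → (u ~? w) →-dec ¬? (lookup κ u ≟ᶠ lookup κ w)

colourings : (n N : ℕ) → List (Vec (Fin N) n)
colourings zero    N = [] ∷ []
colourings (suc n) N = cartesianProductWith _∷_ (allFin N) (colourings n N)

-- Exponents of the monomial ∏_u x_{κ(u)}.
content : {n N : ℕ} → Vec (Fin N) n → Monomial
content κ = List.tabulate λ i → count (i ≟ᶠ_) κ

-- The coefficient of x^α counts the proper colourings κ with
-- ∏_u x_{κ(u)} = x^α; these only use colours occurring in x^α, so it
-- suffices to range over the first N colours, N the length of α.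
X : {n : ℕ} → Graph n → Series
X {n} H α = + length (filter (λ κ → proper? H κ ×-dec ≡-dec _≟_ (content κ) α) (colourings n (length α)))

Consecutive : {n : ℕ} → Rel (Fin n) 0ℓ
Consecutive i j = suc (toℕ i) ≡ toℕ j ⊎ suc (toℕ j) ≡ toℕ i

path : (n : ℕ) → Graph n
path n = record
  { _~_      = Consecutive
  ; ~-sym    = swap
  ; ~-irrefl = irrefl
  ; _~?_     = λ i j → (suc (toℕ i) ≟ toℕ j) ⊎-dec (suc (toℕ j) ≟ toℕ i)
  }
  where
  irrefl : Irreflexive _≡_ Consecutive
  irrefl refl (inj₁ p) = 1+n≢n p
  irrefl refl (inj₂ p) = 1+n≢n p

IsEnd : {m : ℕ} → Fin (suc m) → Set
IsEnd {m} v = v ≡ zero ⊎ v ≡ fromℕ m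

-- The new vertex v′ is zero; an old vertex u becomes suc u.
module _ {n : ℕ} (H : Graph n) (v : Fin n) where
  open Graph H

  TwinAdjacent : Rel (Fin (suc n)) 0ℓ
  TwinAdjacent zero    zero    = ⊥
  TwinAdjacent zero    (suc w) = w ≡ v ⊎ w ~ v
  TwinAdjacent (suc u) zero    = u ≡ v ⊎ u ~ v
  TwinAdjacent (suc u) (suc w) = u ~ w

  twin : Graph (suc n)
  twin = record
    { _~_      = TwinAdjacent
    ; ~-sym    = λ {u} {w} → symm u w
    ; ~-irrefl = λ {u} {w} → irrefl u w
    ; _~?_     = dec
    }
    where
    symm : ∀ u w → TwinAdjacent u w → TwinAdjacent w u
    symm zero    (suc w) p = p
    symm (suc u) zero    p = p
    symm (suc u) (suc w) p = ~-sym p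

    irrefl : ∀ u w → u ≡ w → ¬ TwinAdjacent u w
    irrefl zero    .zero    refl ()
    irrefl (suc u) .(suc u) refl p = ~-irrefl refl p

    dec : Decidable TwinAdjacent
    dec zero    zero    = no id
    dec zero    (suc w) = (w ≟ᶠ v) ⊎-dec (w ~? v)
    dec (suc u) zero    = (u ≟ᶠ v) ⊎-dec (u ~? v)
    dec (suc u) (suc w) = u ~? w

-- Σ_{n≥1} X_{P_{n,v}} z^{n+1}, with v m the vertex twinned in P_{m+1}.
𝒳 : (∀ m → Fin (suc m)) → Seriesᶻ
𝒳 v 0             = 0ˢ
𝒳 v 1             = 0ˢ
𝒳 v (suc (suc m)) = X (twin (path (suc m)) (v m))

private
  -- Weakly decreasing with positive entries, all at most b.
  data Decreasing (b : ℕ) : List ℕ → Set where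
    []  : Decreasing b []
    _∷_ : ∀ {a xs} → 1 ≤ a × a ≤ b → Decreasing a xs → Decreasing b (a ∷ xs)

  toLinked : ∀ {b xs} → Decreasing b xs → Linked _≥_ xs
  toLinked []                       = []
  toLinked (_ ∷ [])                 = [-]
  toLinked (_ ∷ ds@((_ , q) ∷ _))   = q ∷ toLinked ds

  toPositive : ∀ {b xs} → Decreasing b xs → All (1 ≤_) xs
  toPositive []             = []
  toPositive ((p , _) ∷ ds) = p ∷ toPositive ds

  fromLinked : ∀ {b xs} → Linked _≥_ xs → All (1 ≤_) xs → sum xs ≤ b → Decreasing b xs
  fromLinked {xs = []}         _        _        _ = []
  fromLinked {xs = a ∷ xs}     ls       (p ∷ ps) q = (p , ≤-trans (m≤m+n a (sum xs)) q) ∷ go ls ps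
    where
    go : ∀ {c ys} → Linked _≥_ (c ∷ ys) → All (1 ≤_) ys → Decreasing c ys
    go [-]      []       = []
    go (r ∷ rs) (p ∷ ps) = (p , r) ∷ go rs ps

  length≤sum : ∀ {xs} → All (1 ≤_) xs → length xs ≤ sum xs
  length≤sum []                            = z≤n
  length≤sum {suc x ∷ xs} (s≤s _ ∷ ps) = s≤s (≤-trans (length≤sum ps) (m≤n+m (sum xs) x))

  decreasing-sound : ∀ n b {xs} → xs ∈ decreasing n b → Decreasing b xs
  decreasing-sound zero    b (here refl) = []
  decreasing-sound (suc n) b (here refl) = []
  decreasing-sound (suc n) b (there p)
    with a , a∈ , q ← find (∈-concatMap⁻ (λ a → map (a ∷_) (decreasing n a)) {xs = applyUpTo suc b} p)
    with i , i<b , refl ← ∈-applyUpTo⁻ suc a∈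
    with ys , ys∈ , refl ← ∈-map⁻ (a ∷_) q
    = (s≤s z≤n , i<b) ∷ decreasing-sound n (suc i) ys∈

  decreasing-complete : ∀ n b {xs} → Decreasing b xs → length xs ≤ n → xs ∈ decreasing n b
  decreasing-complete zero    b []                   _ = here refl
  decreasing-complete (suc n) b []                   _ = here refl
  decreasing-complete (suc n) b (_∷_ {suc a} (_ , q) ds) (s≤s r) = there
    (∈-concatMap⁺ (λ a → map (a ∷_) (decreasing n a))
      (lose (∈-applyUpTo⁺ suc q) (∈-map⁺ (suc a ∷_) (decreasing-complete n (suc a) ds r))))

  concatMap-∷-unique : (f : ℕ → List (List ℕ)) → (∀ a → Unique (f a)) →
    ∀ {as} → Unique as → Unique (concatMap (λ a → map (a ∷_) (f a)) as)
  concatMap-∷-unique f u []               = []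
  concatMap-∷-unique f u {a ∷ as} (a∉ ∷ us) = Unique.++⁺
    (Unique.map⁺ (λ where refl → refl) (u a))
    (concatMap-∷-unique f u us)
    λ (p , q) → disjoint p q
    where
    disjoint : ∀ {xs} → xs ∈ map (a ∷_) (f a) → ¬ xs ∈ concatMap (λ a → map (a ∷_) (f a)) as
    disjoint p q
      with _ , _ , refl ← ∈-map⁻ (a ∷_) p
      with a′ , a′∈ , r ← find (∈-concatMap⁻ (λ a → map (a ∷_) (f a)) {xs = as} q)
      with _ , _ , refl ← ∈-map⁻ (a′ ∷_) r
      = All.lookup a∉ a′∈ refl

  decreasing-unique : ∀ n b → Unique (decreasing n b)
  decreasing-unique zero    b = [] ∷ []
  decreasing-unique (suc n) b =
    All.tabulate (λ p → λ where refl → []∉ p) ∷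
    concatMap-∷-unique (decreasing n) (decreasing-unique n)
      (Unique.applyUpTo⁺₁ suc b (λ i<j _ p → <-irrefl (suc-injective p) i<j))
    where
    []∉ : ¬ [] ∈ concatMap (λ a → map (a ∷_) (decreasing n a)) (applyUpTo suc b)
    []∉ p
      with _ , _ , q ← find (∈-concatMap⁻ (λ a → map (a ∷_) (decreasing n a)) {xs = applyUpTo suc b} p)
      with _ , _ , () ← ∈-map⁻ _ q

  parts∘partition : ∀ {xs} → Linked _≥_ xs → All (1 ≤_) xs → parts (partition xs) ≡ xs
  parts∘partition {xs} s p = trans (cong sort (filter-all (1 ≤?_) p))
    (Pointwise.Pointwise-≡⇒≡ (Sorted.↗↭↗⇒≋ (DecTotalOrder.totalOrder ≥-decTotalOrder)
      (sort-↗ xs) s (↭⇒↭ₛ (sort-↭ xs))))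

  candidates : ℕ → List (List ℕ)
  candidates m = filter (λ xs → sum xs ≟ m) (decreasing m m)

  candidates-sound : ∀ m {xs} → xs ∈ candidates m → Decreasing m xs × sum xs ≡ m
  candidates-sound m p with q , r ← ∈-filter⁻ (λ xs → sum xs ≟ m) p = decreasing-sound m m q , r

  parts-injective : ∀ {μ ν} → parts μ ≡ parts ν → μ ≡ ν
  parts-injective refl = refl

parts-sorted : ∀ μ → Linked _≥_ (parts μ)
parts-sorted (mkPartition xs s p) = recompute (Linked.linked? (λ a b → b ≤? a) xs) s

parts-positive : ∀ μ → All (1 ≤_) (parts μ)
parts-positive (mkPartition xs s p) = recompute (all? (1 ≤?_) xs) p

partition∘parts : ∀ μ → partition (parts μ) ≡ μ
partition∘parts μ = parts-injective (parts∘partition (parts-sorted μ) (parts-positive μ))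

partitionsOf-sound : ∀ m {μ} → μ ∈ partitionsOf m → size μ ≡ m
partitionsOf-sound m p
  with xs , q , refl ← ∈-map⁻ partition p
  with ds , r ← candidates-sound m q
  = trans (cong sum (parts∘partition (toLinked ds) (toPositive ds))) r

partitionsOf-complete : ∀ μ → μ ∈ partitionsOf (size μ)
partitionsOf-complete μ = subst (_∈ partitionsOf (size μ)) (partition∘parts μ)
  (∈-map⁺ partition (∈-filter⁺ (λ xs → sum xs ≟ size μ)
    (decreasing-complete (size μ) (size μ)
      (fromLinked (parts-sorted μ) (parts-positive μ) ≤-refl)
      (length≤sum (parts-positive μ)))
    refl))

partitionsOf-unique : ∀ m → Unique (partitionsOf m)
partitionsOf-unique m = Unique.map⁻ (subst Unique (sym eq)
  (Unique.filter⁺ (λ xs → sum xs ≟ m) (decreasing-unique m m)))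
  where
  eq : map parts (partitionsOf m) ≡ candidates m
  eq = trans (sym (map-∘ (candidates m)))
    (map-id-local (All.tabulate λ p → let ds = proj₁ (candidates-sound m p) in
      parts∘partition (toLinked ds) (toPositive ds)))

private
  length-split : ∀ {P : ℕ → Set} (P? : ∀ x → Dec (P x)) xs →
    length (filter P? xs) + length (filter (¬? ∘ P?) xs) ≡ length xs
  length-split P? []       = refl
  length-split P? (x ∷ xs) with P? x
  ... | yes _ = cong suc (length-split P? xs)
  ... | no  _ = trans (+-suc _ _) (cong suc (length-split P? xs))

  count-other : ∀ {P Q : ℕ → Set} (P? : ∀ x → Dec (P x)) (Q? : ∀ x → Dec (Q x)) →
    (∀ {x} → P x → ¬ Q x) → ∀ xs →
    length (filter Q? xs) ≡ length (filter Q? (filter (¬? ∘ P?) xs))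
  count-other P? Q? d []       = refl
  count-other P? Q? d (x ∷ xs) with P? x
  count-other P? Q? d (x ∷ xs) | yes p with Q? x
  ... | yes q = contradiction q (d p)
  ... | no  _ = count-other P? Q? d xs
  count-other P? Q? d (x ∷ xs) | no _ with Q? x
  ... | yes _ = cong suc (count-other P? Q? d xs)
  ... | no  _ = count-other P? Q? d xs

  multinomial∣ : ∀ {js} → Unique js → ∀ xs →
    product (map (λ j → length (filter (j ≟_) xs) !) js) ∣ length xs !
  multinomial∣ []                    xs = 1∣ _
  multinomial∣ {j ∷ js} (j∉ ∷ us) xs = ∣-trans
    (*-monoʳ-∣ (a !) (subst (_∣ length ys !) (sym (cong product (map-cong-local (All.map (λ {i} j≢i → cong _! (count-other (j ≟_) (i ≟_) (λ where refl i≡j → j≢i (sym i≡j)) xs)) j∉)))) (multinomial∣ us ys)))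
    (subst (a ! * length ys ! ∣_) (cong _! (length-split (j ≟_) xs))
      (subst (λ b → a ! * b ! ∣ (a + length ys) !) (m+n∸m≡n a (length ys))
        (k![n∸k]!∣n! (m≤m+n a (length ys)))))
    where
    ys = filter (¬? ∘ (j ≟_)) xs
    a  = length (filter (j ≟_) xs)

ε-exact : ∀ μ → ε μ * ∏mult! μ ≡ ℓ μ ! * product (map (λ j → (j ∸ 1) ^ multiplicity j μ) (supp μ))
ε-exact μ = m/n*n≡m {{∏mult!≢0 μ}} (∣m⇒∣m*n _ (multinomial∣ (deduplicate-! _≟_ (parts μ)) (parts μ)))

{-# OPTIONS --safe #-}
module Submission where

-- Let P_n = X_{P_n}, which enumerates the words of length n without equal
-- adjacent letters.  For a set S and a nonempty such word w with first letter
-- i ∉ S, moving i from w to S is a bijection onto the pairs (S′ ∋ i, w′) with w′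
-- not beginning with i.  Comparing the remaining pairs on both sides (those
-- where the first letter belongs to the set) the sum over |S| + |w| = m
-- telescopes to P_m = m e_m + Σ_{k<m} (k-1) e_k P_{m-k}, that is
-- P = 1 + I / (1 - G) with I = Σ_i i e_i zⁱ.
--
-- Inclusion–exclusion on the triangle at the twinned end gives
-- X_{P_{n,v}} = 2 P_{n+1} - 2 e₂ P_{n-1}, hence
-- 𝒳 = 2 (K - e₂ z² + I G≥3 / (1 - G)).  Expanding the products, the coefficient
-- of e_λ is a weighted count of the words whose letters are the parts of λ, and
-- is evaluated by removing the first letter; for Gˡ this recursion is the
-- one satisfied by the multinomial expression ε.
--
-- The e_λ are linearly independent because the highest power of x₁ in e_λ is
-- ℓ(λ), with coefficient e_μ in the other variables, where μ is λ without its
-- first column.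

-- The term -2 e₂ P_{n-1} turns one factor G into G≥3. Write I / (1 - G) = I + I G / (1 - G) with G
-- = e₂ z² + G≥3. The e₂ z² part is e₂ z² (P - 1), so subtracting e₂ z² P leaves I - e₂ z² + I G≥3 /
-- (1 - G). For at least two parts only the last summand matters, which is why a part of size at
-- least 3 is forced. Since 𝒳 starts in degree 2, the first I may be replaced by K. No series is
-- inverted: in each degree 1 / (1 - G) is a finite sum over the number l of factors.
--
-- A coefficient at an exponent list of length N involves only N variables. Hence the path
-- identities are proved for a family x₁, ..., x_N in an arbitrary commutative ring, with words
-- present only through recursively defined generating functions. They are then specialised to the
-- variables of `seriesRing N` and matched with the colourings.

-- Finite sums, guarded sums and convolutions.

module Sums where

  open import Algebra.Bundles using (CommutativeMonoid; CommutativeRing)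
  open import Data.Bool.Base using (if_then_else_)
  open import Data.List.Base using (List; []; _∷_; _++_; map; foldr; filter; concatMap; upTo; applyUpTo; cartesianProductWith)
  open import Data.List.Membership.Propositional using (_∈_; _∉_)
  import Data.List.Membership.DecPropositional as DecMembership
  open import Data.List.Relation.Unary.Any using (here; there)
  open import Data.List.Relation.Unary.All as All using ([]; _∷_)
  open import Data.List.Relation.Unary.AllPairs using ([]; _∷_)
  open import Data.List.Relation.Unary.Unique.Propositional using (Unique)
  open import Data.Nat.Base as ℕ using (ℕ; zero; suc; _∸_)
  open import Function.Base using (_∘_; id; flip)
  open import Level using (0ℓ)
  open import Relation.Binary.Definitions using (DecidableEquality)
  open import Relation.Binary.PropositionalEquality as ≡ using (_≡_; _≢_)
  open import Relation.Nullary using (Dec; yes; no; does; ¬_; contradiction)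
  open import Relation.Nullary.Decidable using (_×-dec_)

  -- Commutative monoids rather than rings, so that the products over `supp μ` in the multinomial
  -- part obey the same lemmas as the sums.
  module BigOp (M : CommutativeMonoid 0ℓ 0ℓ) where
    open CommutativeMonoid M
    open import Relation.Binary.Reasoning.Setoid setoid
    open import Algebra.Properties.CommutativeSemigroup commutativeSemigroup using (interchange)

    ⨁ : {A : Set} → List A → (A → Carrier) → Carrier
    ⨁ xs f = foldr (λ x s → f x ∙ s) ε xs

    guard : {P : Set} → Dec P → Carrier → Carrier
    guard d x = if does d then x else ε

    guard-yes : ∀ {P} (d : Dec P) {x} → P → guard d x ≈ x
    guard-yes (yes _) p = refl
    guard-yes (no ¬p) p = contradiction p ¬p

    guard-no : ∀ {P} (d : Dec P) {x} → ¬ P → guard d x ≈ ε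
    guard-no (yes p) ¬p = contradiction p ¬p
    guard-no (no _)  ¬p = refl

    guard-cong : ∀ {P Q} (d : Dec P) (d′ : Dec Q) {x y} → (P → Q) → (Q → P) → x ≈ y → guard d x ≈ guard d′ y
    guard-cong (yes p) d′ f g x≈y = trans x≈y (sym (guard-yes d′ (f p)))
    guard-cong (no ¬p) d′ f g x≈y = sym (guard-no d′ (¬p ∘ g))

    guard-congʳ : ∀ {P} (d : Dec P) {x y} → x ≈ y → guard d x ≈ guard d y
    guard-congʳ d = guard-cong d d id id

    guard-ε : ∀ {P} (d : Dec P) → guard d ε ≈ ε
    guard-ε (yes _) = refl
    guard-ε (no _)  = refl

    guard-× : ∀ {P Q} (d : Dec P) (d′ : Dec Q) {x} → guard (d ×-dec d′) x ≈ guard d (guard d′ x)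
    guard-× (yes _) (yes _) = refl
    guard-× (yes _) (no _)  = refl
    guard-× (no _)  _       = refl

    module _ {A : Set} where

      ⨁-cong∈ : ∀ (xs : List A) {f g} → (∀ x → x ∈ xs → f x ≈ g x) → ⨁ xs f ≈ ⨁ xs g
      ⨁-cong∈ []       f≈g = refl
      ⨁-cong∈ (x ∷ xs) f≈g = ∙-cong (f≈g x (here ≡.refl)) (⨁-cong∈ xs λ y → f≈g y ∘ there)

      ⨁-cong : ∀ (xs : List A) {f g} → (∀ x → f x ≈ g x) → ⨁ xs f ≈ ⨁ xs g
      ⨁-cong xs f≈g = ⨁-cong∈ xs λ x _ → f≈g x

      ⨁-ε : ∀ (xs : List A) {f} → (∀ x → x ∈ xs → f x ≈ ε) → ⨁ xs f ≈ ε
      ⨁-ε []       f≈ε = refl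
      ⨁-ε (x ∷ xs) f≈ε = trans (∙-cong (f≈ε x (here ≡.refl)) (⨁-ε xs λ y → f≈ε y ∘ there)) (identityˡ ε)

      ⨁-∙ : ∀ (xs : List A) {f g} → ⨁ xs (λ x → f x ∙ g x) ≈ ⨁ xs f ∙ ⨁ xs g
      ⨁-∙ []       = sym (identityˡ ε)
      ⨁-∙ (x ∷ xs) = trans (∙-congˡ (⨁-∙ xs)) (interchange _ _ _ _)

      ⨁-++ : ∀ (xs ys : List A) {f} → ⨁ (xs ++ ys) f ≈ ⨁ xs f ∙ ⨁ ys f
      ⨁-++ []       ys = sym (identityˡ _)
      ⨁-++ (x ∷ xs) ys = trans (∙-congˡ (⨁-++ xs ys)) (sym (assoc _ _ _))

      ⨁-map : ∀ {B : Set} (h : B → A) xs {f} → ⨁ (map h xs) f ≈ ⨁ xs (f ∘ h)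
      ⨁-map h []       = refl
      ⨁-map h (x ∷ xs) = ∙-congˡ (⨁-map h xs)

      ⨁-concatMap : ∀ {B : Set} (h : B → List A) xs {f} → ⨁ (concatMap h xs) f ≈ ⨁ xs (λ x → ⨁ (h x) f)
      ⨁-concatMap h []       = refl
      ⨁-concatMap h (x ∷ xs) = trans (⨁-++ (h x) (concatMap h xs)) (∙-congˡ (⨁-concatMap h xs))

      ⨁-filter : ∀ {P : A → Set} (P? : ∀ x → Dec (P x)) xs {f} → ⨁ (filter P? xs) f ≈ ⨁ xs (λ x → guard (P? x) (f x))
      ⨁-filter P? []       = refl
      ⨁-filter P? (x ∷ xs) with P? x
      ... | yes _ = ∙-congˡ (⨁-filter P? xs)
      ... | no _  = trans (⨁-filter P? xs) (sym (identityˡ _))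

    ⨁-swap : ∀ {A B : Set} (xs : List A) (ys : List B) {f : A → B → Carrier} →
      ⨁ xs (λ x → ⨁ ys (f x)) ≈ ⨁ ys (λ y → ⨁ xs (λ x → f x y))
    ⨁-swap []       ys = sym (⨁-ε ys λ _ _ → refl)
    ⨁-swap (x ∷ xs) ys = trans (∙-congˡ (⨁-swap xs ys)) (sym (⨁-∙ ys))

    ⨁-cartesian : ∀ {A B C : Set} (h : A → B → C) xs ys {f} →
      ⨁ (cartesianProductWith h xs ys) f ≈ ⨁ xs (λ x → ⨁ ys (λ y → f (h x y)))
    ⨁-cartesian h []       ys = refl
    ⨁-cartesian h (x ∷ xs) ys = trans (⨁-++ (map (h x) ys) _) (∙-cong (⨁-map (h x) ys) (⨁-cartesian h xs ys))

    module _ {A : Set} where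

      ⨁-single : ∀ {xs : List A} {f x} → Unique xs → x ∈ xs → (∀ y → y ∈ xs → y ≢ x → f y ≈ ε) → ⨁ xs f ≈ f x
      ⨁-single {xs = x ∷ xs} (x∉ ∷ u) (here ≡.refl) f≈ε =
        trans (∙-congˡ (⨁-ε xs λ y y∈ → f≈ε y (there y∈) λ where ≡.refl → All.lookup x∉ y∈ ≡.refl)) (identityʳ _)
      ⨁-single {xs = z ∷ xs} (z∉ ∷ u) (there x∈) f≈ε =
        trans (∙-cong (f≈ε z (here ≡.refl) (All.lookup z∉ x∈)) (⨁-single u x∈ λ y → f≈ε y ∘ there)) (identityˡ _)

      module _ (_≟_ : DecidableEquality A) where
        open DecMembership _≟_ using (_∈?_)

        private
          spread : ∀ {ys : List A} {a} x → Unique ys → (x ∉ ys → a ≈ ε) → ⨁ ys (λ y → guard (x ≟ y) a) ≈ a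
          spread {ys} x u h with x ∈? ys
          ... | yes x∈ = trans (⨁-single u x∈ λ y _ y≢x → guard-no (x ≟ y) (y≢x ∘ ≡.sym)) (guard-yes (x ≟ x) ≡.refl)
          ... | no x∉  = trans (⨁-ε ys λ y y∈ → guard-no (x ≟ y) λ where ≡.refl → x∉ y∈) (sym (h x∉))

        -- Both sides equal the double sum over the pairs with `x` equal to `y`: an element of both
        -- lists has exactly one partner because there are no repetitions, and an element of only
        -- one list contributes `ε`.
        ⨁-support : ∀ {xs ys : List A} {f} → Unique xs → Unique ys →
          (∀ x → x ∈ xs → x ∉ ys → f x ≈ ε) → (∀ y → y ∈ ys → y ∉ xs → f y ≈ ε) → ⨁ xs f ≈ ⨁ ys f
        ⨁-support {xs} {ys} {f} ux uy hx hy = begin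
          ⨁ xs f                                        ≈⟨ ⨁-cong∈ xs (λ x x∈ → spread x uy (hx x x∈)) ⟨
          ⨁ xs (λ x → ⨁ ys (λ y → guard (x ≟ y) (f x))) ≈⟨ ⨁-swap xs ys ⟩
          ⨁ ys (λ y → ⨁ xs (λ x → guard (x ≟ y) (f x))) ≈⟨ ⨁-cong ys (λ y → ⨁-cong xs λ x → flip-guard x y) ⟩
          ⨁ ys (λ y → ⨁ xs (λ x → guard (y ≟ x) (f y))) ≈⟨ ⨁-cong∈ ys (λ y y∈ → spread y ux (hy y y∈)) ⟩
          ⨁ ys f                                        ∎
          where
          flip-guard : ∀ x y → guard (x ≟ y) (f x) ≈ guard (y ≟ x) (f y)
          flip-guard x y with x ≟ y
          ... | yes ≡.refl = sym (guard-yes (y ≟ y) ≡.refl)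
          ... | no x≢y     = sym (guard-no (y ≟ x) (x≢y ∘ ≡.sym))

    -- The sum of φ i j over i + j = m.
    diag : ℕ → (ℕ → ℕ → Carrier) → Carrier
    diag zero    φ = φ 0 0
    diag (suc m) φ = φ 0 (suc m) ∙ diag m (φ ∘ suc)

    diag-cong : ∀ m {φ ψ} → (∀ i j → i ℕ.+ j ≡ m → φ i j ≈ ψ i j) → diag m φ ≈ diag m ψ
    diag-cong zero    h = h 0 0 ≡.refl
    diag-cong (suc m) h = ∙-cong (h 0 (suc m) ≡.refl) (diag-cong m λ i j → h (suc i) j ∘ ≡.cong suc)

    diag-ε : ∀ m {φ} → (∀ i j → i ℕ.+ j ≡ m → φ i j ≈ ε) → diag m φ ≈ ε
    diag-ε zero    h = h 0 0 ≡.refl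
    diag-ε (suc m) h = trans (∙-cong (h 0 (suc m) ≡.refl) (diag-ε m λ i j → h (suc i) j ∘ ≡.cong suc)) (identityˡ ε)

    diag-∙ : ∀ m {φ ψ} → diag m (λ i j → φ i j ∙ ψ i j) ≈ diag m φ ∙ diag m ψ
    diag-∙ zero    = refl
    diag-∙ (suc m) = trans (∙-congˡ (diag-∙ m)) (interchange _ _ _ _)

    diag-last : ∀ m {φ} → diag (suc m) φ ≈ diag m (λ i j → φ i (suc j)) ∙ φ (suc m) 0
    diag-last zero    = refl
    diag-last (suc m) {φ} = trans (∙-congˡ (diag-last m {φ ∘ suc})) (sym (assoc _ _ _))

    diag-comm : ∀ m {φ} → diag m φ ≈ diag m (flip φ)
    diag-comm zero        = refl
    diag-comm (suc m) {φ} = begin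
      φ 0 (suc m) ∙ diag m (φ ∘ suc)            ≈⟨ comm _ _ ⟩
      diag m (φ ∘ suc) ∙ φ 0 (suc m)            ≈⟨ ∙-congʳ (diag-comm m) ⟩
      diag m (λ i j → φ (suc j) i) ∙ φ 0 (suc m) ≈⟨ diag-last m {flip φ} ⟨
      diag (suc m) (flip φ)                     ∎

    diag-assoc : ∀ m {φ : ℕ → ℕ → ℕ → Carrier} →
      diag m (λ i k → diag i (λ j l → φ j l k)) ≈ diag m (λ j n → diag n (φ j))
    diag-assoc zero        = refl
    diag-assoc (suc m) {φ} = begin
      φ 0 0 (suc m) ∙ diag m (λ i k → φ 0 (suc i) k ∙ diag i (λ j l → φ (suc j) l k))
        ≈⟨ ∙-congˡ (diag-∙ m) ⟩
      φ 0 0 (suc m) ∙ (diag m (φ 0 ∘ suc) ∙ diag m (λ i k → diag i (λ j l → φ (suc j) l k)))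
        ≈⟨ assoc _ _ _ ⟨
      diag (suc m) (φ 0) ∙ diag m (λ i k → diag i (λ j l → φ (suc j) l k))
        ≈⟨ ∙-congˡ (diag-assoc m) ⟩
      diag (suc m) (φ 0) ∙ diag m (λ j n → diag n (φ (suc j))) ∎

    diag-swap : ∀ m {φ : ℕ → ℕ → ℕ → Carrier} →
      diag m (λ i n → diag n (λ j k → φ i j k)) ≈ diag m (λ j n → diag n (λ i k → φ i j k))
    diag-swap m {φ} = begin
      diag m (λ i n → diag n (φ i))                     ≈⟨ diag-assoc m {φ} ⟨
      diag m (λ n k → diag n (λ i j → φ i j k))         ≈⟨ diag-cong m (λ n k _ → diag-comm n) ⟩
      diag m (λ n k → diag n (λ j i → φ i j k))         ≈⟨ diag-assoc m {λ j i k → φ i j k} ⟩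
      diag m (λ j n → diag n (λ i k → φ i j k))         ∎

    diag-corner : ∀ m {φ} → (∀ i j → φ i (suc j) ≈ ε) → diag m φ ≈ φ m 0
    diag-corner zero    h = refl
    diag-corner (suc m) h = trans (∙-cong (h 0 m) (diag-corner m λ i → h (suc i))) (identityˡ _)

    diag-head : ∀ m {φ} → (∀ i j → φ (suc i) j ≈ ε) → diag m φ ≈ φ 0 m
    diag-head zero    h = refl
    diag-head (suc m) h = trans (∙-congˡ (diag-ε m λ i j _ → h i j)) (identityʳ _)

    diag-⨁ : ∀ m {A : Set} (xs : List A) {φ : ℕ → ℕ → A → Carrier} →
      diag m (λ i j → ⨁ xs (φ i j)) ≈ ⨁ xs (λ x → diag m (λ i j → φ i j x))
    diag-⨁ zero    xs = refl
    diag-⨁ (suc m) xs = trans (∙-congˡ (diag-⨁ m xs)) (sym (⨁-∙ xs))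

    ⨁-applyUpTo : ∀ (h : ℕ → ℕ) n {f} → ⨁ (applyUpTo h n) f ≈ ⨁ (upTo n) (f ∘ h)
    ⨁-applyUpTo h zero    = refl
    ⨁-applyUpTo h (suc n) {f} = ∙-congˡ (begin
      ⨁ (applyUpTo (h ∘ suc) n) f  ≈⟨ ⨁-applyUpTo (h ∘ suc) n ⟩
      ⨁ (upTo n) (f ∘ h ∘ suc)     ≈⟨ ⨁-applyUpTo suc n ⟨
      ⨁ (applyUpTo suc n) (f ∘ h)  ∎)

    -- The products of series are defined with `upTo` and truncated subtraction; `diag` avoids the
    -- subtraction and allows structural induction on `m`.
    ⨁-upTo : ∀ m {φ} → ⨁ (upTo (suc m)) (λ i → φ i (m ∸ i)) ≈ diag m φ
    ⨁-upTo zero        = identityʳ _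
    ⨁-upTo (suc m) {φ} = ∙-congˡ (trans (⨁-applyUpTo suc (suc m)) (⨁-upTo m {φ ∘ suc}))

  module RingSums (R : CommutativeRing 0ℓ 0ℓ) where
    open CommutativeRing R
    open BigOp +-commutativeMonoid public

    *-⨁ : ∀ {A : Set} (xs : List A) {a f} → a * ⨁ xs f ≈ ⨁ xs (λ x → a * f x)
    *-⨁ []       = zeroʳ _
    *-⨁ (x ∷ xs) = trans (distribˡ _ _ _) (+-congˡ (*-⨁ xs))

    ⨁-* : ∀ {A : Set} (xs : List A) {a f} → ⨁ xs f * a ≈ ⨁ xs (λ x → f x * a)
    ⨁-* []       = zeroˡ _
    ⨁-* (x ∷ xs) = trans (distribʳ _ _ _) (+-congˡ (⨁-* xs))

    *-diag : ∀ m {a φ} → a * diag m φ ≈ diag m (λ i j → a * φ i j)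
    *-diag zero    = refl
    *-diag (suc m) = trans (distribˡ _ _ _) (+-congˡ (*-diag m))

    diag-* : ∀ m {a φ} → diag m φ * a ≈ diag m (λ i j → φ i j * a)
    diag-* zero    = refl
    diag-* (suc m) = trans (distribʳ _ _ _) (+-congˡ (diag-* m))

    *-guard : ∀ {P} (d : Dec P) {a x} → a * guard d x ≈ guard d (a * x)
    *-guard (yes _) = refl
    *-guard (no _)  = zeroʳ _

    -- Coefficients of products of power series in z.
    ⟦_⟧ : List (ℕ → Carrier) → ℕ → Carrier
    ⟦ [] ⟧     zero    = 1#
    ⟦ [] ⟧     (suc _) = 0#
    ⟦ F ∷ Fs ⟧ m       = diag m (λ i j → F i * ⟦ Fs ⟧ j)

    ⟦⟧-cong : ∀ {F H Fs} m → (∀ i → F i ≈ H i) → ⟦ F ∷ Fs ⟧ m ≈ ⟦ H ∷ Fs ⟧ m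
    ⟦⟧-cong m F≈H = diag-cong m λ i _ _ → *-congʳ (F≈H i)

    ⟦⟧-swap : ∀ {F H Fs} m → ⟦ F ∷ H ∷ Fs ⟧ m ≈ ⟦ H ∷ F ∷ Fs ⟧ m
    ⟦⟧-swap {F} {H} {Fs} m = begin
      diag m (λ i n → F i * diag n (λ j k → H j * ⟦ Fs ⟧ k))   ≈⟨ diag-cong m (λ _ n _ → *-diag n) ⟩
      diag m (λ i n → diag n (λ j k → F i * (H j * ⟦ Fs ⟧ k))) ≈⟨ diag-swap m {λ i j k → F i * (H j * ⟦ Fs ⟧ k)} ⟩
      diag m (λ j n → diag n (λ i k → F i * (H j * ⟦ Fs ⟧ k))) ≈⟨ diag-cong m (λ _ n _ → diag-cong n λ _ _ _ → x∙yz≈y∙xz _ _ _) ⟩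
      diag m (λ j n → diag n (λ i k → H j * (F i * ⟦ Fs ⟧ k))) ≈⟨ diag-cong m (λ _ n _ → *-diag n) ⟨
      diag m (λ j n → H j * diag n (λ i k → F i * ⟦ Fs ⟧ k))   ∎
      where
      open import Relation.Binary.Reasoning.Setoid setoid
      open import Algebra.Properties.CommutativeSemigroup *-commutativeSemigroup using (x∙yz≈y∙xz)

    ⟦⟧-+ : ∀ {F H Fs} m → ⟦ (λ i → F i + H i) ∷ Fs ⟧ m ≈ ⟦ F ∷ Fs ⟧ m + ⟦ H ∷ Fs ⟧ m
    ⟦⟧-+ m = trans (diag-cong m λ _ _ _ → distribʳ _ _ _) (diag-∙ m)

-- Generating functions of words without equal adjacent letters.

module SmirnovWords where

  open import Algebra.Bundles using (CommutativeRing)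
  open import Data.Fin.Base using (Fin; zero; suc)
  open import Data.Fin.Properties using () renaming (_≟_ to _≟ᶠ_)
  open import Data.List.Base using (List; []; _∷_; map; upTo; applyUpTo; allFin; tabulate; replicate)
  open import Data.List.Membership.Propositional.Properties using (∈-allFin)
  import Data.List.Relation.Unary.Unique.Propositional.Properties as Unique
  open import Data.Nat.Base using (ℕ; zero; suc; _∸_; _≤_; s≤s)
  open import Data.Nat.Properties as ℕₚ using ()
  open import Function.Base using (_∘_)
  open import Level using (0ℓ)
  open import Relation.Binary.PropositionalEquality as ≡ using (_≡_)
  open import Relation.Nullary using (Dec; yes; no; ¬?)
  open Sums

  -- The coefficients of e_k zᵏ in I, G, e₂ z², G≥3 and K - e₂ z². Thus `g` is the sum of `g₂` and
  -- `g₃`, and `κ 2` is 2 - 1. All of them vanish at 0.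
  ι g g₂ g₃ κ : ℕ → ℕ
  ι k = k
  g k = k ∸ 1
  g₂ 2 = 1
  g₂ _ = 0
  g₃ (suc (suc (suc k))) = suc (suc k)
  g₃ _ = 0
  κ 2 = 1
  κ (suc (suc (suc k))) = suc (suc (suc k))
  κ _ = 0

  -- The factors of the summands of 𝒳 / 2 = (K - e₂ z²) + Σ_l I G≥3 Gˡ.
  Ψ : ℕ → List (ℕ → ℕ)
  Ψ zero    = κ ∷ []
  Ψ (suc l) = ι ∷ g₃ ∷ replicate l g

  module Path (R : CommutativeRing 0ℓ 0ℓ) where
    open CommutativeRing R hiding (zero)
    open RingSums R
    open import Algebra.Properties.Semiring.Mult semiring renaming (_×_ to _⨯_)
    open import Algebra.Properties.AbelianGroup +-abelianGroup using (∙-cancelˡ)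
    open import Algebra.Solver.Ring.NaturalCoefficients.Default commutativeSemiring using (solve; _:+_; _:*_; _:=_; con)
    open import Relation.Binary.Reasoning.Setoid setoid

    ⨁-tabulate : ∀ {A : Set} {n} (h : Fin n → A) {f} → ⨁ (tabulate h) f ≈ ⨁ (allFin n) (f ∘ h)
    ⨁-tabulate {n = zero}  h     = refl
    ⨁-tabulate {n = suc n} h {f} = +-congˡ (trans (⨁-tabulate (h ∘ suc)) (sym (⨁-tabulate suc {f ∘ h})))

    +-minus : ∀ a b → a ≈ b + (a - b)
    +-minus a b = begin
      a              ≈⟨ +-identityʳ a ⟨
      a + 0#         ≈⟨ +-congˡ (-‿inverseʳ b) ⟨
      a + (b - b)    ≈⟨ +-assoc _ _ _ ⟨
      a + b - b      ≈⟨ +-congʳ (+-comm a b) ⟩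
      b + a - b      ≈⟨ +-assoc _ _ _ ⟩
      b + (a - b)    ∎

    -- e x k and ê x i k are the elementary symmetric polynomials of degree k in
    -- all the variables x, respectively in all but the i-th.
    e : ∀ {N} → (Fin N → Carrier) → ℕ → Carrier
    e         x zero    = 1#
    e {zero}  x (suc k) = 0#
    e {suc N} x (suc k) = e (x ∘ suc) (suc k) + x zero * e (x ∘ suc) k

    ê : ∀ {N} → (Fin N → Carrier) → Fin N → ℕ → Carrier
    ê x zero    k       = e (x ∘ suc) k
    ê x (suc i) zero    = 1#
    ê x (suc i) (suc k) = ê (x ∘ suc) i (suc k) + x zero * ê (x ∘ suc) i k

    ê-zero : ∀ {N} (x : Fin N → Carrier) i → ê x i 0 ≈ 1#
    ê-zero x zero    = refl
    ê-zero x (suc i) = refl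

    e-split : ∀ {N} (x : Fin N → Carrier) i k → e x (suc k) ≈ ê x i (suc k) + x i * ê x i k
    e-split x zero k = refl
    e-split x (suc i) zero = begin
      e xs 1 + x zero * 1#                              ≈⟨ +-cong (e-split xs i 0) (*-congˡ (sym (ê-zero xs i))) ⟩
      ê xs i 1 + xs i * ê xs i 0 + x zero * ê xs i 0    ≈⟨ solve 4 (λ a b c d → a :+ b :* c :+ d :* c := a :+ d :* c :+ b :* c) refl _ _ _ _ ⟩
      ê xs i 1 + x zero * ê xs i 0 + xs i * ê xs i 0    ≈⟨ +-congˡ (*-congˡ (ê-zero xs i)) ⟩
      ê xs i 1 + x zero * ê xs i 0 + xs i * 1#          ∎
      where xs = x ∘ suc
    e-split x (suc i) (suc k) = begin
      e xs (suc (suc k)) + x zero * e xs (suc k)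
        ≈⟨ +-cong (e-split xs i (suc k)) (*-congˡ (e-split xs i k)) ⟩
      ê xs i (suc (suc k)) + xs i * ê xs i (suc k) + x zero * (ê xs i (suc k) + xs i * ê xs i k)
        ≈⟨ solve 5 (λ a b c d f → a :+ b :* c :+ d :* (c :+ b :* f) := a :+ d :* c :+ b :* (c :+ d :* f)) refl _ _ _ _ _ ⟩
      ê xs i (suc (suc k)) + x zero * ê xs i (suc k) + xs i * (ê xs i (suc k) + x zero * ê xs i k) ∎
      where xs = x ∘ suc

    -- Pairs of a set of size k + 1 and one of its elements: every set is counted k + 1 times.
    ∑xê : ∀ {N} (x : Fin N → Carrier) k → ⨁ (allFin N) (λ i → x i * ê x i k) ≈ suc k ⨯ e x (suc k)
    ∑xê {zero}  x zero    = sym (+-identityʳ 0#)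
    ∑xê {zero}  x (suc k) = sym (trans (+-identityˡ _) (0⨯ (suc k)))
      where
      0⨯ : ∀ n → n ⨯ 0# ≈ 0#
      0⨯ zero    = refl
      0⨯ (suc n) = trans (+-identityˡ _) (0⨯ n)
    ∑xê {suc N} x zero = begin
      x zero * 1# + ⨁ (tabulate suc) (λ i → x i * ê x i 0)       ≈⟨ +-congˡ (⨁-tabulate {n = N} Fin.suc {λ i → x i * ê x i 0}) ⟩
      x zero * 1# + ⨁ (allFin N) (λ i → xs i * 1#)               ≈⟨ +-congˡ (⨁-cong (allFin N) λ i → *-congˡ (ê-zero xs i)) ⟨
      x zero * 1# + ⨁ (allFin N) (λ i → xs i * ê xs i 0)         ≈⟨ +-congˡ (∑xê xs 0) ⟩
      x zero * 1# + (e xs 1 + 0#)                                ≈⟨ solve 2 (λ a b → a :+ (b :+ con 0) := b :+ a :+ con 0) refl _ _ ⟩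
      e xs 1 + x zero * 1# + 0#                                  ∎
      where xs = x ∘ suc
    ∑xê {suc N} x (suc k) = begin
      x zero * e xs (suc k) + ⨁ (tabulate suc) (λ i → x i * ê x i (suc k))
        ≈⟨ +-congˡ (⨁-tabulate {n = N} Fin.suc {λ i → x i * ê x i (suc k)}) ⟩
      x zero * e xs (suc k) + ⨁ (allFin N) (λ i → xs i * (ê xs i (suc k) + x zero * ê xs i k))
        ≈⟨ +-congˡ (⨁-cong (allFin N) λ i → solve 4 (λ a b c d → a :* (b :+ c :* d) := a :* b :+ c :* (a :* d)) refl _ _ _ _) ⟩
      x zero * e xs (suc k) + ⨁ (allFin N) (λ i → xs i * ê xs i (suc k) + x zero * (xs i * ê xs i k))
        ≈⟨ +-congˡ (⨁-∙ (allFin N)) ⟩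
      x zero * e xs (suc k) + (⨁ (allFin N) (λ i → xs i * ê xs i (suc k)) + ⨁ (allFin N) (λ i → x zero * (xs i * ê xs i k)))
        ≈⟨ +-congˡ (+-cong (∑xê xs (suc k)) (sym (*-⨁ (allFin N)))) ⟩
      x zero * e xs (suc k) + (suc (suc k) ⨯ e xs (suc (suc k)) + x zero * ⨁ (allFin N) (λ i → xs i * ê xs i k))
        ≈⟨ +-congˡ (+-congˡ (trans (*-congˡ (∑xê xs k)) (×-comm-* (suc k) _ _))) ⟩
      x zero * e xs (suc k) + (suc (suc k) ⨯ e xs (suc (suc k)) + suc k ⨯ (x zero * e xs (suc k)))
        ≈⟨ solve 3 (λ a b c → a :+ (b :+ c) := b :+ (a :+ c)) refl _ _ _ ⟩
      suc (suc k) ⨯ e xs (suc (suc k)) + suc (suc k) ⨯ (x zero * e xs (suc k))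
        ≈⟨ ×-distrib (suc (suc k)) _ _ ⟨
      suc (suc k) ⨯ (e xs (suc (suc k)) + x zero * e xs (suc k)) ∎
      where
      xs = x ∘ suc
      ×-distrib : ∀ n a b → n ⨯ (a + b) ≈ n ⨯ a + n ⨯ b
      ×-distrib zero    a b = sym (+-identityʳ 0#)
      ×-distrib (suc n) a b = trans (+-congˡ (×-distrib n a b)) (solve 4 (λ a b c d → a :+ b :+ (c :+ d) := a :+ c :+ (b :+ d)) refl _ _ _ _)

    ⟪_⟫ : (ℕ → Carrier) → (ℕ → ℕ) → ℕ → Carrier
    ⟪ ϵ ⟫ φ k = φ k ⨯ ϵ k

    module _ {N : ℕ} (x : Fin N → Carrier) where

      private
        Fins = allFin N

      -- P n is the sum of the monomials of all words of length n over Fin N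
      -- without equal adjacent letters; A n i is the part of it from the words
      -- beginning with i.
      P : ℕ → Carrier
      A : ℕ → Fin N → Carrier
      P zero    = 1#
      P (suc n) = ⨁ Fins (A (suc n))
      A zero    i = 0#
      A (suc n) i = x i * (P n - A n i)

      private
        -- The part of `P` from nonempty words, that is, those having a first letter.
        p : ℕ → Carrier
        p n = ⨁ Fins (A n)

        p-zero : p 0 ≈ 0#
        p-zero = ⨁-ε Fins λ _ _ → refl

        -- The pairs (S, w) with |S| = k and |w| = n in which the first letter of w belongs to S.
        -- These are the pairs left over by the bijection, on both of its sides.
        Q : ℕ → ℕ → Carrier
        Q zero    n = 0#
        Q (suc k) n = ⨁ Fins (λ i → x i * ê x i k * A n i)

        Q-zeroʳ : ∀ k → Q k 0 ≈ 0#
        Q-zeroʳ zero    = refl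
        Q-zeroʳ (suc k) = ⨁-ε Fins λ _ _ → zeroʳ _

        -- The bijection for |S| = k and |w| = n + 1, with the leftover pairs added to both sides.
        -- All pairs (S, w) are those with first letter outside S and those of `Q k (suc n)`. All
        -- triples (i, S′, w′) with i in S′ are those where w′ does not begin with i and those of
        -- `Q (suc k) n`.
        Q-step : ∀ k n → e x k * p (suc n) + Q (suc k) n ≈ suc k ⨯ e x (suc k) * P n + Q k (suc n)
        Q-step k n = begin
          e x k * p (suc n) + Q (suc k) n
            ≈⟨ +-congʳ (*-⨁ Fins) ⟩
          ⨁ Fins (λ i → e x k * A (suc n) i) + ⨁ Fins (λ i → x i * ê x i k * A n i)
            ≈⟨ ⨁-∙ Fins ⟨
          ⨁ Fins (λ i → e x k * A (suc n) i + x i * ê x i k * A n i)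
            ≈⟨ ⨁-cong Fins (λ i → term k i) ⟩
          ⨁ Fins (λ i → x i * ê x i k * P n + q k i)
            ≈⟨ ⨁-∙ Fins ⟩
          ⨁ Fins (λ i → x i * ê x i k * P n) + ⨁ Fins (q k)
            ≈⟨ +-cong (trans (sym (⨁-* Fins)) (*-congʳ (∑xê x k))) (∑q k) ⟩
          suc k ⨯ e x (suc k) * P n + Q k (suc n) ∎
          where
          q : ℕ → Fin N → Carrier
          q zero    i = 0#
          q (suc k) i = x i * ê x i k * A (suc n) i

          ∑q : ∀ k → ⨁ Fins (q k) ≈ Q k (suc n)
          ∑q zero    = ⨁-ε Fins λ _ _ → refl
          ∑q (suc k) = refl

          term : ∀ k i → e x k * A (suc n) i + x i * ê x i k * A n i ≈ x i * ê x i k * P n + q k i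
          term zero i = begin
            1# * (x i * D) + x i * ê x i 0 * a    ≈⟨ +-congʳ (*-congʳ (ê-zero x i)) ⟨
            ê x i 0 * (x i * D) + x i * ê x i 0 * a ≈⟨ solve 4 (λ b c d f → b :* (c :* d) :+ c :* b :* f := c :* b :* (f :+ d) :+ con 0) refl _ _ _ _ ⟩
            x i * ê x i 0 * (a + D) + 0#          ≈⟨ +-congʳ (*-congˡ (+-minus _ _)) ⟨
            x i * ê x i 0 * P n + 0#              ∎
            where D = P n - A n i; a = A n i
          term (suc k) i = begin
            e x (suc k) * (x i * D) + x i * ê x i (suc k) * a
              ≈⟨ +-congʳ (*-congʳ (e-split x i k)) ⟩
            (ê x i (suc k) + x i * ê x i k) * (x i * D) + x i * ê x i (suc k) * a
              ≈⟨ solve 5 (λ b c d f h → (b :+ c :* h) :* (c :* d) :+ c :* b :* f := c :* b :* (f :+ d) :+ c :* h :* (c :* d)) refl _ _ _ _ _ ⟩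
            x i * ê x i (suc k) * (a + D) + x i * ê x i k * (x i * D)
              ≈⟨ +-congʳ (*-congˡ (+-minus _ _)) ⟨
            x i * ê x i (suc k) * P n + x i * ê x i k * (x i * D) ∎
            where D = P n - A n i; a = A n i

        -- Only the empty word distinguishes `P` from `p`, and in degree `m` it is paired with
        -- `F m`.
        P-p : ∀ m (F : ℕ → Carrier) → diag m (λ k n → F k * P n) ≈ F m + diag m (λ k n → F k * p n)
        P-p m F = begin
          diag m (λ k n → F k * P n)                     ≈⟨ diag-cong m (λ k n _ → eq k n) ⟩
          diag m (λ k n → δ k n + F k * p n)             ≈⟨ diag-∙ m ⟩
          diag m δ + diag m (λ k n → F k * p n)          ≈⟨ +-congʳ (diag-corner m λ _ _ → refl) ⟩
          F m + diag m (λ k n → F k * p n)               ∎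
          where
          δ : ℕ → ℕ → Carrier
          δ k zero    = F k
          δ k (suc _) = 0#
          eq : ∀ k n → F k * P n ≈ δ k n + F k * p n
          eq k zero    = sym (trans (+-cong (sym (*-identityʳ _)) (trans (*-congˡ p-zero) (zeroʳ _))) (+-identityʳ _))
          eq k (suc n) = sym (+-identityˡ _)

        -- The telescoped identity, with the summand k = 0 of the left side (where e₀ = 1) isolated
        -- as `p (suc m)`. The other summands on the left form `s`, which is also contained in the
        -- right side and cancels; this lowers the factor k + 1 to k.
        path-recurrence : ∀ m → p (suc m) ≈ suc m ⨯ e x (suc m) + diag m (λ k n → k ⨯ e x (suc k) * p n)
        path-recurrence m = ∙-cancelˡ s _ _ (begin
          s + p (suc m)                                      ≈⟨ +-comm _ _ ⟩
          p (suc m) + s                                      ≈⟨ +-congʳ (*-identityˡ _) ⟨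
          diag (suc m) (λ k n → e x k * p n)                 ≈⟨ diag-last m {λ k n → e x k * p n} ⟩
          diag m (λ k n → e x k * p (suc n)) + e x (suc m) * p 0
                                                             ≈⟨ +-congˡ (trans (*-congˡ p-zero) (zeroʳ _)) ⟩
          diag m (λ k n → e x k * p (suc n)) + 0#            ≈⟨ +-identityʳ _ ⟩
          diag m (λ k n → e x k * p (suc n))                 ≈⟨ telescope ⟩
          diag m (λ k n → suc k ⨯ e x (suc k) * P n)         ≈⟨ P-p m (λ k → suc k ⨯ e x (suc k)) ⟩
          suc m ⨯ e x (suc m) + diag m (λ k n → suc k ⨯ e x (suc k) * p n)
                                                             -- One of the k + 1 copies of e_{k+1}
                                                             -- is split off from each summand;
                                                             -- together these copies form `s`.
                                                             ≈⟨ +-congˡ (trans (diag-cong m (λ _ _ _ → distribʳ _ _ _)) (diag-∙ m)) ⟩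
          suc m ⨯ e x (suc m) + (s + diag m (λ k n → k ⨯ e x (suc k) * p n))
                                                             ≈⟨ solve 3 (λ a b c → a :+ (b :+ c) := b :+ (a :+ c)) refl _ _ _ ⟩
          s + (suc m ⨯ e x (suc m) + diag m (λ k n → k ⨯ e x (suc k) * p n)) ∎)
          where
          s = diag m (λ k n → e x (suc k) * p n)

          -- Both sides are the full antidiagonal sum of `Q` in degree m + 1 without one end term.
          -- The end terms are zero: the empty set contains no letter and the empty word has no
          -- first letter.
          shift : diag m (λ k n → Q (suc k) n) ≈ diag m (λ k n → Q k (suc n))
          shift = begin
            diag m (λ k n → Q (suc k) n)              ≈⟨ +-identityˡ _ ⟨
            diag (suc m) Q                            ≈⟨ diag-last m {Q} ⟩
            diag m (λ k n → Q k (suc n)) + Q (suc m) 0 ≈⟨ +-congˡ (Q-zeroʳ (suc m)) ⟩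
            diag m (λ k n → Q k (suc n)) + 0#         ≈⟨ +-identityʳ _ ⟩
            diag m (λ k n → Q k (suc n))              ∎

          telescope : diag m (λ k n → e x k * p (suc n)) ≈ diag m (λ k n → suc k ⨯ e x (suc k) * P n)
          telescope = ∙-cancelˡ (diag m (λ k n → Q k (suc n))) _ _ (begin
            diag m (λ k n → Q k (suc n)) + diag m (λ k n → e x k * p (suc n))
              ≈⟨ +-congʳ shift ⟨
            diag m (λ k n → Q (suc k) n) + diag m (λ k n → e x k * p (suc n))
              ≈⟨ +-comm _ _ ⟩
            diag m (λ k n → e x k * p (suc n)) + diag m (λ k n → Q (suc k) n)
              ≈⟨ diag-∙ m ⟨
            diag m (λ k n → e x k * p (suc n) + Q (suc k) n)
              ≈⟨ diag-cong m (λ k n _ → Q-step k n) ⟩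
            diag m (λ k n → suc k ⨯ e x (suc k) * P n + Q k (suc n))
              ≈⟨ diag-∙ m ⟩
            diag m (λ k n → suc k ⨯ e x (suc k) * P n) + diag m (λ k n → Q k (suc n))
              ≈⟨ +-comm _ _ ⟩
            diag m (λ k n → Q k (suc n)) + diag m (λ k n → suc k ⨯ e x (suc k) * P n) ∎)

        W : (ℕ → ℕ) → ℕ → Carrier
        W = ⟪ e x ⟫

        Ws : List (ℕ → ℕ) → ℕ → Carrier
        Ws Φ = ⟦ map W Φ ⟧

        Ws-single : ∀ φ m → Ws (φ ∷ []) m ≈ W φ m
        Ws-single φ m = trans (diag-corner m {λ i j → W φ i * ⟦ [] ⟧ j} λ i j → zeroʳ _) (*-identityʳ _)

        -- Iteration of the recurrence, each round contributing one factor `g`. The degree drops in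
        -- every round, so at most `m` rounds matter. The bound `B` is left free because sums of the
        -- same length are later compared in degrees m and m + 2.
        path-expansion : ∀ B m → m ≤ B → p m ≈ ⨁ (upTo B) (λ l → Ws (ι ∷ replicate l g) m)
        path-expansion B zero _ = trans p-zero (sym (⨁-ε (upTo B) λ _ _ → zeroˡ _))
        path-expansion (suc B) (suc m) (s≤s m≤B) = begin
          p (suc m)
            ≈⟨ path-recurrence m ⟩
          W ι (suc m) + diag m (λ k n → W g (suc k) * p n)
            ≈⟨ +-cong (sym (Ws-single ι (suc m))) (diag-cong m λ k n k+n≡m → *-congˡ
                 (path-expansion B n (ℕₚ.≤-trans (ℕₚ.m≤n+m n k) (ℕₚ.≤-trans (ℕₚ.≤-reflexive k+n≡m) m≤B)))) ⟩
          Ws (ι ∷ []) (suc m) + diag m (λ k n → W g (suc k) * ⨁ (upTo B) (λ l → Ws (ι ∷ replicate l g) n))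
            ≈⟨ +-congˡ (diag-cong m λ _ _ _ → *-⨁ (upTo B)) ⟩
          Ws (ι ∷ []) (suc m) + diag m (λ k n → ⨁ (upTo B) (λ l → W g (suc k) * Ws (ι ∷ replicate l g) n))
            ≈⟨ +-congˡ (diag-⨁ m (upTo B)) ⟩
          Ws (ι ∷ []) (suc m) + ⨁ (upTo B) (λ l → diag m (λ k n → W g (suc k) * Ws (ι ∷ replicate l g) n))
            -- The missing summand with `W g 0` is zero, so the sum is a full convolution; the new
            -- factor `g` is then moved behind `ι`.
            ≈⟨ +-congˡ (⨁-cong (upTo B) λ l → trans (sym (trans (+-congʳ (zeroˡ _)) (+-identityˡ _))) (⟦⟧-swap {W g} {W ι} {map W (replicate l g)} (suc m))) ⟩
          Ws (ι ∷ []) (suc m) + ⨁ (upTo B) (λ l → Ws (ι ∷ replicate (suc l) g) (suc m))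
            ≈⟨ +-congˡ (⨁-applyUpTo suc B) ⟨
          ⨁ (upTo (suc B)) (λ l → Ws (ι ∷ replicate l g) (suc m)) ∎

        W-g : ∀ k → W g k ≈ W g₂ k + W g₃ k
        W-g zero                = sym (+-identityʳ _)
        W-g (suc zero)          = sym (+-identityʳ _)
        W-g (suc (suc zero))    = sym (+-identityʳ _)
        W-g (suc (suc (suc k))) = sym (+-identityˡ _)

        Ws-g₂ : ∀ l m → Ws (ι ∷ g₂ ∷ replicate l g) (suc (suc m)) ≈ e x 2 * Ws (ι ∷ replicate l g) m
        Ws-g₂ l m = begin
          Ws (ι ∷ g₂ ∷ replicate l g) (suc (suc m))
            ≈⟨ ⟦⟧-swap {W ι} {W g₂} {map W (replicate l g)} (suc (suc m)) ⟩
          0# * Z (suc (suc m)) + (0# * Z (suc m) + diag m (λ i j → W g₂ (suc (suc i)) * Z j))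
            ≈⟨ solve 3 (λ a b c → con 0 :* a :+ (con 0 :* b :+ c) := c) refl _ _ _ ⟩
          diag m (λ i j → W g₂ (suc (suc i)) * Z j)
            ≈⟨ diag-head m (λ i j → zeroˡ _) ⟩
          (e x 2 + 0#) * Z m
            ≈⟨ *-congʳ (+-identityʳ _) ⟩
          e x 2 * Z m ∎
          where Z = Ws (ι ∷ replicate l g)

        -- Replacing `p` by `P` adds a term e₂ exactly when m = 0, that is in degree 2, and there
        -- `κ` is smaller than `ι` by one.
        ι-κ : ∀ m → W ι (suc (suc m)) + e x 2 * p m ≈ W κ (suc (suc m)) + e x 2 * P m
        ι-κ zero    = begin
          e x 2 + (e x 2 + 0#) + e x 2 * p 0  ≈⟨ +-congˡ (trans (*-congˡ p-zero) (zeroʳ _)) ⟩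
          e x 2 + (e x 2 + 0#) + 0#           ≈⟨ solve 1 (λ a → a :+ (a :+ con 0) :+ con 0 := a :+ con 0 :+ a :* con 1) refl _ ⟩
          e x 2 + 0# + e x 2 * 1#             ∎
        ι-κ (suc m) = refl

        -- The first factor `g` of every term with at least one is split into `g₂` and `g₃`. The
        -- `g₂` terms sum up to e₂ `p m` by the expansion in degree m; the `g₃` terms are the later
        -- members of `Ψ`.
        path-Ψ : ∀ m → P (suc (suc m)) ≈ e x 2 * P m + ⨁ (upTo (suc (suc m))) (λ l → Ws (Ψ l) (suc (suc m)))
        path-Ψ m = begin
          p M
            ≈⟨ path-expansion M M ℕₚ.≤-refl ⟩
          Ws (ι ∷ []) M + ⨁ (applyUpTo suc (suc m)) (λ l → Ws (ι ∷ replicate l g) M)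
            ≈⟨ +-cong (Ws-single ι M) (⨁-applyUpTo suc (suc m)) ⟩
          W ι M + ⨁ (upTo (suc m)) (λ l → Ws (ι ∷ g ∷ replicate l g) M)
            ≈⟨ +-congˡ (⨁-cong (upTo (suc m)) λ l → split l) ⟩
          W ι M + ⨁ (upTo (suc m)) (λ l → e x 2 * Ws (ι ∷ replicate l g) m + Ws (Ψ (suc l)) M)
            ≈⟨ +-congˡ (⨁-∙ (upTo (suc m))) ⟩
          W ι M + (⨁ (upTo (suc m)) (λ l → e x 2 * Ws (ι ∷ replicate l g) m) + S)
            ≈⟨ +-congˡ (+-congʳ (*-⨁ (upTo (suc m)))) ⟨
          W ι M + (e x 2 * ⨁ (upTo (suc m)) (λ l → Ws (ι ∷ replicate l g) m) + S)
            ≈⟨ +-congˡ (+-congʳ (*-congˡ (path-expansion (suc m) m (ℕₚ.n≤1+n m)))) ⟨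
          W ι M + (e x 2 * p m + S)
            ≈⟨ +-assoc _ _ _ ⟨
          W ι M + e x 2 * p m + S
            ≈⟨ +-congʳ (ι-κ m) ⟩
          W κ M + e x 2 * P m + S
            ≈⟨ solve 3 (λ a b c → a :+ b :+ c := b :+ (a :+ c)) refl _ _ _ ⟩
          e x 2 * P m + (W κ M + S)
            ≈⟨ +-congˡ (+-cong (Ws-single κ M) (⨁-applyUpTo suc (suc m))) ⟨
          e x 2 * P m + ⨁ (upTo M) (λ l → Ws (Ψ l) M) ∎
          where
          M = suc (suc m)
          S = ⨁ (upTo (suc m)) (λ l → Ws (Ψ (suc l)) M)
          split : ∀ l → Ws (ι ∷ g ∷ replicate l g) M ≈ e x 2 * Ws (ι ∷ replicate l g) m + Ws (Ψ (suc l)) M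
          split l = begin
            Ws (ι ∷ g ∷ r) M                      ≈⟨ ⟦⟧-swap {W ι} {W g} {map W r} M ⟩
            Ws (g ∷ ι ∷ r) M                      ≈⟨ ⟦⟧-cong {Fs = map W (ι ∷ r)} M W-g ⟩
            ⟦ (λ i → W g₂ i + W g₃ i) ∷ map W (ι ∷ r) ⟧ M ≈⟨ ⟦⟧-+ {W g₂} {W g₃} {map W (ι ∷ r)} M ⟩
            Ws (g₂ ∷ ι ∷ r) M + Ws (g₃ ∷ ι ∷ r) M ≈⟨ +-cong (⟦⟧-swap {W g₂} {W ι} {map W r} M) (⟦⟧-swap {W g₃} {W ι} {map W r} M) ⟩
            Ws (ι ∷ g₂ ∷ r) M + Ws (ι ∷ g₃ ∷ r) M ≈⟨ +-congʳ (Ws-g₂ l m) ⟩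
            e x 2 * Ws (ι ∷ r) m + Ws (ι ∷ g₃ ∷ r) M ∎
            where r = replicate l g

      ≢-sum : (Fin N → Carrier) → Fin N → Carrier
      ≢-sum f i = ⨁ Fins (λ j → guard (¬? (i ≟ᶠ j)) (f j))

      ⨁-≢ : ∀ f i → ⨁ Fins f ≈ f i + ≢-sum f i
      ⨁-≢ f i = begin
        ⨁ Fins f                                                                  ≈⟨ ⨁-cong Fins (λ j → split j) ⟩
        ⨁ Fins (λ j → guard (i ≟ᶠ j) (f j) + guard (¬? (i ≟ᶠ j)) (f j))     ≈⟨ ⨁-∙ Fins ⟩
        ⨁ Fins (λ j → guard (i ≟ᶠ j) (f j)) + ≢-sum f i                        ≈⟨ +-congʳ (⨁-single (Unique.allFin⁺ N) (∈-allFin i) λ j _ j≢i → guard-no (i ≟ᶠ j) (j≢i ∘ ≡.sym)) ⟩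
        guard (i ≟ᶠ i) (f i) + ≢-sum f i                                       ≈⟨ +-congʳ (guard-yes (i ≟ᶠ i) ≡.refl) ⟩
        f i + ≢-sum f i                                                           ∎
        where
        split : ∀ j → f j ≈ guard (i ≟ᶠ j) (f j) + guard (¬? (i ≟ᶠ j)) (f j)
        split j with i ≟ᶠ j
        ... | yes _ = sym (+-identityʳ _)
        ... | no _  = sym (+-identityˡ _)

      -- The sum of the monomials of all words ijw without equal adjacent letters,
      -- |w| = m, with i also different from the first letter of w.
      T : ℕ → Carrier
      T m = ⨁ Fins (λ i → ⨁ Fins (λ j → guard (¬? (i ≟ᶠ j)) (x i * (x j * (P m - A m i - A m j)))))

      private
        pairs : (Fin N → Fin N → Carrier) → Carrier
        pairs f = ⨁ Fins (λ i → ⨁ Fins (λ j → guard (¬? (i ≟ᶠ j)) (f i j)))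

        pairs-cong : ∀ {f h} → (∀ i j → f i j ≈ h i j) → pairs f ≈ pairs h
        pairs-cong f≈h = ⨁-cong Fins λ i → ⨁-cong Fins λ j → guard-congʳ (¬? (i ≟ᶠ j)) (f≈h i j)

        pairs-+ : ∀ {f h} → pairs (λ i j → f i j + h i j) ≈ pairs f + pairs h
        pairs-+ = trans (⨁-cong Fins λ i → trans (⨁-cong Fins λ j → guard-+ (¬? (i ≟ᶠ j))) (⨁-∙ Fins)) (⨁-∙ Fins)
          where
          guard-+ : ∀ {Z} (d : Dec Z) {a b} → guard d (a + b) ≈ guard d a + guard d b
          guard-+ (yes _) = refl
          guard-+ (no _)  = sym (+-identityʳ 0#)

        pairs-comm : ∀ {f} → pairs f ≈ pairs (λ i j → f j i)
        pairs-comm = trans (⨁-swap Fins Fins) (⨁-cong Fins λ i → ⨁-cong Fins λ j →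
          guard-cong (¬? (j ≟ᶠ i)) (¬? (i ≟ᶠ j)) (λ j≢i → j≢i ∘ ≡.sym) (λ i≢j → i≢j ∘ ≡.sym) refl)

        pairs-* : ∀ {f : Fin N → Carrier} {h} → pairs (λ i j → f i * h j) ≈ ⨁ Fins (λ i → f i * ≢-sum h i)
        pairs-* = ⨁-cong Fins λ i → sym (trans (*-⨁ Fins) (⨁-cong Fins λ j → *-guard (¬? (i ≟ᶠ j))))

        P-pairs : ∀ m → P (suc (suc m)) ≈ pairs (λ i j → x i * (x j * (P m - A m j)))
        P-pairs m = trans (⨁-cong Fins λ i → *-congˡ (∙-cancelˡ (A (suc m) i) _ _
          (trans (sym (+-minus _ _)) (⨁-≢ (A (suc m)) i)))) (sym pairs-*)

        e₂-pairs : e x 2 + e x 2 ≈ pairs (λ i j → x i * x j)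
        e₂-pairs = begin
          e x 2 + e x 2                       ≈⟨ +-congˡ (+-identityʳ _) ⟨
          2 ⨯ e x 2                           ≈⟨ ∑xê x 1 ⟨
          ⨁ Fins (λ i → x i * ê x i 1)        ≈⟨ ⨁-cong Fins (λ i → *-congˡ (ê₁ i)) ⟩
          ⨁ Fins (λ i → x i * ≢-sum x i)      ≈⟨ pairs-* ⟨
          pairs (λ i j → x i * x j)           ∎
          where
          e₁ : e x 1 ≈ ⨁ Fins x
          e₁ = sym (trans (⨁-cong Fins λ i → trans (sym (*-identityʳ _)) (*-congˡ (sym (ê-zero x i)))) (trans (∑xê x 0) (+-identityʳ _)))
          ê₁ : ∀ i → ê x i 1 ≈ ≢-sum x i
          ê₁ i = ∙-cancelˡ (x i) _ _ (begin
            x i + ê x i 1                ≈⟨ +-comm _ _ ⟩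
            ê x i 1 + x i                ≈⟨ +-congˡ (trans (sym (*-identityʳ _)) (*-congˡ (sym (ê-zero x i)))) ⟩
            ê x i 1 + x i * ê x i 0      ≈⟨ e-split x i 0 ⟨
            e x 1                        ≈⟨ e₁ ⟩
            ⨁ Fins x                     ≈⟨ ⨁-≢ x i ⟩
            x i + ≢-sum x i              ∎)

      -- Here i and j are the colours of the twinned vertices and w colours the rest. For fixed i ≠
      -- j, the words w avoiding both i and j as first letter, together with all words w, count the
      -- same as those avoiding j together with those avoiding i, since no word begins with both.
      -- The last two families are the proper words ijw and jiw.
      twin-path : ∀ m → T m + (e x 2 + e x 2) * P m ≈ P (suc (suc m)) + P (suc (suc m))
      twin-path m = begin
        T m + (e x 2 + e x 2) * P m
          ≈⟨ +-congˡ (trans (*-congʳ e₂-pairs) (trans (⨁-* Fins) (⨁-cong Fins λ i → trans (⨁-* Fins) (⨁-cong Fins λ j → guard-* (¬? (i ≟ᶠ j)))))) ⟩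
        pairs (λ i j → x i * (x j * (P m - A m i - A m j))) + pairs (λ i j → x i * x j * P m)
          ≈⟨ pairs-+ ⟨
        pairs (λ i j → x i * (x j * (P m - A m i - A m j)) + x i * x j * P m)
          ≈⟨ pairs-cong (λ i j → term (x i) (x j) (P m) (A m i) (A m j)) ⟩
        pairs (λ i j → x i * (x j * (P m - A m j)) + x j * (x i * (P m - A m i)))
          ≈⟨ pairs-+ ⟩
        pairs (λ i j → x i * (x j * (P m - A m j))) + pairs (λ i j → x j * (x i * (P m - A m i)))
          ≈⟨ +-congˡ pairs-comm ⟩
        pairs (λ i j → x i * (x j * (P m - A m j))) + pairs (λ i j → x i * (x j * (P m - A m j)))
          ≈⟨ +-cong (P-pairs m) (P-pairs m) ⟨
        P (suc (suc m)) + P (suc (suc m)) ∎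
        where
        guard-* : ∀ {Z} (d : Dec Z) {a b} → guard d a * b ≈ guard d (a * b)
        guard-* (yes _) = refl
        guard-* (no _)  = zeroˡ _

        -- Nothing cancels in this identity, so the semiring solver suffices, with the negated terms
        -- as atoms.
        term : ∀ a b p c d → a * (b * (p - c - d)) + a * b * p ≈ a * (b * (p - d)) + b * (a * (p - c))
        term a b p c d = solve 5 (λ a b p c d → a :* (b :* (p :+ c :+ d)) :+ a :* b :* p := a :* (b :* (p :+ d)) :+ b :* (a :* (p :+ c))) refl a b p (- c) (- d)

      twin-expansion : ∀ m → T m ≈ 2 ⨯ ⨁ (upTo (suc (suc m))) (λ l → ⟦ map ⟪ e x ⟫ (Ψ l) ⟧ (suc (suc m)))
      twin-expansion m = ∙-cancelˡ ((e x 2 + e x 2) * P m) _ _ (begin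
        (e x 2 + e x 2) * P m + T m                ≈⟨ +-comm _ _ ⟩
        T m + (e x 2 + e x 2) * P m                ≈⟨ twin-path m ⟩
        P (suc (suc m)) + P (suc (suc m))          ≈⟨ +-cong (path-Ψ m) (path-Ψ m) ⟩
        e x 2 * P m + S + (e x 2 * P m + S)        ≈⟨ solve 3 (λ a b c → a :* b :+ c :+ (a :* b :+ c) := (a :+ a) :* b :+ (c :+ (c :+ con 0))) refl _ _ _ ⟩
        (e x 2 + e x 2) * P m + 2 ⨯ S              ∎)
        where S = ⨁ (upTo (suc (suc m))) (λ l → ⟦ map ⟪ e x ⟫ (Ψ l) ⟧ (suc (suc m)))

-- The ring of series in finitely many variables.

module SeriesRing where

  open import Defs
  open import Algebra.Bundles using (CommutativeRing)
  open import Data.Bool.Base using (true; false)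
  open import Data.Fin.Base using (Fin; zero; suc)
  open import Data.Integer.Base using (+_; 0ℤ; 1ℤ; _+_; _*_; -_)
  open import Data.Integer.Properties as ℤₚ using (+-*-commutativeRing)
  open import Data.List.Base using (List; []; _∷_; map; length; upTo)
  open import Data.List.Relation.Unary.All using (all?)
  open import Data.Nat.Base using (ℕ; zero; suc; _∸_)
  open import Data.Nat.Properties using (_≤?_; suc-injective)
  open import Data.Product.Base using (_,_)
  open import Function.Base using (_∘_)
  open import Level using (0ℓ)
  open import Relation.Binary.PropositionalEquality using (_≡_; refl; sym; trans; cong; cong₂; module ≡-Reasoning)
  open import Relation.Nullary using (does)
  open Sums
  open SmirnovWords

  open RingSums +-*-commutativeRing

  -- The coefficient of x₁ⁱ as a series in the remaining variables; not a derivative.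
  _∂_ : Series → ℕ → Series
  (f ∂ i) β = f (i ∷ β)

  -- The Cauchy product with respect to the first variable. It reduces the ring laws to `diag`
  -- identities and induction on the exponent list.
  ·-∷ : ∀ (f h : Series) a α → (f · h) (a ∷ α) ≡ diag a (λ i j → ((f ∂ i) · (h ∂ j)) α)
  ·-∷ f h a α = trans (⨁-concatMap (λ i → map (λ (β , γ) → i ∷ β , (a ∸ i) ∷ γ) (splits α)) (upTo (suc a)) {λ (β , γ) → f β * h γ})
    (trans (⨁-cong (upTo (suc a)) λ i → ⨁-map (λ (β , γ) → i ∷ β , (a ∸ i) ∷ γ) (splits α) {λ (β , γ) → f β * h γ})
      (⨁-upTo a {λ i j → ((f ∂ i) · (h ∂ j)) α}))

  -- Both factors of a splitting have the length of the original exponent list, so the equality of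
  -- `seriesRing`, which inspects one length only, is respected by products.
  ·-cong : ∀ α {f f′ h h′ : Series} → (∀ β → length β ≡ length α → f β ≡ f′ β) →
    (∀ β → length β ≡ length α → h β ≡ h′ β) → (f · h) α ≡ (f′ · h′) α
  ·-cong []      p q = cong₂ (λ a b → a * b + 0ℤ) (p [] refl) (q [] refl)
  ·-cong (a ∷ α) {f} {f′} {h} {h′} p q = trans (·-∷ f h a α) (trans
    (diag-cong a λ i j _ → ·-cong α (λ β → p (i ∷ β) ∘ cong suc) (λ β → q (j ∷ β) ∘ cong suc))
    (sym (·-∷ f′ h′ a α)))

  ·-comm : ∀ f h α → (f · h) α ≡ (h · f) α
  ·-comm f h []      = cong (_+ 0ℤ) (ℤₚ.*-comm (f []) (h []))
  ·-comm f h (a ∷ α) = trans (·-∷ f h a α) (trans (diag-comm a)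
    (trans (diag-cong a λ i j _ → ·-comm (f ∂ j) (h ∂ i) α) (sym (·-∷ h f a α))))

  diag-· : ∀ m (φ : ℕ → ℕ → Series) h α → ((λ β → diag m (λ i j → φ i j β)) · h) α ≡ diag m (λ i j → (φ i j · h) α)
  diag-· m φ h α = trans (⨁-cong (splits α) λ (β , γ) → diag-* m {h γ} {λ i j → φ i j β}) (sym (diag-⨁ m (splits α) {λ i j (β , γ) → φ i j β * h γ}))

  ·-diag : ∀ m (φ : ℕ → ℕ → Series) h α → (h · (λ β → diag m (λ i j → φ i j β))) α ≡ diag m (λ i j → (h · φ i j) α)
  ·-diag m φ h α = trans (⨁-cong (splits α) λ (β , γ) → *-diag m {h β} {λ i j → φ i j γ}) (sym (diag-⨁ m (splits α) {λ i j (β , γ) → h β * φ i j γ}))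

  ·-assoc : ∀ f h k α → ((f · h) · k) α ≡ (f · (h · k)) α
  ·-assoc f h k []      = cong (_+ 0ℤ) (begin
    (f [] * h [] + 0ℤ) * k []   ≡⟨ cong (_* k []) (ℤₚ.+-identityʳ (f [] * h [])) ⟩
    f [] * h [] * k []          ≡⟨ ℤₚ.*-assoc (f []) (h []) (k []) ⟩
    f [] * (h [] * k [])        ≡⟨ cong (f [] *_) (ℤₚ.+-identityʳ (h [] * k [])) ⟨
    f [] * (h [] * k [] + 0ℤ)   ∎)
    where open ≡-Reasoning
  ·-assoc f h k (a ∷ α) = begin
    ((f · h) · k) (a ∷ α)
      ≡⟨ ·-∷ (f · h) k a α ⟩
    diag a (λ i n → (((f · h) ∂ i) · (k ∂ n)) α)
      ≡⟨ diag-cong a (λ i n _ → trans (·-cong α {h = k ∂ n} (λ β _ → ·-∷ f h i β) λ _ _ → refl) (diag-· i (λ j l → (f ∂ j) · (h ∂ l)) (k ∂ n) α)) ⟩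
    diag a (λ i n → diag i (λ j l → (((f ∂ j) · (h ∂ l)) · (k ∂ n)) α))
      ≡⟨ diag-cong a (λ i n _ → diag-cong i λ j l _ → ·-assoc (f ∂ j) (h ∂ l) (k ∂ n) α) ⟩
    diag a (λ i n → diag i (λ j l → ((f ∂ j) · ((h ∂ l) · (k ∂ n))) α))
      ≡⟨ diag-assoc a {λ j l n → ((f ∂ j) · ((h ∂ l) · (k ∂ n))) α} ⟩
    diag a (λ j m → diag m (λ l n → ((f ∂ j) · ((h ∂ l) · (k ∂ n))) α))
      ≡⟨ diag-cong a (λ j m _ → trans (·-cong α {f = f ∂ j} (λ _ _ → refl) λ β _ → ·-∷ h k m β) (·-diag m (λ l n → (h ∂ l) · (k ∂ n)) (f ∂ j) α)) ⟨
    diag a (λ j m → ((f ∂ j) · ((h · k) ∂ m)) α)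
      ≡⟨ ·-∷ f (h · k) a α ⟨
    (f · (h · k)) (a ∷ α) ∎
    where open ≡-Reasoning

  ·-zeroˡ : ∀ f h α → (∀ β → f β ≡ 0ℤ) → (f · h) α ≡ 0ℤ
  ·-zeroˡ f h α f≡0 = ⨁-ε (splits α) λ (β , γ) _ → trans (cong (_* h γ) (f≡0 β)) (ℤₚ.*-zeroˡ (h γ))

  ·-identityˡ : ∀ f α → (1ˢ · f) α ≡ f α
  ·-identityˡ f []      = trans (ℤₚ.+-identityʳ _) (ℤₚ.*-identityˡ _)
  ·-identityˡ f (a ∷ α) = trans (·-∷ 1ˢ f a α)
    (trans (diag-head a λ i j → ·-zeroˡ (1ˢ ∂ suc i) (f ∂ j) α λ _ → refl) (·-identityˡ (f ∂ a) α))

  _⊕_ : Series → Series → Series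
  (f ⊕ h) α = f α + h α

  ·-distribˡ : ∀ f h k α → (f · (h ⊕ k)) α ≡ ((f · h) ⊕ (f · k)) α
  ·-distribˡ f h k α = trans (⨁-cong (splits α) {λ (β , γ) → f β * (h γ + k γ)} {λ (β , γ) → f β * h γ + f β * k γ} λ (β , γ) → ℤₚ.*-distribˡ-+ (f β) (h γ) (k γ)) (⨁-∙ (splits α) {λ (β , γ) → f β * h γ} {λ (β , γ) → f β * k γ})

  -- Series in N variables: only their values at the monomials of length N matter.
  seriesRing : ℕ → CommutativeRing 0ℓ 0ℓ
  seriesRing N = record
    { Carrier = Series
    ; _≈_ = λ f h → ∀ α → length α ≡ N → f α ≡ h α
    ; _+_ = _⊕_
    ; _*_ = _·_
    ; -_ = λ f α → - f α
    ; 0# = 0ˢ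
    ; 1# = 1ˢ
    ; isCommutativeRing = record
      { isRing = record
        { +-isAbelianGroup = record
          { isGroup = record
            { isMonoid = record
              { isSemigroup = record
                { isMagma = record
                  { isEquivalence = record
                    { refl = λ _ _ → refl
                    ; sym = λ p α q → sym (p α q)
                    ; trans = λ p p′ α q → trans (p α q) (p′ α q)
                    }
                  ; ∙-cong = λ p p′ α q → cong₂ _+_ (p α q) (p′ α q)
                  }
                ; assoc = λ f h k α _ → ℤₚ.+-assoc (f α) (h α) (k α)
                }
              ; identity = (λ f α _ → ℤₚ.+-identityˡ (f α)) , (λ f α _ → ℤₚ.+-identityʳ (f α))
              }
            ; inverse = (λ f α _ → ℤₚ.+-inverseˡ (f α)) , (λ f α _ → ℤₚ.+-inverseʳ (f α))
            ; ⁻¹-cong = λ p α q → cong -_ (p α q)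
            }
          ; comm = λ f h α _ → ℤₚ.+-comm (f α) (h α)
          }
        ; *-cong = λ p p′ α q → ·-cong α (λ β r → p β (trans r q)) (λ β r → p′ β (trans r q))
        ; *-assoc = λ f h k α _ → ·-assoc f h k α
        ; *-identity = (λ f α _ → ·-identityˡ f α) , (λ f α _ → trans (·-comm f 1ˢ α) (·-identityˡ f α))
        ; distrib = (λ f h k α _ → ·-distribˡ f h k α)
                  , (λ f h k α _ → trans (·-comm (h ⊕ k) f α) (trans (·-distribˡ f h k α) (cong₂ _+_ (·-comm f h α) (·-comm f k α))))
        }
      ; *-comm = λ f h α _ → ·-comm f h α
      }
    }

  elementary-zero : ∀ α → elementary 0 α ≡ 1ˢ α
  elementary-zero []          = refl
  elementary-zero (zero ∷ α)  = elementary-zero α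
  elementary-zero (suc a ∷ α) with does (all? (_≤? 1) (suc a ∷ α))
  ... | true  = refl
  ... | false = refl

  -- The substitution of x_{i+1} for x_i: the result does not involve x₁.
  shift : Series → Series
  shift f []          = 0ℤ
  shift f (zero ∷ α)  = f α
  shift f (suc _ ∷ α) = 0ℤ

  var : ∀ {N} → Fin N → Series
  var zero    []                  = 0ℤ
  var zero    (zero ∷ α)          = 0ℤ
  var zero    (suc zero ∷ α)      = 1ˢ α
  var zero    (suc (suc _) ∷ α)   = 0ℤ
  var (suc i) = shift (var i)

  shift-· : ∀ f h a α → (shift f · h) (a ∷ α) ≡ (f · (h ∂ a)) α
  shift-· f h a α = trans (·-∷ (shift f) h a α) (diag-head a λ i j → ·-zeroˡ (shift f ∂ suc i) (h ∂ j) α λ _ → refl)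

  var-·-zero : ∀ {N} h α → (var {suc N} zero · h) (zero ∷ α) ≡ 0ℤ
  var-·-zero {N} h α = trans (·-∷ (var {suc N} zero) h 0 α) (·-zeroˡ (var {suc N} zero ∂ 0) (h ∂ 0) α λ _ → refl)

  var-·-suc : ∀ {N} h a α → (var {suc N} zero · h) (suc a ∷ α) ≡ h (a ∷ α)
  var-·-suc {N} h a α = begin
    (v · h) (suc a ∷ α)
      ≡⟨ ·-∷ v h (suc a) α ⟩
    ((v ∂ 0) · (h ∂ suc a)) α + diag a (λ i j → ((v ∂ suc i) · (h ∂ j)) α)
      ≡⟨ cong₂ _+_ (·-zeroˡ (v ∂ 0) (h ∂ suc a) α λ _ → refl) (diag-head a λ i j → ·-zeroˡ (v ∂ suc (suc i)) (h ∂ j) α λ _ → refl) ⟩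
    0ℤ + (1ˢ · (h ∂ a)) α
      ≡⟨ ℤₚ.+-identityˡ _ ⟩
    (1ˢ · (h ∂ a)) α
      ≡⟨ ·-identityˡ (h ∂ a) α ⟩
    h (a ∷ α) ∎
    where
    open ≡-Reasoning
    v = var {suc N} zero

  module _ (N : ℕ) where
    private
      module R = RingSums (seriesRing N)
      open import Algebra.Properties.Semiring.Mult (CommutativeRing.semiring (seriesRing N)) renaming (_×_ to _⨯_)

    ⨁-eval : ∀ {A : Set} (xs : List A) {f : A → Series} α → R.⨁ xs f α ≡ ∑ xs (λ x → f x α)
    ⨁-eval []       α = refl
    ⨁-eval (x ∷ xs) {f} α = cong (λ s → f x α + s) (⨁-eval xs {f} α)

    diag-eval : ∀ m {φ : ℕ → ℕ → Series} α → R.diag m φ α ≡ diag m (λ i j → φ i j α)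
    diag-eval zero    α = refl
    diag-eval (suc m) {φ} α = cong (λ s → φ 0 (suc m) α + s) (diag-eval m {φ ∘ suc} α)

    ⨯-eval : ∀ n {f} α → (n ⨯ f) α ≡ ((+ n) • f) α
    ⨯-eval zero    {f} α = sym (ℤₚ.*-zeroˡ (f α))
    ⨯-eval (suc n) {f} α = trans (cong (λ s → f α + s) (⨯-eval n α))
      (sym (trans (ℤₚ.*-distribʳ-+ (f α) 1ℤ (+ n)) (cong (_+ ((+ n) * f α)) (ℤₚ.*-identityˡ (f α)))))

  -- `shift` respects sums and products, hence elementary symmetric polynomials. This relates the
  -- ring in N + 1 variables to the one in N variables for the induction in `e-var`.
  e-shift : ∀ N {n} (x : Fin n → Series) k a α → length α ≡ N →
    Path.e (seriesRing (suc N)) (shift ∘ x) k (a ∷ α) ≡ shift (Path.e (seriesRing N) x k) (a ∷ α)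
  e-shift N x zero zero    α p = refl
  e-shift N x zero (suc a) α p = refl
  e-shift N {zero}  x (suc k) zero    α p = refl
  e-shift N {zero}  x (suc k) (suc a) α p = refl
  e-shift N {suc n} x (suc k) a α p = begin
    e′ (shift ∘ x ∘ suc) (suc k) (a ∷ α) + (shift (x zero) · e′ (shift ∘ x ∘ suc) k) (a ∷ α)
      ≡⟨ cong₂ _+_ (e-shift N (x ∘ suc) (suc k) a α p) (shift-· (x zero) (e′ (shift ∘ x ∘ suc) k) a α) ⟩
    shift (e₀ (x ∘ suc) (suc k)) (a ∷ α) + (x zero · (e′ (shift ∘ x ∘ suc) k ∂ a)) α
      ≡⟨ cong (λ s → shift (e₀ (x ∘ suc) (suc k)) (a ∷ α) + s) (·-cong α {f = x zero} (λ _ _ → refl) λ β q → e-shift N (x ∘ suc) k a β (trans q p)) ⟩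
    shift (e₀ (x ∘ suc) (suc k)) (a ∷ α) + (x zero · (shift (e₀ (x ∘ suc) k) ∂ a)) α
      ≡⟨ cases a ⟩
    shift (e₀ x (suc k)) (a ∷ α) ∎
    where
    open ≡-Reasoning
    e′ = Path.e (seriesRing (suc N))
    e₀ : ∀ {n} → (Fin n → Series) → ℕ → Series
    e₀ = Path.e (seriesRing N)
    cases : ∀ a → shift (e₀ (x ∘ suc) (suc k)) (a ∷ α) + (x zero · (shift (e₀ (x ∘ suc) k) ∂ a)) α ≡ shift (e₀ x (suc k)) (a ∷ α)
    cases zero    = refl
    cases (suc a) = trans (ℤₚ.+-identityˡ _) (trans (·-comm (x zero) 0ˢ α) (·-zeroˡ 0ˢ (x zero) α λ _ → refl))

  -- Induction on N by the exponent of x₁: exponents 0 and 1 pick the two summands of the recursion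
  -- for `e`, and from 2 on both sides vanish.
  e-var : ∀ N k α → length α ≡ N → Path.e (seriesRing N) {N} var k α ≡ elementary k α
  e-var N       zero    α       p = sym (elementary-zero α)
  e-var zero    (suc k) []      p = refl
  e-var (suc N) (suc k) (a ∷ α) p = trans
    (cong (λ s → s + (var {suc N} zero · e′) (a ∷ α)) (e-shift N {N} var (suc k) a α q)) (cases a)
    where
    q = suc-injective p
    e′ = Path.e (seriesRing (suc N)) {N} (shift ∘ var) k
    cases : ∀ a → shift (Path.e (seriesRing N) {N} var (suc k)) (a ∷ α) + (var {suc N} zero · e′) (a ∷ α) ≡ elementary (suc k) (a ∷ α)
    cases zero          = trans (cong₂ _+_ (e-var N (suc k) α q) (var-·-zero {N} e′ α)) (ℤₚ.+-identityʳ _)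
    cases (suc zero)    = trans (ℤₚ.+-identityˡ _) (trans (var-·-suc {N} e′ 0 α) (trans (e-shift N var k 0 α q) (e-var N k α q)))
    cases (suc (suc a)) = trans (ℤₚ.+-identityˡ _) (trans (var-·-suc {N} e′ (suc a) α) (e-shift N var k (suc a) α q))

-- Proper colourings of a twinned path as pairs of letters followed by a word.

module Colourings where

  open import Defs
  open import Algebra.Bundles using (CommutativeRing)
  open import Data.Bool.Base using (if_then_else_)
  open import Data.Fin.Base using (Fin; zero; suc; toℕ; fromℕ; opposite; inject₁)
  open import Data.Fin.Properties using (opposite-prop; opposite-involutive; toℕ<n) renaming (_≟_ to _≟ᶠ_)
  open import Data.Integer.Base as ℤ using (ℤ; +_; 1ℤ)
  open import Data.Integer.Properties as ℤₚ using (+-*-commutativeRing)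
  open import Data.List.Base as List using (List; []; _∷_; length; filter; allFin)
  open import Data.List.Properties using (≡-dec; ∷-injective; length-tabulate)
  open import Data.Nat.Base using (ℕ; zero; suc; _∸_)
  open import Data.Nat.Properties as ℕₚ using (_≟_; suc-injective)
  open import Data.Product.Base using (_×_; _,_; proj₁; proj₂)
  open import Data.Sum.Base as Sum using (_⊎_; inj₁; inj₂)
  open import Data.Unit.Base using (⊤; tt)
  open import Data.Vec.Base using (Vec; []; _∷_; _∷ʳ_; lookup; reverse; count)
  open import Data.Vec.Properties using (reverse-∷)
  open import Function.Base using (_∘_; id)
  open import Level using (0ℓ)
  open import Relation.Binary.PropositionalEquality as ≡ using (_≡_; _≢_; cong; subst; subst₂)
  open import Relation.Nullary using (Dec; yes; no; does; ¬?)
  open import Relation.Nullary.Decidable using (_×-dec_)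
  open Sums
  open SmirnovWords
  open SeriesRing

  Fresh : ∀ {N n} → Fin N → Vec (Fin N) n → Set
  Fresh c []      = ⊤
  Fresh c (h ∷ _) = c ≢ h

  Smirnov : ∀ {N n} → Vec (Fin N) n → Set
  Smirnov []      = ⊤
  Smirnov (c ∷ κ) = Fresh c κ × Smirnov κ

  fresh? : ∀ {N n} (c : Fin N) (κ : Vec (Fin N) n) → Dec (Fresh c κ)
  fresh? c []      = yes tt
  fresh? c (h ∷ _) = ¬? (c ≟ᶠ h)

  smirnov? : ∀ {N n} (κ : Vec (Fin N) n) → Dec (Smirnov κ)
  smirnov? []      = yes tt
  smirnov? (c ∷ κ) = fresh? c κ ×-dec smirnov? κ

  module _ {N : ℕ} where

    Proper⇒Smirnov : ∀ {n} (κ : Vec (Fin N) n) → Proper (path n) κ → Smirnov κ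
    Proper⇒Smirnov []          pr = tt
    Proper⇒Smirnov (c ∷ [])    pr = tt , tt
    Proper⇒Smirnov (c ∷ d ∷ κ) pr = pr zero (suc zero) (inj₁ ≡.refl) ,
      Proper⇒Smirnov (d ∷ κ) (λ u w → pr (suc u) (suc w) ∘ Sum.map (cong suc) (cong suc))

    Smirnov⇒Proper : ∀ {n} (κ : Vec (Fin N) n) → Smirnov κ → Proper (path n) κ
    Smirnov⇒Proper κ sm u w (inj₁ p) = next κ sm u w p
      where
      next : ∀ {n} (κ : Vec (Fin N) n) → Smirnov κ → ∀ u w → suc (toℕ u) ≡ toℕ w → lookup κ u ≢ lookup κ w
      next (c ∷ d ∷ κ) (f , _)  zero    (suc zero) p = f
      next (c ∷ κ)     (_ , sm) (suc u) (suc w)    p = next κ sm u w (suc-injective p)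
    Smirnov⇒Proper κ sm u w (inj₂ p) = Smirnov⇒Proper κ sm w u (inj₁ p) ∘ ≡.sym

    -- `i` is the colour of the new vertex, `j` that of the twinned end, and `κ` colours the rest of
    -- the path starting at the neighbour of that end.
    Twinned : ∀ {m} → Fin N → Fin N → Vec (Fin N) m → Set
    Twinned i j κ = i ≢ j × Fresh i κ × Smirnov (j ∷ κ)

    twinned? : ∀ {m} i j (κ : Vec (Fin N) m) → Dec (Twinned i j κ)
    twinned? i j κ = ¬? (i ≟ᶠ j) ×-dec fresh? i κ ×-dec smirnov? (j ∷ κ)

    Proper⇒Twinned : ∀ {m} i j (κ : Vec (Fin N) m) → Proper (twin (path (suc m)) zero) (i ∷ j ∷ κ) → Twinned i j κ
    Proper⇒Twinned i j κ pr = pr zero (suc zero) (inj₁ ≡.refl) , fresh κ pr , Proper⇒Smirnov (j ∷ κ) (λ u w → pr (suc u) (suc w))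
      where
      fresh : ∀ {m} (κ : Vec (Fin N) m) → Proper (twin (path (suc m)) zero) (i ∷ j ∷ κ) → Fresh i κ
      fresh []      pr = tt
      fresh (h ∷ κ) pr = pr zero (suc (suc zero)) (inj₂ (inj₂ ≡.refl))

    Twinned⇒Proper : ∀ {m} i j (κ : Vec (Fin N) m) → Twinned i j κ → Proper (twin (path (suc m)) zero) (i ∷ j ∷ κ)
    Twinned⇒Proper i j κ (i≢j , fr , sm) = proper
      where
      from-twin : ∀ {m} (κ : Vec (Fin N) m) → Fresh i κ → ∀ w → w ≡ zero ⊎ Consecutive w zero → i ≢ lookup (j ∷ κ) w
      from-twin κ       fr zero       _               = i≢j
      from-twin (h ∷ κ) fr (suc zero) _               = fr
      from-twin κ       fr (suc (suc w)) (inj₂ (inj₁ ()))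
      from-twin κ       fr (suc (suc w)) (inj₂ (inj₂ ()))
      proper : Proper (twin (path (suc _)) zero) (i ∷ j ∷ κ)
      proper zero    (suc w) adj = from-twin κ fr w adj
      proper (suc u) zero    adj = from-twin κ fr u adj ∘ ≡.sym
      proper (suc u) (suc w) adj = Smirnov⇒Proper (j ∷ κ) sm u w adj

  module _ {A : Set} where

    lookup-∷ʳ-fromℕ : ∀ {n} (xs : Vec A n) x → lookup (xs ∷ʳ x) (fromℕ n) ≡ x
    lookup-∷ʳ-fromℕ []       x = ≡.refl
    lookup-∷ʳ-fromℕ (_ ∷ xs) x = lookup-∷ʳ-fromℕ xs x

    lookup-∷ʳ-inject₁ : ∀ {n} (xs : Vec A n) x i → lookup (xs ∷ʳ x) (inject₁ i) ≡ lookup xs i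
    lookup-∷ʳ-inject₁ (_ ∷ xs) x zero    = ≡.refl
    lookup-∷ʳ-inject₁ (_ ∷ xs) x (suc i) = lookup-∷ʳ-inject₁ xs x i

    lookup-reverse : ∀ {n} (xs : Vec A n) i → lookup (reverse xs) (opposite i) ≡ lookup xs i
    lookup-reverse {suc n} (x ∷ xs) zero    = ≡.trans (cong (λ ys → lookup ys (fromℕ n)) (reverse-∷ x xs)) (lookup-∷ʳ-fromℕ (reverse xs) x)
    lookup-reverse         (x ∷ xs) (suc i) = ≡.trans (cong (λ ys → lookup ys (inject₁ (opposite i))) (reverse-∷ x xs))
      (≡.trans (lookup-∷ʳ-inject₁ (reverse xs) x (opposite i)) (lookup-reverse xs i))

  private
    opposite-next : ∀ {n} (u w : Fin n) → suc (toℕ u) ≡ toℕ w → suc (toℕ (opposite w)) ≡ toℕ (opposite u)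
    opposite-next {n} u w p = begin
      suc (toℕ (opposite w))  ≡⟨ cong suc (opposite-prop w) ⟩
      suc (n ∸ suc (toℕ w))   ≡⟨ ℕₚ.+-∸-assoc 1 (toℕ<n w) ⟨
      n ∸ toℕ w               ≡⟨ cong (n ∸_) p ⟨
      n ∸ suc (toℕ u)         ≡⟨ opposite-prop u ⟨
      toℕ (opposite u)        ∎
      where open ≡.≡-Reasoning

  opposite-Consecutive : ∀ {n} (u w : Fin n) → Consecutive u w → Consecutive (opposite u) (opposite w)
  opposite-Consecutive u w (inj₁ p) = inj₂ (opposite-next u w p)
  opposite-Consecutive u w (inj₂ p) = inj₁ (opposite-next w u p)

  module _ {m : ℕ} where

    -- The reflection of the path, extended by fixing the new vertex. It carries the twin at `v` to
    -- the twin at `opposite v`, so that only the end `zero` needs a computation.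
    fixTwin : Fin (suc (suc m)) → Fin (suc (suc m))
    fixTwin zero    = zero
    fixTwin (suc u) = suc (opposite u)

    fixTwin-involutive : ∀ u → fixTwin (fixTwin u) ≡ u
    fixTwin-involutive zero    = ≡.refl
    fixTwin-involutive (suc u) = cong suc (opposite-involutive u)

    fixTwin-adjacent : ∀ v u w → TwinAdjacent (path (suc m)) v u w → TwinAdjacent (path (suc m)) (opposite v) (fixTwin u) (fixTwin w)
    fixTwin-adjacent v zero    (suc w) adj = Sum.map (cong opposite) (opposite-Consecutive w v) adj
    fixTwin-adjacent v (suc u) zero    adj = Sum.map (cong opposite) (opposite-Consecutive u v) adj
    fixTwin-adjacent v (suc u) (suc w) adj = opposite-Consecutive u w adj

    lookup-fixTwin : ∀ {A : Set} i (κ : Vec A (suc m)) u → lookup (i ∷ reverse κ) (fixTwin u) ≡ lookup (i ∷ κ) u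
    lookup-fixTwin i κ zero    = ≡.refl
    lookup-fixTwin i κ (suc u) = lookup-reverse κ u

    Proper-reverse⁻ : ∀ {N} v i (κ : Vec (Fin N) (suc m)) →
      Proper (twin (path (suc m)) (opposite v)) (i ∷ reverse κ) → Proper (twin (path (suc m)) v) (i ∷ κ)
    Proper-reverse⁻ v i κ pr u w adj = subst₂ _≢_ (lookup-fixTwin i κ u) (lookup-fixTwin i κ w)
      (pr (fixTwin u) (fixTwin w) (fixTwin-adjacent v u w adj))

    Proper-reverse⁺ : ∀ {N} v i (κ : Vec (Fin N) (suc m)) →
      Proper (twin (path (suc m)) v) (i ∷ κ) → Proper (twin (path (suc m)) (opposite v)) (i ∷ reverse κ)
    Proper-reverse⁺ v i κ pr u w adj = subst₂ _≢_ (eq u) (eq w)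
      -- The reflection leads from `opposite v` to its double opposite, which has to be identified
      -- with `v`.
      (pr (fixTwin u) (fixTwin w) (subst (λ v → TwinAdjacent (path (suc m)) v (fixTwin u) (fixTwin w)) (opposite-involutive v) (fixTwin-adjacent (opposite v) u w adj)))
      where
      eq : ∀ u → lookup (i ∷ κ) (fixTwin u) ≡ lookup (i ∷ reverse κ) u
      eq u = ≡.trans (≡.sym (lookup-fixTwin i κ (fixTwin u))) (cong (lookup (i ∷ reverse κ)) (fixTwin-involutive u))

  module Colour (R : CommutativeRing 0ℓ 0ℓ) {N : ℕ} (x : Fin N → CommutativeRing.Carrier R) where
    open CommutativeRing R hiding (zero)
    open RingSums R
    open Path R
    open import Algebra.Properties.AbelianGroup +-abelianGroup using (∙-cancelˡ)
    open import Algebra.Properties.CommutativeSemigroup *-commutativeSemigroup using (x∙yz≈y∙xz)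
    open import Algebra.Properties.Ring ring using (-0#≈0#)
    open import Relation.Binary.Reasoning.Setoid setoid

    mono : ∀ {n} → Vec (Fin N) n → Carrier
    mono []      = 1#
    mono (c ∷ κ) = x c * mono κ

    -- The chromatic symmetric polynomial evaluated at `x`; `X-eval` recovers the counting
    -- definition by taking the variables for `x`.
    Xᴿ : ∀ {n} → Graph n → Carrier
    Xᴿ {n} H = ⨁ (colourings n N) (λ κ → guard (proper? H κ) (mono κ))

    ⨁-colourings : ∀ n {f : Vec (Fin N) (suc n) → Carrier} →
      ⨁ (colourings (suc n) N) f ≈ ⨁ (allFin N) (λ c → ⨁ (colourings n N) (λ κ → f (c ∷ κ)))
    ⨁-colourings n {f} = ⨁-cartesian _∷_ (allFin N) (colourings n N) {f}

    private
      ⨁-∷ʳ : ∀ n (f : Vec (Fin N) (suc n) → Carrier) →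
        ⨁ (colourings (suc n) N) f ≈ ⨁ (allFin N) (λ c → ⨁ (colourings n N) (λ κ → f (κ ∷ʳ c)))
      ⨁-∷ʳ zero    f = ⨁-colourings 0
      ⨁-∷ʳ (suc n) f = begin
        ⨁ (colourings (suc (suc n)) N) f
          ≈⟨ ⨁-colourings (suc n) ⟩
        ⨁ (allFin N) (λ d → ⨁ (colourings (suc n) N) (λ κ → f (d ∷ κ)))
          ≈⟨ ⨁-cong (allFin N) (λ d → ⨁-∷ʳ n (λ κ → f (d ∷ κ))) ⟩
        ⨁ (allFin N) (λ d → ⨁ (allFin N) (λ c → ⨁ (colourings n N) (λ κ → f (d ∷ (κ ∷ʳ c)))))
          ≈⟨ ⨁-swap (allFin N) (allFin N) ⟩
        ⨁ (allFin N) (λ c → ⨁ (allFin N) (λ d → ⨁ (colourings n N) (λ κ → f (d ∷ (κ ∷ʳ c)))))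
          ≈⟨ ⨁-cong (allFin N) (λ c → ⨁-colourings n {λ κ → f (κ ∷ʳ c)}) ⟨
        ⨁ (allFin N) (λ c → ⨁ (colourings (suc n) N) (λ κ → f (κ ∷ʳ c))) ∎

      mono-∷ʳ : ∀ {n} (κ : Vec (Fin N) n) c → mono (κ ∷ʳ c) ≈ mono (c ∷ κ)
      mono-∷ʳ []      c = refl
      mono-∷ʳ (d ∷ κ) c = trans (*-congˡ (mono-∷ʳ κ c)) (x∙yz≈y∙xz _ _ _)

    ⨁-reverse : ∀ n (f : Vec (Fin N) n → Carrier) → ⨁ (colourings n N) f ≈ ⨁ (colourings n N) (f ∘ reverse)
    ⨁-reverse zero    f = refl
    ⨁-reverse (suc n) f = begin
      ⨁ (colourings (suc n) N) f
        ≈⟨ ⨁-∷ʳ n f ⟩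
      ⨁ (allFin N) (λ c → ⨁ (colourings n N) (λ κ → f (κ ∷ʳ c)))
        ≈⟨ ⨁-cong (allFin N) (λ c → ⨁-reverse n (λ κ → f (κ ∷ʳ c))) ⟩
      ⨁ (allFin N) (λ c → ⨁ (colourings n N) (λ κ → f (reverse κ ∷ʳ c)))
        ≈⟨ ⨁-cong (allFin N) (λ c → ⨁-cong (colourings n N) λ κ → reflexive (cong f (≡.sym (reverse-∷ c κ)))) ⟩
      ⨁ (allFin N) (λ c → ⨁ (colourings n N) (λ κ → f (reverse (c ∷ κ))))
        ≈⟨ ⨁-colourings n ⟨
      ⨁ (colourings (suc n) N) (f ∘ reverse) ∎

    mono-reverse : ∀ {n} (κ : Vec (Fin N) n) → mono (reverse κ) ≈ mono κ
    mono-reverse []      = refl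
    mono-reverse (c ∷ κ) = trans (reflexive (cong mono (reverse-∷ c κ))) (trans (mono-∷ʳ (reverse κ) c) (*-congˡ (mono-reverse κ)))

    Xᴿ-opposite : ∀ m v → Xᴿ (twin (path (suc m)) (opposite v)) ≈ Xᴿ (twin (path (suc m)) v)
    Xᴿ-opposite m v = begin
      Xᴿ (twin (path (suc m)) (opposite v))
        ≈⟨ ⨁-colourings (suc m) ⟩
      ⨁ (allFin N) (λ i → ⨁ (colourings (suc m) N) (λ κ → guard (proper? (twin (path (suc m)) (opposite v)) (i ∷ κ)) (mono (i ∷ κ))))
        ≈⟨ ⨁-cong (allFin N) (λ i → ⨁-reverse (suc m) (λ κ → guard (proper? (twin (path (suc m)) (opposite v)) (i ∷ κ)) (mono (i ∷ κ)))) ⟩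
      ⨁ (allFin N) (λ i → ⨁ (colourings (suc m) N) (λ κ → guard (proper? (twin (path (suc m)) (opposite v)) (i ∷ reverse κ)) (mono (i ∷ reverse κ))))
        ≈⟨ ⨁-cong (allFin N) (λ i → ⨁-cong (colourings (suc m) N) λ κ →
             guard-cong (proper? (twin (path (suc m)) (opposite v)) (i ∷ reverse κ)) (proper? (twin (path (suc m)) v) (i ∷ κ))
               (Proper-reverse⁻ v i κ) (Proper-reverse⁺ v i κ) (*-congˡ (mono-reverse κ))) ⟩
      ⨁ (allFin N) (λ i → ⨁ (colourings (suc m) N) (λ κ → guard (proper? (twin (path (suc m)) v) (i ∷ κ)) (mono (i ∷ κ))))
        ≈⟨ ⨁-colourings (suc m) ⟨
      Xᴿ (twin (path (suc m)) v) ∎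

    private
      sm : ∀ {n} → Vec (Fin N) n → Carrier
      sm κ = guard (smirnov? κ) (mono κ)

      ⨁-guard : ∀ {Z B : Set} (d : Dec Z) (xs : List B) {f} → ⨁ xs (λ y → guard d (f y)) ≈ guard d (⨁ xs f)
      ⨁-guard (yes _) xs = refl
      ⨁-guard (no _)  xs = ⨁-ε xs λ _ _ → refl

      -- Gives the recursively defined `A` its meaning as a sum over words. Proved together with
      -- `fresh-sum`: deleting the first letter i leaves a word not beginning with i, and such words
      -- are all words minus those counted by `A` for i.
      A-sum : ∀ n i → A x (suc n) i ≈ ⨁ (colourings n N) (λ κ → sm (i ∷ κ))

      fresh-sum : ∀ n i → ⨁ (colourings n N) (λ κ → guard (fresh? i κ) (sm κ)) ≈ P x n - A x n i
      fresh-sum zero    i = +-congˡ (sym -0#≈0#)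
      fresh-sum (suc n) i = begin
        ⨁ (colourings (suc n) N) (λ κ → guard (fresh? i κ) (sm κ))
          ≈⟨ ⨁-colourings n ⟩
        ⨁ (allFin N) (λ h → ⨁ (colourings n N) (λ κ → guard (¬? (i ≟ᶠ h)) (sm (h ∷ κ))))
          ≈⟨ ⨁-cong (allFin N) (λ h → trans (⨁-guard (¬? (i ≟ᶠ h)) (colourings n N)) (guard-congʳ (¬? (i ≟ᶠ h)) (sym (A-sum n h)))) ⟩
        ≢-sum x (A x (suc n)) i
          ≈⟨ ∙-cancelˡ (A x (suc n) i) _ _ (trans (sym (⨁-≢ x (A x (suc n)) i)) (+-minus _ _)) ⟩
        P x (suc n) - A x (suc n) i ∎

      A-sum n i = begin
        x i * (P x n - A x n i)
          ≈⟨ *-congˡ (fresh-sum n i) ⟨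
        x i * ⨁ (colourings n N) (λ κ → guard (fresh? i κ) (sm κ))
          ≈⟨ *-⨁ (colourings n N) ⟩
        ⨁ (colourings n N) (λ κ → x i * guard (fresh? i κ) (sm κ))
          ≈⟨ ⨁-cong (colourings n N) (λ κ → trans (*-guard (fresh? i κ)) (trans (guard-congʳ (fresh? i κ) (*-guard (smirnov? κ))) (sym (guard-× (fresh? i κ) (smirnov? κ))))) ⟩
        ⨁ (colourings n N) (λ κ → sm (i ∷ κ)) ∎

      -- The hypothesis i ≠ j makes the two excluded families of words disjoint, so that both may
      -- simply be subtracted.
      fresh₂-sum : ∀ n i j → i ≢ j →
        ⨁ (colourings n N) (λ κ → guard (fresh? i κ) (guard (fresh? j κ) (sm κ))) ≈ P x n - A x n i - A x n j
      fresh₂-sum zero    i j i≢j = trans (+-congˡ (sym -0#≈0#)) (+-congʳ (trans (sym (+-identityʳ _)) (+-congˡ (sym -0#≈0#))))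
      fresh₂-sum (suc n) i j i≢j = begin
        ⨁ (colourings (suc n) N) (λ κ → guard (fresh? i κ) (guard (fresh? j κ) (sm κ)))
          ≈⟨ ⨁-colourings n ⟩
        ⨁ (allFin N) (λ h → ⨁ (colourings n N) (λ κ → guard (¬? (i ≟ᶠ h)) (guard (¬? (j ≟ᶠ h)) (sm (h ∷ κ)))))
          ≈⟨ ⨁-cong (allFin N) (λ h → trans (⨁-guard (¬? (i ≟ᶠ h)) (colourings n N)) (guard-congʳ (¬? (i ≟ᶠ h))
               (trans (⨁-guard (¬? (j ≟ᶠ h)) (colourings n N)) (guard-congʳ (¬? (j ≟ᶠ h)) (sym (A-sum n h)))))) ⟩
        ≢-sum x f i
          ≈⟨ ∙-cancelˡ (A x (suc n) i) _ _ (begin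
               A x (suc n) i + ≢-sum x f i     ≈⟨ +-congʳ (guard-yes (¬? (j ≟ᶠ i)) (i≢j ∘ ≡.sym)) ⟨
               f i + ≢-sum x f i               ≈⟨ ⨁-≢ x f i ⟨
               ≢-sum x (A x (suc n)) j         ≈⟨ ∙-cancelˡ (A x (suc n) j) _ _ (trans (sym (⨁-≢ x (A x (suc n)) j)) (+-minus _ _)) ⟩
               P x (suc n) - A x (suc n) j     ≈⟨ +-congʳ (+-minus (P x (suc n)) (A x (suc n) i)) ⟩
               A x (suc n) i + (P x (suc n) - A x (suc n) i) - A x (suc n) j ≈⟨ +-assoc _ _ _ ⟩
               A x (suc n) i + (P x (suc n) - A x (suc n) i - A x (suc n) j) ∎) ⟩
        P x (suc n) - A x (suc n) i - A x (suc n) j ∎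
        where
        f : Fin N → Carrier
        f h = guard (¬? (j ≟ᶠ h)) (A x (suc n) h)

    Xᴿ-twin-zero : ∀ m → Xᴿ (twin (path (suc m)) zero) ≈ T x m
    Xᴿ-twin-zero m = begin
      Xᴿ (twin (path (suc m)) zero)
        ≈⟨ ⨁-colourings (suc m) ⟩
      ⨁ (allFin N) (λ i → ⨁ (colourings (suc m) N) (λ κ → guard (proper? (twin (path (suc m)) zero) (i ∷ κ)) (mono (i ∷ κ))))
        ≈⟨ ⨁-cong (allFin N) (λ i → ⨁-colourings m) ⟩
      ⨁ (allFin N) (λ i → ⨁ (allFin N) (λ j → ⨁ (colourings m N) (λ κ → guard (proper? (twin (path (suc m)) zero) (i ∷ j ∷ κ)) (mono (i ∷ j ∷ κ)))))
        ≈⟨ ⨁-cong (allFin N) (λ i → ⨁-cong (allFin N) λ j → ⨁-cong (colourings m N) (λ κ → unfold i j κ)) ⟩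
      ⨁ (allFin N) (λ i → ⨁ (allFin N) (λ j → ⨁ (colourings m N) (λ κ → guard (¬? (i ≟ᶠ j)) (x i * (x j * w i j κ)))))
        ≈⟨ ⨁-cong (allFin N) (λ i → ⨁-cong (allFin N) λ j → trans (⨁-guard (¬? (i ≟ᶠ j)) (colourings m N)) (eval i j)) ⟩
      T x m ∎
      where
      w : Fin N → Fin N → Vec (Fin N) m → Carrier
      w i j κ = guard (fresh? i κ) (guard (fresh? j κ) (sm κ))

      unfold : ∀ i j κ → guard (proper? (twin (path (suc m)) zero) (i ∷ j ∷ κ)) (mono (i ∷ j ∷ κ)) ≈ guard (¬? (i ≟ᶠ j)) (x i * (x j * w i j κ))
      unfold i j κ = begin
        guard (proper? (twin (path (suc m)) zero) (i ∷ j ∷ κ)) M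
          ≈⟨ guard-cong (proper? (twin (path (suc m)) zero) (i ∷ j ∷ κ)) (twinned? i j κ) (Proper⇒Twinned i j κ) (Twinned⇒Proper i j κ) refl ⟩
        guard (twinned? i j κ) M
          ≈⟨ trans (guard-× (¬? (i ≟ᶠ j)) (fresh? i κ ×-dec smirnov? (j ∷ κ))) (guard-congʳ (¬? (i ≟ᶠ j))
               (trans (guard-× (fresh? i κ) (smirnov? (j ∷ κ))) (guard-congʳ (fresh? i κ) (guard-× (fresh? j κ) (smirnov? κ))))) ⟩
        guard (¬? (i ≟ᶠ j)) (guard (fresh? i κ) (guard (fresh? j κ) (guard (smirnov? κ) M)))
          ≈⟨ guard-congʳ (¬? (i ≟ᶠ j)) (trans (*-congˡ (pull (x j) (mono κ))) (pull (x i) (x j * mono κ))) ⟨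
        guard (¬? (i ≟ᶠ j)) (x i * (x j * w i j κ)) ∎
        where
        M = mono (i ∷ j ∷ κ)
        pull : ∀ a b → a * guard (fresh? i κ) (guard (fresh? j κ) (guard (smirnov? κ) b)) ≈ guard (fresh? i κ) (guard (fresh? j κ) (guard (smirnov? κ) (a * b)))
        pull a b = trans (*-guard (fresh? i κ)) (guard-congʳ (fresh? i κ) (trans (*-guard (fresh? j κ)) (guard-congʳ (fresh? j κ) (*-guard (smirnov? κ)))))

      eval : ∀ i j → guard (¬? (i ≟ᶠ j)) (⨁ (colourings m N) (λ κ → x i * (x j * w i j κ)))
        ≈ guard (¬? (i ≟ᶠ j)) (x i * (x j * (P x m - A x m i - A x m j)))
      eval i j with i ≟ᶠ j
      ... | yes _  = refl
      ... | no i≢j = sym (begin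
        x i * (x j * (P x m - A x m i - A x m j))       ≈⟨ *-congˡ (*-congˡ (fresh₂-sum m i j i≢j)) ⟨
        x i * (x j * ⨁ (colourings m N) (w i j))        ≈⟨ *-congˡ (*-⨁ (colourings m N)) ⟩
        x i * ⨁ (colourings m N) (λ κ → x j * w i j κ)  ≈⟨ *-⨁ (colourings m N) ⟩
        ⨁ (colourings m N) (λ κ → x i * (x j * w i j κ)) ∎)

    Xᴿ-twin-end : ∀ m v → IsEnd v → Xᴿ (twin (path (suc m)) v) ≈ T x m
    Xᴿ-twin-end m .zero       (inj₁ ≡.refl) = Xᴿ-twin-zero m
    -- `opposite zero` computes to `fromℕ m`.
    Xᴿ-twin-end m .(fromℕ m) (inj₂ ≡.refl) = trans (Xᴿ-opposite m zero) (Xᴿ-twin-zero m)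

  module ℤΣ = RingSums +-*-commutativeRing

  -- Multiplication by the i-th variable on exponent lists.
  bump : ∀ {N} → Fin N → Monomial → Monomial
  bump _       []      = []
  bump zero    (b ∷ β) = suc b ∷ β
  bump (suc i) (b ∷ β) = b ∷ bump i β

  content-∷ : ∀ {n N} c (κ : Vec (Fin N) n) → content (c ∷ κ) ≡ bump c (content κ)
  content-∷ c κ = go c (λ i → count (i ≟ᶠ_) κ)
    where
    go : ∀ {N} (c : Fin N) (h : Fin N → ℕ) → List.tabulate (λ i → (if does (i ≟ᶠ c) then suc else id) (h i)) ≡ bump c (List.tabulate h)
    go zero    h = ≡.refl
    go (suc c) h = cong (h zero ∷_) (go c (h ∘ suc))

  -- The single monomial with exponents `β`, as a series.
  δ : Monomial → Series
  δ β α = ℤΣ.guard (≡-dec _≟_ β α) 1ℤ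

  1ˢ-δ : ∀ N α → length α ≡ N → 1ˢ α ≡ δ (content {0} {N} []) α
  1ˢ-δ zero    []          _ = ≡.refl
  1ˢ-δ (suc N) (zero ∷ α)  p = ≡.trans (1ˢ-δ N α (suc-injective p))
    (ℤΣ.guard-cong (≡-dec _≟_ (content {0} {N} []) α) (≡-dec _≟_ (content {0} {suc N} []) (zero ∷ α)) (cong (zero ∷_)) (proj₂ ∘ ∷-injective) ≡.refl)
  1ˢ-δ (suc N) (suc a ∷ α) p = ≡.refl

  var-δ : ∀ {N} (i : Fin N) β α → length β ≡ N → length α ≡ N → (var i · δ β) α ≡ δ (bump i β) α
  var-δ {suc N} zero (b ∷ β) (zero ∷ α)  _ _ = var-·-zero {N} (δ (b ∷ β)) α
  var-δ {suc N} zero (b ∷ β) (suc a ∷ α) _ _ = ≡.trans (var-·-suc {N} (δ (b ∷ β)) a α)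
    (ℤΣ.guard-cong (≡-dec _≟_ (b ∷ β) (a ∷ α)) (≡-dec _≟_ (suc b ∷ β) (suc a ∷ α))
      (λ where ≡.refl → ≡.refl) (λ where ≡.refl → ≡.refl) ≡.refl)
  var-δ {suc N} (suc i) (b ∷ β) (a ∷ α) p q = ≡.trans (shift-· (var i) (δ (b ∷ β)) a α) (cases (b ≟ a))
    where
    cases : Dec (b ≡ a) → (var i · (δ (b ∷ β) ∂ a)) α ≡ δ (b ∷ bump i β) (a ∷ α)
    cases (yes ≡.refl) = begin
      (var i · (δ (b ∷ β) ∂ b)) α      ≡⟨ ·-cong α {f = var i} (λ _ _ → ≡.refl) (λ γ _ → ∷-δ β γ) ⟨
      (var i · δ β) α                  ≡⟨ var-δ i β α (suc-injective p) (suc-injective q) ⟩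
      δ (bump i β) α                   ≡⟨ ∷-δ (bump i β) α ⟩
      δ (b ∷ bump i β) (b ∷ α)         ∎
      where
      open ≡.≡-Reasoning
      ∷-δ : ∀ β γ → δ β γ ≡ δ (b ∷ β) (b ∷ γ)
      ∷-δ β γ = ℤΣ.guard-cong (≡-dec _≟_ β γ) (≡-dec _≟_ (b ∷ β) (b ∷ γ)) (cong (b ∷_)) (proj₂ ∘ ∷-injective) ≡.refl
    cases (no b≢a) = ≡.trans
      (≡.trans (·-comm (var i) (δ (b ∷ β) ∂ a) α) (·-zeroˡ (δ (b ∷ β) ∂ a) (var i) α λ γ → ℤΣ.guard-no (≡-dec _≟_ (b ∷ β) (a ∷ γ)) (b≢a ∘ proj₁ ∘ ∷-injective)))
      (≡.sym (ℤΣ.guard-no (≡-dec _≟_ (b ∷ bump i β) (a ∷ α)) (b≢a ∘ proj₁ ∘ ∷-injective)))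

  module _ (N : ℕ) where
    private
      module C = Colour (seriesRing N) {N} var

    mono-eval : ∀ {n} (κ : Vec (Fin N) n) α → length α ≡ N → C.mono κ α ≡ δ (content κ) α
    mono-eval []      α p = 1ˢ-δ N α p
    mono-eval (c ∷ κ) α p = begin
      (var c · C.mono κ) α      ≡⟨ ·-cong α {f = var c} (λ _ _ → ≡.refl) (λ β q → mono-eval κ β (≡.trans q p)) ⟩
      (var c · δ (content κ)) α ≡⟨ var-δ c (content κ) α (length-tabulate (λ i → count (i ≟ᶠ_) κ)) p ⟩
      δ (bump c (content κ)) α  ≡⟨ cong (λ β → δ β α) (content-∷ c κ) ⟨
      δ (content (c ∷ κ)) α     ∎
      where open ≡.≡-Reasoning

  length-filter-⨁ : ∀ {A : Set} {P : A → Set} (P? : ∀ x → Dec (P x)) xs →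
    + length (filter P? xs) ≡ ∑ xs (λ x → ℤΣ.guard (P? x) 1ℤ)
  length-filter-⨁ P? []       = ≡.refl
  length-filter-⨁ P? (x ∷ xs) with P? x
  ... | yes _ = cong (λ s → 1ℤ ℤ.+ s) (length-filter-⨁ P? xs)
  ... | no _  = ≡.trans (length-filter-⨁ P? xs) (≡.sym (ℤₚ.+-identityˡ _))

  -- Counting colourings of content `α` is the same as summing the `α`-coefficients of their
  -- monomials, by `mono-eval`; the number of variables is taken to be the length of `α`, as in the
  -- definition of `X`.
  X-eval : ∀ {n} (H : Graph n) α → X H α ≡ Colour.Xᴿ (seriesRing (length α)) {length α} var H α
  X-eval {n} H α = begin
    X H α
      ≡⟨ length-filter-⨁ (λ κ → proper? H κ ×-dec ≡-dec _≟_ (content κ) α) cs ⟩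
    ∑ cs (λ κ → ℤΣ.guard (proper? H κ ×-dec ≡-dec _≟_ (content κ) α) 1ℤ)
      ≡⟨ ℤΣ.⨁-cong cs (λ κ → ≡.trans (ℤΣ.guard-× (proper? H κ) (≡-dec _≟_ (content κ) α)) (≡.trans (ℤΣ.guard-congʳ (proper? H κ) (≡.sym (mono-eval N κ α ≡.refl))) (guard-eval (proper? H κ) (C.mono κ)))) ⟩
    ∑ cs (λ κ → R.guard (proper? H κ) (C.mono κ) α)
      ≡⟨ ⨁-eval N cs {λ κ → R.guard (proper? H κ) (C.mono κ)} α ⟨
    C.Xᴿ H α ∎
    where
    open ≡.≡-Reasoning
    N = length α
    cs = colourings n N
    module C = Colour (seriesRing N) {N} var
    module R = RingSums (seriesRing N)
    guard-eval : ∀ {Z : Set} (d : Dec Z) f → ℤΣ.guard d (f α) ≡ R.guard d f α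
    guard-eval (yes _) f = ≡.refl
    guard-eval (no _)  f = ≡.refl

-- Coefficients of e_μ in products of series as weighted counts of words.

module WordCoefficients where

  open import Defs
  open import Algebra.Bundles using (CommutativeRing)
  open import Data.Integer.Base using (ℤ; +_; 0ℤ; _+_; _*_)
  open import Data.Integer.Properties as ℤₚ using (+-*-commutativeRing)
  open import Data.List.Base using (List; []; _∷_; map; foldr; length; filter; concatMap; upTo)
  open import Data.List.Membership.Propositional using (_∈_; _∉_; find)
  open import Data.List.Membership.DecPropositional using () renaming (_∈?_ to mem?)
  open import Data.List.Membership.Propositional.Properties using (∈-map⁻; ∈-concatMap⁻; ∈-upTo⁺; ∈-upTo⁻; ∈-deduplicate⁺; ∈-deduplicate⁻)
  open import Data.List.Properties using (≡-dec; filter-all)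
  open import Data.List.Relation.Binary.Permutation.Propositional as ↭ using (_↭_; prep; swap; ↭-refl; ↭-sym; ↭-trans; ↭⇒↭ₛ; ↭-reflexive)
  open import Data.List.Relation.Binary.Permutation.Propositional.Properties using (↭-length; ∈-resp-↭; drop-∷; filter-↭)
  import Data.List.Relation.Binary.Pointwise as Pointwise
  open Pointwise using (Pointwise; []; _∷_)
  open import Data.List.Relation.Unary.All as All using (All; []; _∷_)
  import Data.List.Relation.Unary.All.Properties as All
  open import Data.List.Relation.Unary.Any using (here; there) renaming (_─_ to _removeAt_)
  import Data.List.Relation.Unary.Sorted.TotalOrder.Properties as Sorted
  open import Data.List.Relation.Unary.Unique.Propositional using (Unique)
  import Data.List.Relation.Unary.Unique.Propositional.Properties as Unique
  open import Data.List.Relation.Unary.Unique.DecPropositional.Properties using (deduplicate-!)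
  open import Data.Maybe.Base using (just; nothing; maybe′)
  open import Data.Nat.Base as ℕ using (ℕ; zero; suc; _∸_; _≤_; s≤s)
  open import Data.Nat.ListAction using (sum)
  open import Data.Nat.ListAction.Properties using (sum-↭)
  open import Data.Nat.Properties as ℕₚ using (_≟_; _≤?_)
  open import Data.Product.Base using (_×_; _,_; ∃-syntax)
  open import Function.Base using (_∘_)
  open import Relation.Binary.Bundles using (DecTotalOrder)
  open import Relation.Binary.PropositionalEquality using (_≡_; _≢_; refl; sym; trans; cong; cong₂; subst; module ≡-Reasoning)
  open import Relation.Nullary using (Dec; yes; no; contradiction)
  open Sums
  open SmirnovWords
  open SeriesRing
  open import Data.List.Sort.InsertionSort ≥-decTotalOrder using (insertionSort)
  open import Data.List.Sort.Base (DecTotalOrder.totalOrder ≥-decTotalOrder) using (module SortingAlgorithm)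
  open SortingAlgorithm insertionSort using (sort-↭)

  open RingSums +-*-commutativeRing

  partition-↭ : ∀ xs → parts (partition xs) ↭ filter (1 ≤?_) xs
  partition-↭ xs = sort-↭ (filter (1 ≤?_) xs)

  ≡-parts : ∀ {μ ν} → parts μ ≡ parts ν → μ ≡ ν
  ≡-parts refl = refl

  ≡-↭ : ∀ {μ ν} → parts μ ↭ parts ν → μ ≡ ν
  ≡-↭ {μ} {ν} p = ≡-parts (Pointwise.Pointwise-≡⇒≡
    (Sorted.↗↭↗⇒≋ (DecTotalOrder.totalOrder ≥-decTotalOrder) (parts-sorted μ) (parts-sorted ν) (↭⇒↭ₛ p)))

  partition⁺-↭ : ∀ {xs} → All (1 ≤_) xs → parts (partition xs) ↭ xs
  partition⁺-↭ {xs} pos = ↭-trans (partition-↭ xs) (↭-reflexive (filter-all (1 ≤?_) pos))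

  partition-cong : ∀ {xs ys} → xs ↭ ys → partition xs ≡ partition ys
  partition-cong {xs} {ys} p = ≡-↭ (↭-trans (partition-↭ xs) (↭-trans (filter-↭ (1 ≤?_) p) (↭-sym (partition-↭ ys))))

  removeAt-↭ : ∀ {x : ℕ} {xs} (p : x ∈ xs) → x ∷ (xs removeAt p) ↭ xs
  removeAt-↭ (here refl) = ↭-refl
  removeAt-↭ {x} {y ∷ xs} (there p) = ↭-trans (swap x y ↭-refl) (prep y (removeAt-↭ p))

  -- Describes removal of a part up to permutation; this form is the one used from here on, so that
  -- the sorting inside `partition` never has to be unfolded.
  ⊖-∈ : ∀ μ {a} → a ∈ parts μ → ∃[ ν ] (μ ⊖ a ≡ just ν × a ∷ parts ν ↭ parts μ)
  ⊖-∈ μ {a} a∈ with mem? _≟_ a (parts μ)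
  ... | no a∉ = contradiction a∈ a∉
  ... | yes p = _ , refl , ↭-trans (prep a (partition⁺-↭ (All.─⁺ p (parts-positive μ)))) (removeAt-↭ p)

  ⊖-∉ : ∀ μ {a} → a ∉ parts μ → μ ⊖ a ≡ nothing
  ⊖-∉ μ {a} a∉ with mem? _≟_ a (parts μ)
  ... | no _  = refl
  ... | yes p = contradiction p a∉

  ⊖-just : ∀ μ {ν a} → a ∷ parts ν ↭ parts μ → μ ⊖ a ≡ just ν
  ⊖-just μ p with ν′ , eq , p′ ← ⊖-∈ μ (∈-resp-↭ p (here refl)) =
    trans eq (cong just (≡-↭ (drop-∷ (↭-trans p′ (↭-sym p)))))

  ∈⇒≤sum : ∀ {a xs} → a ∈ xs → a ≤ sum xs
  ∈⇒≤sum {xs = a ∷ xs} (here refl) = ℕₚ.m≤m+n a (sum xs)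
  ∈⇒≤sum {xs = b ∷ xs} (there a∈)  = ℕₚ.≤-trans (∈⇒≤sum a∈) (ℕₚ.m≤n+m (sum xs) b)

  sum-filter : ∀ w → sum (filter (1 ≤?_) w) ≡ sum w
  sum-filter []          = refl
  sum-filter (zero ∷ w)  = sum-filter w
  sum-filter (suc k ∷ w) = cong (suc k ℕ.+_) (sum-filter w)

  -- Letters may be 0, but the weights of interest vanish there (see Unitless).
  words : ℕ → ℕ → List (List ℕ)
  words zero    zero    = [] ∷ []
  words zero    (suc _) = []
  words (suc l) m       = concatMap (λ a → map (a ∷_) (words l (m ∸ a))) (upTo (suc m))

  ⨁-words : ∀ l m f → ∑ (words (suc l) m) f ≡ ∑ (upTo (suc m)) (λ a → ∑ (words l (m ∸ a)) (λ w → f (a ∷ w)))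
  ⨁-words l m f = trans (⨁-concatMap (λ a → map (a ∷_) (words l (m ∸ a))) (upTo (suc m)) {f})
    (⨁-cong (upTo (suc m)) λ a → ⨁-map (a ∷_) (words l (m ∸ a)) {f})

  ⨁-words-diag : ∀ l m f → ∑ (words (suc l) m) f ≡ diag m (λ a j → ∑ (words l j) (λ w → f (a ∷ w)))
  ⨁-words-diag l m f = trans (⨁-words l m f) (⨁-upTo m {λ a j → ∑ (words l j) (λ w → f (a ∷ w))})

  words-sum : ∀ l m {w} → w ∈ words l m → sum w ≡ m
  words-sum zero    zero (here refl) = refl
  words-sum (suc l) m    p
    with a , a∈ , q ← find (∈-concatMap⁻ (λ a → map (a ∷_) (words l (m ∸ a))) {xs = upTo (suc m)} p)
    with w , w∈ , refl ← ∈-map⁻ (a ∷_) q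
    = trans (cong (a ℕ.+_) (words-sum l (m ∸ a) w∈)) (ℕₚ.m+[n∸m]≡n (ℕₚ.≤-pred (∈-upTo⁻ a∈)))

  wt : List (ℕ → ℕ) → List ℕ → ℕ
  wt (φ ∷ Φ) (a ∷ w) = φ a ℕ.* wt Φ w
  wt _       _       = 1

  eʷ : List ℕ → Series
  eʷ = foldr (λ k f → elementary k · f) 1ˢ

  ·-leftComm : ∀ f h k α → (f · (h · k)) α ≡ (h · (f · k)) α
  ·-leftComm f h k α = begin
    (f · (h · k)) α  ≡⟨ ·-assoc f h k α ⟨
    ((f · h) · k) α  ≡⟨ ·-cong α {h = k} (λ β _ → ·-comm f h β) (λ _ _ → refl) ⟩
    ((h · f) · k) α  ≡⟨ ·-assoc h f k α ⟩
    (h · (f · k)) α  ∎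
    where open ≡-Reasoning

  eʷ-↭ : ∀ {v w} → v ↭ w → ∀ α → eʷ v α ≡ eʷ w α
  eʷ-↭ ↭.refl             α = refl
  eʷ-↭ (prep k p)         α = ·-cong α {f = elementary k} (λ _ _ → refl) (λ β _ → eʷ-↭ p β)
  eʷ-↭ {_ ∷ _ ∷ v} {_ ∷ _ ∷ w} (swap j k p) α = trans (·-leftComm (elementary j) (elementary k) (eʷ v) α)
    (·-cong α {f = elementary k} (λ _ _ → refl) λ β _ → ·-cong β {f = elementary j} (λ _ _ → refl) (λ γ _ → eʷ-↭ p γ))
  eʷ-↭ (↭.trans p q)      α = trans (eʷ-↭ p α) (eʷ-↭ q α)

  eʷ-filter : ∀ w α → eʷ (filter (1 ≤?_) w) α ≡ eʷ w α
  eʷ-filter []          α = refl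
  eʷ-filter (zero ∷ w)  α = trans (eʷ-filter w α) (trans (sym (·-identityˡ (eʷ w) α))
    (·-cong α {h = eʷ w} (λ β _ → sym (elementary-zero β)) (λ _ _ → refl)))
  eʷ-filter (suc k ∷ w) α = ·-cong α {f = elementary (suc k)} (λ _ _ → refl) (λ β _ → eʷ-filter w β)

  eʷ-partition : ∀ w α → eʷ w α ≡ e (partition w) α
  eʷ-partition w α = sym (trans (eʷ-↭ (partition-↭ w) α) (eʷ-filter w α))

  match? : ∀ w μ → Dec (parts (partition w) ≡ parts μ)
  match? w μ = ≡-dec _≟_ (parts (partition w)) (parts μ)

  -- The coefficient of e_μ in the product of the series Σ_k φ(k) e_k zᵏ for φ in `Φ`: the total
  -- weight of the words, one letter for each factor, whose positive letters rearrange to `μ`.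
  coef : List (ℕ → ℕ) → Partition → ℤ
  coef Φ μ = ∑ (words (length Φ) (size μ)) (λ w → guard (match? w μ) (+ wt Φ w))

  private
    size-partition : ∀ w → size (partition w) ≡ sum w
    size-partition w = trans (sum-↭ (partition-↭ w)) (sum-filter w)

    guard-* : ∀ {P : Set} (d : Dec P) {a b} → guard d a * b ≡ guard d (a * b)
    guard-* (yes _)     = refl
    guard-* (no _)  {b = b} = ℤₚ.*-zeroˡ b

  -- The words are grouped by their partition, which occurs exactly once in `partitionsOf m`; within
  -- a group the products of elementary functions agree by commutativity and e₀ = 1.
  coef-expansion : ∀ Φ m α →
    ∑ (words (length Φ) m) (λ w → + wt Φ w * eʷ w α) ≡ ∑ (partitionsOf m) (λ μ → coef Φ μ * e μ α)
  coef-expansion Φ m α = begin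
    ∑ ws (λ w → + wt Φ w * eʷ w α)
      ≡⟨ ⨁-cong∈ ws (λ w w∈ → term w w∈) ⟩
    ∑ ws (λ w → ∑ (partitionsOf m) (λ μ → guard (match? w μ) (+ wt Φ w) * e μ α))
      ≡⟨ ⨁-swap ws (partitionsOf m) {λ w μ → guard (match? w μ) (+ wt Φ w) * e μ α} ⟩
    ∑ (partitionsOf m) (λ μ → ∑ ws (λ w → guard (match? w μ) (+ wt Φ w) * e μ α))
      ≡⟨ ⨁-cong (partitionsOf m) (λ μ → ⨁-* ws {e μ α} {λ w → guard (match? w μ) (+ wt Φ w)}) ⟨
    ∑ (partitionsOf m) (λ μ → ∑ ws (λ w → guard (match? w μ) (+ wt Φ w)) * e μ α)
      ≡⟨ ⨁-cong∈ (partitionsOf m) (λ μ μ∈ → cong (λ n → ∑ (words (length Φ) n) (λ w → guard (match? w μ) (+ wt Φ w)) * e μ α) (sym (partitionsOf-sound m μ∈))) ⟩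
    ∑ (partitionsOf m) (λ μ → coef Φ μ * e μ α) ∎
    where
    open ≡-Reasoning
    ws = words (length Φ) m
    term : ∀ w → w ∈ ws → + wt Φ w * eʷ w α ≡ ∑ (partitionsOf m) (λ μ → guard (match? w μ) (+ wt Φ w) * e μ α)
    term w w∈ = sym (trans
      (⨁-single {f = λ μ → guard (match? w μ) (+ wt Φ w) * e μ α} (partitionsOf-unique m)
        (subst (λ n → partition w ∈ partitionsOf n) (trans (size-partition w) (words-sum (length Φ) m w∈)) (partitionsOf-complete (partition w)))
        (λ μ _ μ≢ → trans (cong (_* e μ α) (guard-no (match? w μ) (λ eq → μ≢ (sym (≡-parts eq))))) (ℤₚ.*-zeroˡ (e μ α))))
      (cong₂ _*_ (guard-yes (match? w (partition w)) refl) (sym (eʷ-partition w α))))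

  module _ (N : ℕ) where
    private
      module R = RingSums (seriesRing N)
      module 𝕊 = CommutativeRing (seriesRing N)

    Represents : (ℕ → Series) → (ℕ → ℕ) → Set
    Represents F φ = ∀ k → F k 𝕊.≈ ((+ φ k) • elementary k)

    private
      scale : ∀ {A : Set} (xs : List A) k f (c : A → ℤ) (h : A → Series) α →
        ((k • f) · (λ γ → ∑ xs (λ x → c x * h x γ))) α ≡ ∑ xs (λ x → k * c x * (f · h x) α)
      scale xs k f c h α = begin
        ∑ (splits α) (λ (β , γ) → k * f β * ∑ xs (λ x → c x * h x γ))
          ≡⟨ ⨁-cong (splits α) (λ (β , γ) → trans (*-⨁ xs {k * f β} {λ x → c x * h x γ}) (⨁-cong xs λ x → interchange k (f β) (c x) (h x γ))) ⟩
        ∑ (splits α) (λ (β , γ) → ∑ xs (λ x → k * c x * (f β * h x γ)))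
          ≡⟨ ⨁-swap (splits α) xs {λ (β , γ) x → k * c x * (f β * h x γ)} ⟩
        ∑ xs (λ x → ∑ (splits α) (λ (β , γ) → k * c x * (f β * h x γ)))
          ≡⟨ ⨁-cong xs (λ x → *-⨁ (splits α) {k * c x} {λ (β , γ) → f β * h x γ}) ⟨
        ∑ xs (λ x → k * c x * (f · h x) α) ∎
        where
        open ≡-Reasoning
        open import Algebra.Properties.CommutativeSemigroup ℤₚ.*-commutativeSemigroup using (interchange)

    ⟦⟧-words : ∀ {Fs Φ} → Pointwise Represents Fs Φ → ∀ m α → length α ≡ N →
      R.⟦ Fs ⟧ m α ≡ ∑ (words (length Φ) m) (λ w → + wt Φ w * eʷ w α)
    ⟦⟧-words []            zero    α p = sym (trans (ℤₚ.+-identityʳ _) (ℤₚ.*-identityˡ (1ˢ α)))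
    ⟦⟧-words []            (suc m) α p = refl
    ⟦⟧-words {F ∷ Fs} {φ ∷ Φ} (r ∷ rs) m α p = begin
      R.diag m (λ a j → F a · R.⟦ Fs ⟧ j) α
        ≡⟨ diag-eval N m α ⟩
      diag m (λ a j → (F a · R.⟦ Fs ⟧ j) α)
        ≡⟨ diag-cong m (λ a j _ → trans
             (·-cong α (λ β q → r a β (trans q p)) (λ β q → ⟦⟧-words rs j β (trans q p)))
             (trans (scale (words (length Φ) j) (+ φ a) (elementary a) (λ w → + wt Φ w) eʷ α)
               (⨁-cong (words (length Φ) j) λ w → cong (_* eʷ (a ∷ w) α) (sym (ℤₚ.pos-* (φ a) (wt Φ w)))))) ⟩
      diag m (λ a j → ∑ (words (length Φ) j) (λ w → + wt (φ ∷ Φ) (a ∷ w) * eʷ (a ∷ w) α))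
        ≡⟨ ⨁-words-diag (length Φ) m (λ w → + wt (φ ∷ Φ) w * eʷ w α) ⟨
      ∑ (words (suc (length Φ)) m) (λ w → + wt (φ ∷ Φ) w * eʷ w α) ∎
      where open ≡-Reasoning

  -- No factor has a constant term, so words with a letter 0 have weight zero and the number of
  -- factors equals the number of parts.
  Unitless : List (ℕ → ℕ) → Set
  Unitless = All (λ φ → φ 0 ≡ 0)

  module _ (φ : ℕ → ℕ) (φ0 : φ 0 ≡ 0) (Φ : List (ℕ → ℕ)) where

    -- Classification of words by their first letter `a`, after which the rest is a word for μ - a.
    -- The list `L` is flexible since non-parts contribute 0: it will be `supp μ`, the support of a
    -- larger partition, or an explicit list of the distinct parts.
    coef-∷ : ∀ μ {L} → Unique L → (∀ {a} → a ∈ parts μ → a ∈ L) →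
      coef (φ ∷ Φ) μ ≡ ∑ L (λ a → + φ a * maybe′ (coef Φ) 0ℤ (μ ⊖ a))
    coef-∷ μ {L} u parts⊆ = begin
      coef (φ ∷ Φ) μ
        ≡⟨ ⨁-words (length Φ) (size μ) (λ w → guard (match? w μ) (+ wt (φ ∷ Φ) w)) ⟩
      ∑ (upTo (suc (size μ))) (λ a → inner a)
        ≡⟨ ⨁-cong (upTo (suc (size μ))) term ⟩
      ∑ (upTo (suc (size μ))) f
        ≡⟨ ⨁-support _≟_ (Unique.upTo⁺ (suc (size μ))) u (λ a _ a∉ → f-zero (a∉ ∘ parts⊆))
             (λ a _ a∉ → f-zero (a∉ ∘ λ a∈ → ∈-upTo⁺ (s≤s (∈⇒≤sum a∈)))) ⟩
      ∑ L f ∎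
      where
      open ≡-Reasoning
      inner f : ℕ → ℤ
      inner a = ∑ (words (length Φ) (size μ ∸ a)) (λ w → guard (match? (a ∷ w) μ) (+ (φ a ℕ.* wt Φ w)))
      f a = + φ a * maybe′ (coef Φ) 0ℤ (μ ⊖ a)

      f-zero : ∀ {a} → a ∉ parts μ → f a ≡ 0ℤ
      f-zero {a} a∉ = trans (cong (λ ν → + φ a * maybe′ (coef Φ) 0ℤ ν) (⊖-∉ μ a∉)) (ℤₚ.*-zeroʳ (+ φ a))

      match-∷ : ∀ {a w} → parts (partition (suc a ∷ w)) ≡ parts μ → suc a ∷ filter (1 ≤?_) w ↭ parts μ
      match-∷ {a} {w} eq = ↭-trans (↭-sym (partition-↭ (suc a ∷ w))) (↭-reflexive eq)

      term : ∀ a → inner a ≡ f a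
      -- A first letter 0 is invisible in the partition and cannot be treated as a removed part; its
      -- weight is zero instead.
      term zero = trans
        (⨁-ε (words (length Φ) (size μ)) λ w _ → trans (guard-congʳ (match? (0 ∷ w) μ) (cong (λ k → + (k ℕ.* wt Φ w)) φ0)) (guard-ε (match? (0 ∷ w) μ)))
        (sym (trans (cong (λ k → + k * maybe′ (coef Φ) 0ℤ (μ ⊖ 0)) φ0) (ℤₚ.*-zeroˡ (maybe′ (coef Φ) 0ℤ (μ ⊖ 0)))))
      term (suc a) with mem? _≟_ (suc a) (parts μ)
      ... | no a∉ = trans (⨁-ε (words (length Φ) (size μ ∸ suc a)) λ w _ →
          guard-no (match? (suc a ∷ w) μ) (λ eq → a∉ (∈-resp-↭ (match-∷ {w = w} eq) (here refl))))
        (sym (ℤₚ.*-zeroʳ (+ φ (suc a))))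
      ... | yes a∈ = let ν = partition (parts μ removeAt a∈) in found ν
          (↭-trans (prep (suc a) (partition⁺-↭ (All.─⁺ a∈ (parts-positive μ)))) (removeAt-↭ a∈))
        where
        found : ∀ ν → suc a ∷ parts ν ↭ parts μ → inner (suc a) ≡ + φ (suc a) * coef Φ ν
        found ν p = begin
          inner (suc a)
            ≡⟨ cong (λ n → ∑ (words (length Φ) n) (λ w → guard (match? (suc a ∷ w) μ) (+ (φ (suc a) ℕ.* wt Φ w)))) size-ν ⟩
          ∑ (words (length Φ) (size ν)) (λ w → guard (match? (suc a ∷ w) μ) (+ (φ (suc a) ℕ.* wt Φ w)))
            ≡⟨ ⨁-cong (words (length Φ) (size ν)) (λ w → trans
                 (guard-cong (match? (suc a ∷ w) μ) (match? w ν) (there⁻ w) (there⁺ w) (ℤₚ.pos-* (φ (suc a)) (wt Φ w)))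
                 (sym (*-guard (match? w ν) {+ φ (suc a)} {+ wt Φ w}))) ⟩
          ∑ (words (length Φ) (size ν)) (λ w → + φ (suc a) * guard (match? w ν) (+ wt Φ w))
            ≡⟨ *-⨁ (words (length Φ) (size ν)) {+ φ (suc a)} {λ w → guard (match? w ν) (+ wt Φ w)} ⟨
          + φ (suc a) * coef Φ ν ∎
          where
          size-ν : size μ ∸ suc a ≡ size ν
          size-ν = trans (cong (_∸ suc a) (sym (sum-↭ p))) (ℕₚ.m+n∸m≡n (suc a) (size ν))
          there⁻ : ∀ w → parts (partition (suc a ∷ w)) ≡ parts μ → parts (partition w) ≡ parts ν
          there⁻ w eq = cong parts (≡-↭ {partition w} {ν} (↭-trans (partition-↭ w) (drop-∷ (↭-trans (match-∷ {w = w} eq) (↭-sym p)))))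
          there⁺ : ∀ w → parts (partition w) ≡ parts ν → parts (partition (suc a ∷ w)) ≡ parts μ
          there⁺ w eq = cong parts (≡-↭ {partition (suc a ∷ w)} {μ} (↭-trans (partition-↭ (suc a ∷ w))
            (↭-trans (prep (suc a) (↭-trans (↭-sym (partition-↭ w)) (↭-reflexive eq))) p)))

  supp-unique : ∀ μ → Unique (supp μ)
  supp-unique μ = deduplicate-! _≟_ (parts μ)

  ∈-supp⁺ : ∀ μ {a} → a ∈ parts μ → a ∈ supp μ
  ∈-supp⁺ μ = ∈-deduplicate⁺ _≟_

  ∈-supp⁻ : ∀ μ {a} → a ∈ supp μ → a ∈ parts μ
  ∈-supp⁻ μ = ∈-deduplicate⁻ _≟_ (parts μ)

  coef-∷-zero : ∀ φ → φ 0 ≡ 0 → ∀ Φ μ → (∀ a ν → a ∷ parts ν ↭ parts μ → + φ a * coef Φ ν ≡ 0ℤ) → coef (φ ∷ Φ) μ ≡ 0ℤ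
  coef-∷-zero φ φ0 Φ μ h = trans (coef-∷ φ φ0 Φ μ (supp-unique μ) (∈-supp⁺ μ)) (⨁-ε (supp μ) term)
    where
    term : ∀ a → a ∈ supp μ → + φ a * maybe′ (coef Φ) 0ℤ (μ ⊖ a) ≡ 0ℤ
    term a a∈ with ν , eq , p ← ⊖-∈ μ (∈-supp⁻ μ a∈) rewrite eq = h a ν p

  coef-[]-zero : ∀ μ → parts μ ≢ [] → coef [] μ ≡ 0ℤ
  coef-[]-zero μ ≢[] = ⨁-ε (words 0 (size μ)) λ w w∈ → guard-no (match? w μ) (no-match (size μ) w∈)
    where
    no-match : ∀ m {w} → w ∈ words 0 m → parts (partition w) ≢ parts μ
    no-match zero (here refl) eq = ≢[] (sym eq)

  coef-length : ∀ {Φ} → Unitless Φ → ∀ μ → length Φ ≢ ℓ μ → coef Φ μ ≡ 0ℤ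
  coef-length []                    μ ≢ℓ = coef-[]-zero μ λ eq → ≢ℓ (sym (cong length eq))
  coef-length {φ ∷ Φ} (φ0 ∷ Φ0) μ ≢ℓ = coef-∷-zero φ φ0 Φ μ λ a ν p →
    trans (cong (+ φ a *_) (coef-length Φ0 ν λ eq → ≢ℓ (trans (cong suc eq) (↭-length p)))) (ℤₚ.*-zeroʳ (+ φ a))

  -- The part `b` must be the letter of some factor, and every factor gives it weight 0.
  coef-∈ : ∀ {Φ} → Unitless Φ → ∀ {b} → All (λ φ → φ b ≡ 0) Φ → ∀ μ → b ∈ parts μ → coef Φ μ ≡ 0ℤ
  coef-∈ [] {b} _ μ b∈ = coef-[]-zero μ λ eq → contradiction (subst (b ∈_) eq b∈) λ ()
  coef-∈ {φ ∷ Φ} (φ0 ∷ Φ0) {b} (φb ∷ Φb) μ b∈ = coef-∷-zero φ φ0 Φ μ λ a ν p → term a ν (∈-resp-↭ (↭-sym p) b∈)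
    where
    term : ∀ a ν → b ∈ a ∷ parts ν → + φ a * coef Φ ν ≡ 0ℤ
    term a ν (here refl) = trans (cong (λ k → + k * coef Φ ν) φb) (ℤₚ.*-zeroˡ (coef Φ ν))
    term a ν (there b∈)  = trans (cong (+ φ a *_) (coef-∈ Φ0 Φb ν b∈)) (ℤₚ.*-zeroʳ (+ φ a))

  -- Exchanging the first two letters changes neither the partition nor the weight. This lets
  -- whichever factor is decisive be treated as the first one.
  coef-swap : ∀ φ ψ Φ μ → coef (φ ∷ ψ ∷ Φ) μ ≡ coef (ψ ∷ φ ∷ Φ) μ
  coef-swap φ ψ Φ μ = begin
    coef (φ ∷ ψ ∷ Φ) μ
      ≡⟨ unfold φ ψ ⟩
    diag (size μ) (λ a n → diag n (λ b j → ∑ (words (length Φ) j) (λ w → guard (match? (a ∷ b ∷ w) μ) (+ wt (φ ∷ ψ ∷ Φ) (a ∷ b ∷ w)))))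
      ≡⟨ diag-swap (size μ) {λ a b j → ∑ (words (length Φ) j) (λ w → guard (match? (a ∷ b ∷ w) μ) (+ wt (φ ∷ ψ ∷ Φ) (a ∷ b ∷ w)))} ⟩
    diag (size μ) (λ b n → diag n (λ a j → ∑ (words (length Φ) j) (λ w → guard (match? (a ∷ b ∷ w) μ) (+ wt (φ ∷ ψ ∷ Φ) (a ∷ b ∷ w)))))
      ≡⟨ diag-cong (size μ) (λ b n _ → diag-cong n λ a j _ → ⨁-cong (words (length Φ) j) λ w →
           guard-cong (match? (a ∷ b ∷ w) μ) (match? (b ∷ a ∷ w) μ)
             (trans (cong parts (partition-cong (swap b a (↭-refl {x = w})))))
             (trans (cong parts (partition-cong (swap a b (↭-refl {x = w})))))
             (cong +_ (x∙yz≈y∙xz (φ a) (ψ b) (wt Φ w)))) ⟩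
    diag (size μ) (λ b n → diag n (λ a j → ∑ (words (length Φ) j) (λ w → guard (match? (b ∷ a ∷ w) μ) (+ wt (ψ ∷ φ ∷ Φ) (b ∷ a ∷ w)))))
      ≡⟨ unfold ψ φ ⟨
    coef (ψ ∷ φ ∷ Φ) μ ∎
    where
    open ≡-Reasoning
    open import Algebra.Properties.CommutativeSemigroup ℕₚ.*-commutativeSemigroup using (x∙yz≈y∙xz)
    unfold : ∀ φ ψ → coef (φ ∷ ψ ∷ Φ) μ ≡ diag (size μ) (λ a n → diag n (λ b j → ∑ (words (length Φ) j) (λ w → guard (match? (a ∷ b ∷ w) μ) (+ wt (φ ∷ ψ ∷ Φ) (a ∷ b ∷ w)))))
    unfold φ ψ = trans (⨁-words-diag (suc (length Φ)) (size μ) (λ w → guard (match? w μ) (+ wt (φ ∷ ψ ∷ Φ) w)))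
      (diag-cong (size μ) λ a n _ → ⨁-words-diag (length Φ) n (λ w → guard (match? (a ∷ w) μ) (+ wt (φ ∷ ψ ∷ Φ) (a ∷ w))))

-- Linear independence of the e_λ.

module Independence where

  open import Defs
  open import Data.Integer.Base using (ℤ; +_; 0ℤ; _+_; _*_; -_; _-_)
  open import Data.Integer.Properties as ℤₚ using (+-*-commutativeRing)
  open import Data.List.Base using (List; []; _∷_; _++_; map; length; filter; replicate)
  open import Data.List.Membership.Propositional using (_∈_)
  open import Data.List.Membership.Propositional.Properties using (∈-map⁺; ∈-map⁻; ∈-filter⁺; ∈-filter⁻)
  open import Data.List.Properties using (map-∘; map-id-local)
  open import Data.List.Relation.Unary.All as All using (All; []; _∷_)
  import Data.List.Relation.Unary.All.Properties as All
  open import Data.List.Relation.Unary.Linked as Linked using (Linked; []; [-]; _∷_)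
  import Data.List.Relation.Unary.Linked.Properties as Linked
  open import Data.List.Relation.Unary.Unique.Propositional using (Unique)
  import Data.List.Relation.Unary.Unique.Propositional.Properties as Unique
  open import Data.Nat.Base as ℕ using (ℕ; zero; suc; pred; _∸_; _≤_; _≥_; _<_; z≤n; s≤s)
  open import Data.Nat.ListAction using (sum)
  open import Data.Nat.Properties as ℕₚ using (_≟_; _≤?_)
  open import Data.Product.Base using (_×_; _,_; proj₁; proj₂)
  open import Function.Base using (_∘_)
  open import Relation.Binary.Definitions using (tri<; tri≈; tri>)
  open import Relation.Binary.PropositionalEquality using (_≡_; refl; sym; trans; cong; cong₂; subst; module ≡-Reasoning)
  open import Relation.Nullary using (contradiction)
  open Sums
  open SeriesRing
  open WordCoefficients

  open RingSums +-*-commutativeRing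

  elementary-·-suc : ∀ k f n β →
    (elementary (suc k) · f) (suc n ∷ β) ≡ (elementary (suc k) · (f ∂ suc n)) β + (elementary k · (f ∂ n)) β
  elementary-·-suc k f n β = trans (·-∷ (elementary (suc k)) f (suc n) β)
    (cong (λ s → (elementary (suc k) · (f ∂ suc n)) β + s)
      (diag-head n λ i j → ·-zeroˡ (elementary (suc k) ∂ suc (suc i)) (f ∂ j) β λ _ → refl))

  -- Every factor is at most linear in x₁, so the degree in x₁ is at most the number of factors.
  eʷ-high : ∀ {w} → All (1 ≤_) w → ∀ {i} β → length w < i → eʷ w (i ∷ β) ≡ 0ℤ
  eʷ-high []                       {suc i} β _       = refl
  eʷ-high {suc k ∷ w} (s≤s _ ∷ ps) {suc i} β (s≤s p) = trans (elementary-·-suc k (eʷ w) i β) (cong₂ _+_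
    (trans (·-comm (elementary (suc k)) (eʷ w ∂ suc i) β) (·-zeroˡ (eʷ w ∂ suc i) (elementary (suc k)) β λ γ → eʷ-high ps γ (ℕₚ.m<n⇒m<1+n p)))
    (trans (·-comm (elementary k) (eʷ w ∂ i) β) (·-zeroˡ (eʷ w ∂ i) (elementary k) β λ γ → eʷ-high ps γ p)))

  -- To reach the maximal power, x₁ must be taken from every factor, and the coefficient of x₁ in
  -- e_k is e_{k-1} in the other variables.
  eʷ-top : ∀ {w} → All (1 ≤_) w → ∀ β → eʷ w (length w ∷ β) ≡ eʷ (map pred w) β
  eʷ-top []                       β = refl
  eʷ-top {suc k ∷ w} (s≤s _ ∷ ps) β = begin
    eʷ (suc k ∷ w) (suc n ∷ β)
      ≡⟨ elementary-·-suc k (eʷ w) n β ⟩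
    (elementary (suc k) · (eʷ w ∂ suc n)) β + (elementary k · (eʷ w ∂ n)) β
      ≡⟨ cong₂ _+_
           (trans (·-comm (elementary (suc k)) (eʷ w ∂ suc n) β) (·-zeroˡ (eʷ w ∂ suc n) (elementary (suc k)) β λ γ → eʷ-high ps γ (ℕₚ.n<1+n n)))
           (·-cong β {f = elementary k} (λ _ _ → refl) (λ γ _ → eʷ-top ps γ)) ⟩
    0ℤ + (elementary k · eʷ (map pred w)) β
      ≡⟨ ℤₚ.+-identityˡ _ ⟩
    eʷ (k ∷ map pred w) β ∎
    where
    open ≡-Reasoning
    n = length w

  -- Removing the first column of a Young diagram, and restoring it when its
  -- length L is known.
  dropColumn : List ℕ → List ℕ
  dropColumn μ = filter (1 ≤?_) (map pred μ)

  addColumn : ℕ → List ℕ → List ℕ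
  addColumn L ν = map suc ν ++ replicate (L ∸ length ν) 1

  IsPartition : List ℕ → Set
  IsPartition μ = Linked _≥_ μ × All (1 ≤_) μ

  dropColumn-isPartition : ∀ {μ} → IsPartition μ → IsPartition (dropColumn μ)
  dropColumn-isPartition {μ} (s , _) =
    Linked.filter⁺ (1 ≤?_) (λ p q → ℕₚ.≤-trans q p) (Linked.map⁺ (Linked.map ℕₚ.pred-mono-≤ s)) , All.all-filter (1 ≤?_) (map pred μ)

  -- Dropping a column erases precisely the parts equal to 1. In a decreasing list they stand at the
  -- end, and the known length tells how many to append.
  addColumn-dropColumn : ∀ {μ} → IsPartition μ → addColumn (length μ) (dropColumn μ) ≡ μ
  addColumn-dropColumn {[]}              _               = refl
  addColumn-dropColumn {suc zero ∷ μ}    (s , _ ∷ ps)    = trans (cong (addColumn (suc (length μ))) (none s ps)) (cong (1 ∷_) (ones s ps))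
    where
    none : ∀ {μ} → Linked _≥_ (1 ∷ μ) → All (1 ≤_) μ → dropColumn μ ≡ []
    none [-]            []       = refl
    none (s≤s z≤n ∷ s)  (s≤s _ ∷ ps) = none s ps
    ones : ∀ {μ} → Linked _≥_ (1 ∷ μ) → All (1 ≤_) μ → replicate (length μ) 1 ≡ μ
    ones [-]            []       = refl
    ones (s≤s z≤n ∷ s)  (s≤s _ ∷ ps) = cong (1 ∷_) (ones s ps)
  addColumn-dropColumn {suc (suc a) ∷ μ} (s , _ ∷ ps)    = cong (suc (suc a) ∷_) (addColumn-dropColumn (Linked.tail s , ps))

  dropColumn-sum : ∀ {μ B} → 1 ≤ length μ → All (1 ≤_) μ → sum μ ≤ suc B → sum (dropColumn μ) ≤ B
  dropColumn-sum {suc a ∷ μ} {B} _ (s≤s _ ∷ _) (s≤s p) = begin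
    sum (dropColumn (suc a ∷ μ)) ≡⟨ sum-filter (a ∷ map pred μ) ⟩
    a ℕ.+ sum (map pred μ)       ≤⟨ ℕₚ.+-monoʳ-≤ a (pred-sum μ) ⟩
    a ℕ.+ sum μ                  ≤⟨ p ⟩
    B                            ∎
    where
    open ℕₚ.≤-Reasoning
    pred-sum : ∀ xs → sum (map pred xs) ≤ sum xs
    pred-sum []       = z≤n
    pred-sum (x ∷ xs) = ℕₚ.+-mono-≤ (ℕₚ.pred[n]≤n {x}) (pred-sum xs)

  length≤sum : ∀ {xs} → All (1 ≤_) xs → length xs ≤ sum xs
  length≤sum []                      = z≤n
  length≤sum {_ ∷ _} (p ∷ ps) = ℕₚ.+-mono-≤ p (length≤sum ps)

  -- Among the e_μ, those with ℓ(μ) = L maximal are the only ones containing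
  -- monomials divisible by x₁^L, and the coefficient of x₁^L in e_μ is e_ν in
  -- the other variables, ν being μ without its first column.
  independent : ∀ B M → Unique M → (∀ {μ} → μ ∈ M → IsPartition μ × sum μ ≤ B) → (c : List ℕ → ℤ) →
    (∀ α → ∑ M (λ μ → c μ * eʷ μ α) ≡ 0ℤ) → ∀ {μ} → μ ∈ M → c μ ≡ 0ℤ
  independent B M unique valid c relation {μ} μ∈ = below (suc B) μ∈ (ℕₚ.m≤n+m (suc B) (length μ))
    where
    length≤B : ∀ {μ} → μ ∈ M → length μ ≤ B
    length≤B μ∈ = let (_ , ps) , q = valid μ∈ in ℕₚ.≤-trans (length≤sum ps) q

    -- The empty partition has no column to drop. Once all other coefficients vanish, the constant
    -- monomial isolates its coefficient.
    empty : [] ∈ M → (∀ {ν} → ν ∈ M → 0 < length ν → c ν ≡ 0ℤ) → c [] ≡ 0ℤ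
    empty []∈ longer = begin
      c []                                ≡⟨ ℤₚ.*-identityʳ (c []) ⟨
      c [] * eʷ [] []                     ≡⟨ ⨁-single {f = λ ν → c ν * eʷ ν []} unique []∈ (λ where
                                               [] _ []≢ → contradiction refl []≢
                                               ν@(_ ∷ _) ν∈ _ → trans (cong (_* eʷ ν []) (longer ν∈ (s≤s z≤n))) (ℤₚ.*-zeroˡ (eʷ ν []))) ⟨
      ∑ M (λ ν → c ν * eʷ ν [])           ≡⟨ relation [] ⟩
      0ℤ                                  ∎
      where open ≡-Reasoning

    -- A nonempty first column has at least one box, so the bound on the sums decreases; the
    -- recursion of `independent` runs on this bound. With bound 0 there is no nonempty partition.
    step : ∀ B → (∀ {ν} → ν ∈ M → sum ν ≤ B) → ∀ {μ} → μ ∈ M → 1 ≤ length μ →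
      (∀ {ν} → ν ∈ M → length μ < length ν → c ν ≡ 0ℤ) → c μ ≡ 0ℤ
    step zero    sum≤ {μ} μ∈ 1≤L longer = contradiction (ℕₚ.≤-trans 1≤L (ℕₚ.≤-trans (length≤sum (proj₂ (proj₁ (valid μ∈)))) (sum≤ μ∈))) λ ()
    step (suc B) sum≤ {μ} μ∈ 1≤L longer =
      trans (cong c (sym (restore (∈-filter⁺ (λ ν → length ν ≟ L) μ∈ refl))))
        (independent B (map dropColumn top) unique′ valid′ (c ∘ addColumn L) relation′
          (∈-map⁺ dropColumn (∈-filter⁺ (λ ν → length ν ≟ L) μ∈ refl)))
      where
      open ≡-Reasoning
      L = length μ
      top = filter (λ ν → length ν ≟ L) M

      restore : ∀ {ν} → ν ∈ top → addColumn L (dropColumn ν) ≡ ν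
      restore {ν} ν∈ with ν∈M , eq ← ∈-filter⁻ (λ ν → length ν ≟ L) ν∈ = subst (λ n → addColumn n (dropColumn ν) ≡ ν) eq (addColumn-dropColumn (proj₁ (valid ν∈M)))

      unique′ : Unique (map dropColumn top)
      unique′ = Unique.map⁻ {f = addColumn L} (subst Unique
        (sym (trans (sym (map-∘ top)) (map-id-local (All.tabulate restore))))
        (Unique.filter⁺ (λ ν → length ν ≟ L) unique))

      valid′ : ∀ {ν} → ν ∈ map dropColumn top → IsPartition ν × sum ν ≤ B
      valid′ ν∈ with ξ , ξ∈ , refl ← ∈-map⁻ dropColumn ν∈ with ξ∈M , eq ← ∈-filter⁻ (λ ν → length ν ≟ L) ξ∈ =
        dropColumn-isPartition (proj₁ (valid ξ∈M)) , dropColumn-sum (subst (1 ≤_) (sym eq) 1≤L) (proj₂ (proj₁ (valid ξ∈M))) (sum≤ ξ∈M)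

      -- At x₁ to the power `L`, shorter ν have too small a degree, longer ν already have
      -- coefficient zero, and those of length `L` lose their first column.
      term : ∀ β ν → ν ∈ M → guard (length ν ≟ L) (c ν * eʷ (dropColumn ν) β) ≡ c ν * eʷ ν (L ∷ β)
      term β ν ν∈ with ℕₚ.<-cmp (length ν) L
      ... | tri< ν<L ν≢L _ = trans (guard-no (length ν ≟ L) ν≢L)
        (sym (trans (cong (c ν *_) (eʷ-high (proj₂ (proj₁ (valid ν∈))) β ν<L)) (ℤₚ.*-zeroʳ (c ν))))
      ... | tri> _ ν≢L L<ν = trans (guard-no (length ν ≟ L) ν≢L)
        (sym (trans (cong (_* eʷ ν (L ∷ β)) (longer ν∈ L<ν)) (ℤₚ.*-zeroˡ (eʷ ν (L ∷ β)))))
      ... | tri≈ _ ν≡L _ = trans (guard-yes (length ν ≟ L) ν≡L) (cong (c ν *_)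
        (trans (eʷ-filter (map pred ν) β) (trans (sym (eʷ-top (proj₂ (proj₁ (valid ν∈))) β)) (cong (λ n → eʷ ν (n ∷ β)) ν≡L))))

      relation′ : ∀ β → ∑ (map dropColumn top) (λ ν → c (addColumn L ν) * eʷ ν β) ≡ 0ℤ
      relation′ β = begin
        ∑ (map dropColumn top) (λ ν → c (addColumn L ν) * eʷ ν β)
          ≡⟨ ⨁-map dropColumn top {λ ν → c (addColumn L ν) * eʷ ν β} ⟩
        ∑ top (λ ν → c (addColumn L (dropColumn ν)) * eʷ (dropColumn ν) β)
          ≡⟨ ⨁-cong∈ top (λ ν ν∈ → cong (λ ξ → c ξ * eʷ (dropColumn ν) β) (restore ν∈)) ⟩
        ∑ top (λ ν → c ν * eʷ (dropColumn ν) β)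
          ≡⟨ ⨁-filter (λ ν → length ν ≟ L) M {λ ν → c ν * eʷ (dropColumn ν) β} ⟩
        ∑ M (λ ν → guard (length ν ≟ L) (c ν * eʷ (dropColumn ν) β))
          ≡⟨ ⨁-cong∈ M (term β) ⟩
        ∑ M (λ ν → c ν * eʷ ν (L ∷ β))
          ≡⟨ relation (L ∷ β) ⟩
        0ℤ ∎

    -- Downward induction on the length, whose maximum is at most `B`: the number `s` exceeds the
    -- distance from `length μ` to `B`.
    below : ∀ s {μ} → μ ∈ M → B < length μ ℕ.+ s → c μ ≡ 0ℤ
    below zero    {μ} μ∈ p = contradiction (length≤B μ∈) (ℕₚ.<⇒≱ (subst (B <_) (ℕₚ.+-identityʳ (length μ)) p))
    below (suc s) {μ} μ∈ p = cases μ μ∈ λ {ν} ν∈ L<ν →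
      below s ν∈ (ℕₚ.<-≤-trans (subst (B <_) (ℕₚ.+-suc (length μ) s) p) (ℕₚ.+-monoˡ-≤ s L<ν))
      where
      cases : ∀ μ → μ ∈ M → (∀ {ν} → ν ∈ M → length μ < length ν → c ν ≡ 0ℤ) → c μ ≡ 0ℤ
      cases []        μ∈ longer = empty μ∈ longer
      cases μ@(_ ∷ _) μ∈ longer = step B (proj₂ ∘ valid) μ∈ (s≤s z≤n) longer

  expansion-unique : ∀ {F c c′} → EExpansion F c → EExpansion F c′ → ∀ μ → c′ μ ≡ c μ
  expansion-unique {F} {c} {c′} ex ex′ μ = ℤₚ.i-j≡0⇒i≡j (c′ μ) (c μ)
    (subst (λ ν → c′ ν - c ν ≡ 0ℤ) (partition∘parts μ)
      (independent m (map parts (partitionsOf m)) (Unique.map⁺ ≡-parts (partitionsOf-unique m)) valid d relation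
        (∈-map⁺ parts (partitionsOf-complete μ))))
    where
    open ≡-Reasoning
    m = size μ
    d : List ℕ → ℤ
    d xs = c′ (partition xs) - c (partition xs)

    valid : ∀ {xs} → xs ∈ map parts (partitionsOf m) → IsPartition xs × sum xs ≤ m
    valid xs∈ with ν , ν∈ , refl ← ∈-map⁻ parts xs∈ = (parts-sorted ν , parts-positive ν) , ℕₚ.≤-reflexive (partitionsOf-sound m ν∈)

    relation : ∀ α → ∑ (map parts (partitionsOf m)) (λ xs → d xs * eʷ xs α) ≡ 0ℤ
    relation α = ∙-cancelʳ (F m α) _ _ (begin
      ∑ (map parts (partitionsOf m)) (λ xs → d xs * eʷ xs α) + F m α
        ≡⟨ cong₂ _+_ (trans (⨁-map parts (partitionsOf m) {λ xs → d xs * eʷ xs α})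
             (⨁-cong (partitionsOf m) λ ν → cong (λ ξ → (c′ ξ - c ξ) * e ν α) (partition∘parts ν))) (ex m α) ⟩
      ∑ (partitionsOf m) (λ ν → (c′ ν - c ν) * e ν α) + ∑ (partitionsOf m) (λ ν → c ν * e ν α)
        ≡⟨ ⨁-∙ (partitionsOf m) {λ ν → (c′ ν - c ν) * e ν α} {λ ν → c ν * e ν α} ⟨
      ∑ (partitionsOf m) (λ ν → (c′ ν - c ν) * e ν α + c ν * e ν α)
        ≡⟨ ⨁-cong (partitionsOf m) (λ ν → cancel (c′ ν) (c ν) (e ν α)) ⟩
      ∑ (partitionsOf m) (λ ν → c′ ν * e ν α)
        ≡⟨ ex′ m α ⟨
      F m α
        ≡⟨ ℤₚ.+-identityˡ (F m α) ⟨
      0ℤ + F m α ∎)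
      where
      open import Algebra.Properties.AbelianGroup ℤₚ.+-0-abelianGroup using (∙-cancelʳ)
      cancel : ∀ x y z → (x - y) * z + y * z ≡ x * z
      cancel x y z = trans (sym (ℤₚ.*-distribʳ-+ z (x - y) y)) (cong (_* z)
        (trans (ℤₚ.+-assoc x (- y) y) (trans (cong (λ t → x + t) (ℤₚ.+-inverseˡ y)) (ℤₚ.+-identityʳ x))))

  hasECoefficients : ∀ {F c} → EExpansion F c → F HasECoefficients c
  hasECoefficients ex = record { expansion = ex ; unique = λ c′ → expansion-unique ex }

-- The multinomial expression `ε` as a coefficient of a power of G.

module Multinomials where

  open import Defs
  open import Data.Integer.Base as ℤ using (ℤ; +_; 0ℤ; 1ℤ; _+_; _*_)
  open import Data.Integer.Properties as ℤₚ using (+-*-commutativeRing)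
  open import Data.List.Base using (List; []; _∷_; map; length; replicate)
  open import Data.List.Membership.Propositional using (_∈_; _∉_)
  open import Data.List.Properties using (filter-none; filter-accept; filter-reject)
  open import Data.List.Relation.Binary.Permutation.Propositional using (_↭_)
  open import Data.List.Relation.Binary.Permutation.Propositional.Properties using (↭-length; ∈-resp-↭; filter-↭)
  open import Data.List.Relation.Unary.All as All using (All; []; _∷_)
  open import Data.List.Relation.Unary.Any using (here; there)
  open import Data.List.Relation.Unary.Unique.Propositional using (Unique)
  open import Data.Maybe.Base using (maybe′)
  open import Data.Nat.Base as ℕ using (ℕ; zero; suc; _∸_; _^_; _!)
  open import Data.Nat.ListAction using (product)
  open import Data.Nat.Properties as ℕₚ using (_≟_)
  open import Data.Nat.Solver using (module +-*-Solver)
  open import Data.Product.Base using (_,_)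
  open import Function.Base using (_∘_)
  open import Relation.Binary.PropositionalEquality using (_≡_; _≢_; refl; sym; trans; cong; subst; module ≡-Reasoning)
  open import Relation.Nullary using (Dec; yes; no; contradiction)
  open Sums
  open SmirnovWords
  open Colourings using (length-filter-⨁)
  open WordCoefficients

  open RingSums +-*-commutativeRing
  module ℕΠ = BigOp ℕₚ.*-1-commutativeMonoid

  private
    product-map : ∀ (f : ℕ → ℕ) xs → product (map f xs) ≡ ℕΠ.⨁ xs f
    product-map f []       = refl
    product-map f (x ∷ xs) = cong (f x ℕ.*_) (product-map f xs)

    ⨁-scale : ∀ {L} {f h : ℕ → ℕ} {a k} → Unique L → a ∈ L → f a ≡ k ℕ.* h a → (∀ j → j ≢ a → f j ≡ h j) →
      ℕΠ.⨁ L f ≡ k ℕ.* ℕΠ.⨁ L h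
    ⨁-scale {L} {f} {h} {a} {k} u a∈ fa fj = begin
      ℕΠ.⨁ L f                                             ≡⟨ ℕΠ.⨁-cong L split ⟩
      ℕΠ.⨁ L (λ j → ℕΠ.guard (a ≟ j) k ℕ.* h j)            ≡⟨ ℕΠ.⨁-∙ L {λ j → ℕΠ.guard (a ≟ j) k} {h} ⟩
      ℕΠ.⨁ L (λ j → ℕΠ.guard (a ≟ j) k) ℕ.* ℕΠ.⨁ L h       ≡⟨ cong (ℕ._* ℕΠ.⨁ L h) (trans (ℕΠ.⨁-single u a∈ λ j _ j≢a → ℕΠ.guard-no (a ≟ j) (j≢a ∘ sym)) (ℕΠ.guard-yes (a ≟ a) refl)) ⟩
      k ℕ.* ℕΠ.⨁ L h                                       ∎
      where
      open ≡-Reasoning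
      split : ∀ j → f j ≡ ℕΠ.guard (a ≟ j) k ℕ.* h j
      split j = cases (a ≟ j)
        where
        cases : Dec (a ≡ j) → f j ≡ ℕΠ.guard (a ≟ j) k ℕ.* h j
        cases (yes refl) = trans fa (cong (ℕ._* h a) (sym (ℕΠ.guard-yes (a ≟ a) refl)))
        cases (no a≢j)   = trans (fj j (a≢j ∘ sym)) (trans (sym (ℕₚ.*-identityˡ (h j))) (cong (ℕ._* h j) (sym (ℕΠ.guard-no (a ≟ j) a≢j))))

    multiplicity-∉ : ∀ μ {j} → j ∉ parts μ → multiplicity j μ ≡ 0
    multiplicity-∉ μ {j} j∉ = cong length (filter-none (j ≟_) {xs = parts μ} (All.tabulate λ x∈ j≡x → j∉ (subst (_∈ parts μ) (sym j≡x) x∈)))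

    module _ {μ ν a} (p : a ∷ parts ν ↭ parts μ) where

      multiplicity-≡ : multiplicity a μ ≡ suc (multiplicity a ν)
      multiplicity-≡ = trans (sym (↭-length (filter-↭ (a ≟_) p))) (cong length (filter-accept (a ≟_) {xs = parts ν} refl))

      multiplicity-≢ : ∀ j → j ≢ a → multiplicity j μ ≡ multiplicity j ν
      multiplicity-≢ j j≢a = trans (sym (↭-length (filter-↭ (j ≟_) p))) (cong length (filter-reject (j ≟_) {xs = parts ν} j≢a))

      -- Used for F j m = m! and for F j m = (j - 1)ᵐ. Only the factor at `a` changes, and F j 0 = 1
      -- absorbs the possible disappearance of `a` from the support.
      ∏-remove : ∀ (F : ℕ → ℕ → ℕ) {k} → (∀ j → F j 0 ≡ 1) → (∀ m → multiplicity a μ ≡ suc m → F a (suc m) ≡ k ℕ.* F a m) →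
        product (map (λ j → F j (multiplicity j μ)) (supp μ)) ≡ k ℕ.* product (map (λ j → F j (multiplicity j ν)) (supp ν))
      ∏-remove F {k} F0 Fa = begin
        product (map fμ (supp μ))        ≡⟨ product-map fμ (supp μ) ⟩
        ℕΠ.⨁ (supp μ) fμ                 ≡⟨ ⨁-scale {k = k} (supp-unique μ) (∈-supp⁺ μ (∈-resp-↭ p (here refl)))
                                              (trans (cong (F a) multiplicity-≡) (Fa (multiplicity a ν) multiplicity-≡))
                                              (λ j j≢a → cong (F j) (multiplicity-≢ j j≢a)) ⟩
        k ℕ.* ℕΠ.⨁ (supp μ) fν           ≡⟨ cong (k ℕ.*_) (ℕΠ.⨁-support _≟_ (supp-unique μ) (supp-unique ν)
                                              (λ j _ j∉ → trans (cong (F j) (multiplicity-∉ ν (j∉ ∘ ∈-supp⁺ ν))) (F0 j))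
                                              (λ j j∈ j∉ → contradiction (∈-supp⁺ μ (∈-resp-↭ p (there (∈-supp⁻ ν j∈)))) j∉)) ⟩
        k ℕ.* ℕΠ.⨁ (supp ν) fν           ≡⟨ cong (k ℕ.*_) (product-map fν (supp ν)) ⟨
        k ℕ.* product (map fν (supp ν))  ∎
        where
        open ≡-Reasoning
        fμ fν : ℕ → ℕ
        fμ j = F j (multiplicity j μ)
        fν j = F j (multiplicity j ν)

    ∏pow : Partition → ℕ
    ∏pow μ = product (map (λ j → (j ∸ 1) ^ multiplicity j μ) (supp μ))

    ∑-multiplicity : ∀ μ → ∑ (supp μ) (λ j → + multiplicity j μ) ≡ + ℓ μ
    ∑-multiplicity μ = begin
      ∑ (supp μ) (λ j → + multiplicity j μ)
        ≡⟨ ⨁-cong (supp μ) (λ j → length-filter-⨁ (j ≟_) (parts μ)) ⟩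
      ∑ (supp μ) (λ j → ∑ (parts μ) (λ x → guard (j ≟ x) 1ℤ))
        ≡⟨ ⨁-swap (supp μ) (parts μ) {λ j x → guard (j ≟ x) 1ℤ} ⟩
      ∑ (parts μ) (λ x → ∑ (supp μ) (λ j → guard (j ≟ x) 1ℤ))
        ≡⟨ ⨁-cong∈ (parts μ) (λ x x∈ → trans (⨁-single {f = λ j → guard (j ≟ x) 1ℤ} (supp-unique μ) (∈-supp⁺ μ x∈) (λ j _ j≢x → guard-no (j ≟ x) j≢x)) (guard-yes (x ≟ x) refl)) ⟩
      ∑ (parts μ) (λ _ → 1ℤ)
        ≡⟨ ones (parts μ) ⟩
      + ℓ μ ∎
      where
      open ≡-Reasoning
      ones : ∀ (xs : List ℕ) → ∑ xs (λ _ → 1ℤ) ≡ + length xs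
      ones []       = refl
      ones (x ∷ xs) = cong (λ s → 1ℤ + s) (ones xs)

  -- Both sides satisfy the recursion of removing the first letter. To avoid the division in `ε`,
  -- `coef-exact` proves it multiplied by `∏mult! μ`, and that factor is cancelled at the end; the
  -- two statements are proved together by induction on `n`.
  coef-ε : ∀ n μ → ℓ μ ≡ n → coef (replicate n g) μ ≡ + ε μ

  private
    -- Removing `a` divides `∏mult! μ` by the multiplicity of `a` and the product of powers by a -
    -- 1. Hence the term of first letter `a` is that multiplicity times a quantity independent of
    -- `a`, and the multiplicities add up to n + 1.
    coef-exact : ∀ n μ → ℓ μ ≡ n → coef (replicate n g) μ * + ∏mult! μ ≡ + (n ! ℕ.* ∏pow μ)
    coef-exact zero (mkPartition [] _ _) _ = refl
    coef-exact (suc n) μ ℓ≡ = begin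
      coef (replicate (suc n) g) μ * + ∏mult! μ
        ≡⟨ cong (_* + ∏mult! μ) (coef-∷ g refl (replicate n g) μ (supp-unique μ) (∈-supp⁺ μ)) ⟩
      ∑ (supp μ) f * + ∏mult! μ
        ≡⟨ ⨁-* (supp μ) {+ ∏mult! μ} {f} ⟩
      ∑ (supp μ) (λ a → f a * + ∏mult! μ)
        ≡⟨ ⨁-cong∈ (supp μ) term ⟩
      ∑ (supp μ) (λ a → + multiplicity a μ * + (n ! ℕ.* ∏pow μ))
        ≡⟨ ⨁-* (supp μ) {+ (n ! ℕ.* ∏pow μ)} {λ a → + multiplicity a μ} ⟨
      ∑ (supp μ) (λ a → + multiplicity a μ) * + (n ! ℕ.* ∏pow μ)
        ≡⟨ cong (_* + (n ! ℕ.* ∏pow μ)) (trans (∑-multiplicity μ) (cong +_ ℓ≡)) ⟩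
      + suc n * + (n ! ℕ.* ∏pow μ)
        ≡⟨ ℤₚ.pos-* (suc n) (n ! ℕ.* ∏pow μ) ⟨
      + (suc n ℕ.* (n ! ℕ.* ∏pow μ))
        ≡⟨ cong +_ (ℕₚ.*-assoc (suc n) (n !) (∏pow μ)) ⟨
      + (suc n ! ℕ.* ∏pow μ) ∎
      where
      open ≡-Reasoning
      f : ℕ → ℤ
      f a = + g a * maybe′ (coef (replicate n g)) 0ℤ (μ ⊖ a)

      term : ∀ a → a ∈ supp μ → f a * + ∏mult! μ ≡ + multiplicity a μ * + (n ! ℕ.* ∏pow μ)
      term a a∈ with ν , eq , p ← ⊖-∈ μ (∈-supp⁻ μ a∈) = begin
        + g a * maybe′ (coef (replicate n g)) 0ℤ (μ ⊖ a) * + ∏mult! μ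
          ≡⟨ cong (λ ξ → + g a * maybe′ (coef (replicate n g)) 0ℤ ξ * + ∏mult! μ) eq ⟩
        + g a * coef (replicate n g) ν * + ∏mult! μ
          ≡⟨ cong (λ z → + g a * z * + ∏mult! μ) (coef-ε n ν ℓν) ⟩
        + g a * + ε ν * + ∏mult! μ
          ≡⟨ cong (_* + ∏mult! μ) (ℤₚ.pos-* (g a) (ε ν)) ⟨
        + (g a ℕ.* ε ν) * + ∏mult! μ
          ≡⟨ ℤₚ.pos-* (g a ℕ.* ε ν) (∏mult! μ) ⟨
        + (g a ℕ.* ε ν ℕ.* ∏mult! μ)
          ≡⟨ cong +_ natural ⟩
        + (k ℕ.* (n ! ℕ.* ∏pow μ))
          ≡⟨ ℤₚ.pos-* k (n ! ℕ.* ∏pow μ) ⟩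
        + k * + (n ! ℕ.* ∏pow μ) ∎
        where
        k = multiplicity a μ
        ℓν : ℓ ν ≡ n
        ℓν = ℕₚ.suc-injective (trans (↭-length p) ℓ≡)
        natural : g a ℕ.* ε ν ℕ.* ∏mult! μ ≡ k ℕ.* (n ! ℕ.* ∏pow μ)
        natural = begin
          g a ℕ.* ε ν ℕ.* ∏mult! μ
            ≡⟨ cong (g a ℕ.* ε ν ℕ.*_) (∏-remove {μ} {ν} p (λ _ m → m !) {k} (λ _ → refl) (λ m eq → cong (ℕ._* m !) (sym eq))) ⟩
          g a ℕ.* ε ν ℕ.* (k ℕ.* ∏mult! ν)
            ≡⟨ solve 4 (λ a b c d → a :* b :* (c :* d) := c :* (a :* (b :* d))) refl (g a) (ε ν) k (∏mult! ν) ⟩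
          k ℕ.* (g a ℕ.* (ε ν ℕ.* ∏mult! ν))
            ≡⟨ cong (λ z → k ℕ.* (g a ℕ.* z)) (trans (ε-exact ν) (cong (λ z → z ! ℕ.* ∏pow ν) ℓν)) ⟩
          k ℕ.* (g a ℕ.* (n ! ℕ.* ∏pow ν))
            ≡⟨ solve 4 (λ a b c d → c :* (a :* (b :* d)) := c :* (b :* (a :* d))) refl (g a) (n !) k (∏pow ν) ⟩
          k ℕ.* (n ! ℕ.* (g a ℕ.* ∏pow ν))
            ≡⟨ cong (λ z → k ℕ.* (n ! ℕ.* z)) (∏-remove {μ} {ν} p (λ j m → (j ∸ 1) ^ m) {g a} (λ _ → refl) (λ _ _ → refl)) ⟨
          k ℕ.* (n ! ℕ.* ∏pow μ) ∎
          where open +-*-Solver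

  coef-ε n μ ℓ≡ = ℤₚ.*-cancelʳ-≡ (coef (replicate n g) μ) (+ ε μ) (+ ∏mult! μ) (begin
    coef (replicate n g) μ * + ∏mult! μ  ≡⟨ coef-exact n μ ℓ≡ ⟩
    + (n ! ℕ.* ∏pow μ)                   ≡⟨ cong (λ z → + (z ! ℕ.* ∏pow μ)) ℓ≡ ⟨
    + (ℓ μ ! ℕ.* ∏pow μ)                 ≡⟨ cong +_ (ε-exact μ) ⟨
    + (ε μ ℕ.* ∏mult! μ)                 ≡⟨ ℤₚ.pos-* (ε μ) (∏mult! μ) ⟩
    + ε μ * + ∏mult! μ                   ∎)
    where
    open ≡-Reasoning
    instance
      _ : ℤ.NonZero (+ ∏mult! μ)
      _ = ∏mult!≢0 μ

-- The coefficients of the twinned paths, and words for special shapes.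

module TwinnedPaths where

  open import Defs
  open import Algebra.Bundles using (CommutativeRing)
  open import Data.Fin.Base using (Fin)
  open import Data.Integer.Base using (ℤ; +_; 0ℤ; 1ℤ; _+_; _*_; _-_)
  open import Data.Integer.Properties as ℤₚ using (+-*-commutativeRing)
  open import Data.List.Base using (List; []; _∷_; _++_; map; length; filter; replicate; upTo)
  open import Data.List.Membership.Propositional using (_∈_; find)
  open import Data.List.Membership.Propositional.Properties using (∈-upTo⁺)
  open import Data.List.Properties using (length-replicate)
  open import Data.List.Relation.Binary.Permutation.Propositional using (_↭_; prep; swap; ↭-refl; ↭-sym; ↭-trans)
  open import Data.List.Relation.Binary.Permutation.Propositional.Properties using (↭-length; ∈-resp-↭; ++-comm)
  open import Data.List.Relation.Binary.Pointwise as Pointwise using (Pointwise; []; _∷_)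
  open import Data.List.Relation.Unary.All as All using (All; []; _∷_)
  import Data.List.Relation.Unary.All.Properties as All
  open import Data.List.Relation.Unary.AllPairs using ([]; _∷_)
  open import Data.List.Relation.Unary.Any as Any using (here; there)
  open import Data.List.Relation.Unary.Unique.Propositional using (Unique)
  import Data.List.Relation.Unary.Unique.Propositional.Properties as Unique
  open import Data.Maybe.Base using (maybe′)
  open import Data.Nat.Base as ℕ using (ℕ; zero; suc; _∸_; _≤_; z≤n; s≤s)
  open import Data.Nat.Properties as ℕₚ using (_≟_; _≤?_)
  open import Data.Product.Base using (_×_; _,_; ∃-syntax)
  open import Function.Base using (_∘_)
  open import Relation.Binary.PropositionalEquality using (_≡_; _≢_; refl; sym; trans; cong; cong₂; module ≡-Reasoning)
  open import Relation.Nullary using (Dec; yes; no; ¬_; contradiction)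
  open Sums
  open SmirnovWords
  open SeriesRing
  open Colourings
  open WordCoefficients
  open Independence
  open Multinomials

  open RingSums +-*-commutativeRing

  -- The coefficients of K; ι differs from it at 1, and κ at 2.
  k₂ : ℕ → ℕ
  k₂ (suc (suc k)) = suc (suc k)
  k₂ _             = 0

  Ψ-length : ∀ l → length (Ψ l) ≡ suc l
  Ψ-length zero    = refl
  Ψ-length (suc l) = cong (λ n → suc (suc n)) (length-replicate l)

  replicate-unitless : ∀ l → Unitless (replicate l g)
  replicate-unitless l = All.replicate⁺ l refl

  Ψ-unitless : ∀ l → Unitless (Ψ l)
  Ψ-unitless zero    = refl ∷ []
  Ψ-unitless (suc l) = refl ∷ refl ∷ replicate-unitless l

  module _ (N : ℕ) where
    private
      module R = RingSums (seriesRing N)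
      module 𝕊 = CommutativeRing (seriesRing N)
      module P = Path (seriesRing N)

    represents-var : ∀ Φ → Pointwise (Represents N) (map P.⟪ P.e {N} var ⟫ Φ) Φ
    represents-var []      = []
    represents-var (φ ∷ Φ) = (λ k α p → trans (⨯-eval N (φ k) {P.e {N} var k} α) (cong (+ φ k *_) (e-var N k α p))) ∷ represents-var Φ

    represents-K : Represents N K k₂
    represents-K zero          α _ = sym (ℤₚ.*-zeroˡ (elementary 0 α))
    represents-K (suc zero)    α _ = sym (ℤₚ.*-zeroˡ (elementary 1 α))
    represents-K (suc (suc k)) α _ = refl

    represents-G : Represents N G g
    represents-G zero          α _ = sym (ℤₚ.*-zeroˡ (elementary 0 α))
    represents-G (suc zero)    α _ = sym (ℤₚ.*-zeroˡ (elementary 1 α))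
    represents-G (suc (suc k)) α _ = refl

    represents-G≥3 : Represents N G≥3 g₃
    represents-G≥3 zero                α _ = sym (ℤₚ.*-zeroˡ (elementary 0 α))
    represents-G≥3 (suc zero)          α _ = sym (ℤₚ.*-zeroˡ (elementary 1 α))
    represents-G≥3 (suc (suc zero))    α _ = sym (ℤₚ.*-zeroˡ (elementary 2 α))
    represents-G≥3 (suc (suc (suc k))) α _ = refl

    ⊛-diag : ∀ F H m → (F ⊛ H) m 𝕊.≈ R.diag m (λ i j → F i · H j)
    ⊛-diag F H m α _ = trans (⨁-upTo m {λ i j → (F i · H j) α}) (sym (diag-eval N m {λ i j → F i · H j} α))

    ^ᶻ-⟦⟧ : ∀ F k m → (F ^ᶻ k) m 𝕊.≈ R.⟦ replicate k F ⟧ m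
    ^ᶻ-⟦⟧ F zero    zero    = 𝕊.refl {1ˢ}
    ^ᶻ-⟦⟧ F zero    (suc m) = 𝕊.refl {0ˢ}
    ^ᶻ-⟦⟧ F (suc k) m       = 𝕊.trans {(F ⊛ F ^ᶻ k) m} {R.diag m (λ i j → F i · (F ^ᶻ k) j)} {R.⟦ replicate (suc k) F ⟧ m} (⊛-diag F (F ^ᶻ k) m)
      (R.diag-cong m {λ i j → F i · (F ^ᶻ k) j} {λ i j → F i · R.⟦ replicate k F ⟧ j} λ i j _ → 𝕊.*-congˡ {F i} {(F ^ᶻ k) j} {R.⟦ replicate k F ⟧ j} (^ᶻ-⟦⟧ F k j))

    -- `⊛` associates to the left, whereas the product of a list nests to the right; the proof is
    -- the reassociation.
    ⊛-⟦⟧ : ∀ F H Z k m → (F ⊛ H ⊛ Z ^ᶻ k) m 𝕊.≈ R.⟦ F ∷ H ∷ replicate k Z ⟧ m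
    ⊛-⟦⟧ F H Z k m = begin
      (F ⊛ H ⊛ Z ^ᶻ k) m
        ≈⟨ ⊛-diag (F ⊛ H) (Z ^ᶻ k) m ⟩
      R.diag m (λ n l → (F ⊛ H) n · (Z ^ᶻ k) l)
        ≈⟨ R.diag-cong m {λ n l → (F ⊛ H) n · (Z ^ᶻ k) l} {λ n l → R.diag n (λ i j → F i · H j) · Zs l}
             (λ n l _ → 𝕊.*-cong {(F ⊛ H) n} {R.diag n (λ i j → F i · H j)} {(Z ^ᶻ k) l} {Zs l} (⊛-diag F H n) (^ᶻ-⟦⟧ Z k l)) ⟩
      R.diag m (λ n l → R.diag n (λ i j → F i · H j) · Zs l)
        ≈⟨ R.diag-cong m {λ n l → R.diag n (λ i j → F i · H j) · Zs l} {λ n l → R.diag n (λ i j → F i · (H j · Zs l))}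
             (λ n l _ → 𝕊.trans {R.diag n (λ i j → F i · H j) · Zs l} {R.diag n (λ i j → (F i · H j) · Zs l)} {R.diag n (λ i j → F i · (H j · Zs l))}
               (R.diag-* n {Zs l} {λ i j → F i · H j})
               (R.diag-cong n {λ i j → (F i · H j) · Zs l} {λ i j → F i · (H j · Zs l)} λ i j _ → 𝕊.*-assoc (F i) (H j) (Zs l))) ⟩
      R.diag m (λ n l → R.diag n (λ i j → F i · (H j · Zs l)))
        ≈⟨ R.diag-assoc m {λ i j l → F i · (H j · Zs l)} ⟩
      R.diag m (λ i n → R.diag n (λ j l → F i · (H j · Zs l)))
        ≈⟨ R.diag-cong m {λ i n → F i · R.diag n (λ j l → H j · Zs l)} {λ i n → R.diag n (λ j l → F i · (H j · Zs l))}
             (λ i n _ → R.*-diag n {F i} {λ j l → H j · Zs l}) ⟨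
      R.⟦ F ∷ H ∷ replicate k Z ⟧ m ∎
      where
      open import Relation.Binary.Reasoning.Setoid 𝕊.setoid
      Zs = R.⟦ replicate k Z ⟧

  ⊛-expansion : ∀ F φ → (∀ N → Represents N F φ) → ∀ k → EExpansion (F ⊛ G≥3 ⊛ G ^ᶻ k) (coef (φ ∷ g₃ ∷ replicate k g))
  ⊛-expansion F φ r k m α = trans (⊛-⟦⟧ N F G≥3 G k m α refl) (trans
    (⟦⟧-words N (r N ∷ represents-G≥3 N ∷ Pointwise.replicate⁺ (represents-G N) k) m α refl)
    (coef-expansion (φ ∷ g₃ ∷ replicate k g) m α))
    where N = length α

  -- `Ψ l` has l + 1 factors without constant term, so only l = ℓ(μ) - 1 can contribute. For the
  -- empty partition the truncated subtraction selects `Ψ 0`, whose coefficient is 0 because `κ 0`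
  -- is.
  cᵗ : Partition → ℤ
  cᵗ μ = + 2 * coef (Ψ (ℓ μ ∸ 1)) μ

  cᵗ-ℓ : ∀ {l} μ → ℓ μ ≡ suc l → cᵗ μ ≡ + 2 * coef (Ψ l) μ
  cᵗ-ℓ μ eq = cong (λ n → + 2 * coef (Ψ (n ∸ 1)) μ) eq

  module _ (v : ∀ m → Fin (suc m)) (end : ∀ m → IsEnd (v m)) where

    private
      𝒳-words : ∀ m α → 𝒳 v m α ≡ + 2 * ∑ (upTo m) (λ l → ∑ (words (length (Ψ l)) m) (λ w → + wt (Ψ l) w * eʷ w α))
      𝒳-words zero          α = refl
      -- In degree 1 only l = 0 occurs, with the single word 1, and `κ 1` is zero.
      𝒳-words (suc zero)    α = sym (cong (λ s → + 2 * (s + 0ℤ)) (⨁-ε (words 1 1) {λ w → + wt (Ψ 0) w * eʷ w α} λ where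
        w (here refl) → ℤₚ.*-zeroˡ (eʷ w α)))
      𝒳-words (suc (suc m)) α = begin
        X (twin (path (suc m)) (v m)) α
          ≡⟨ X-eval (twin (path (suc m)) (v m)) α ⟩
        C.Xᴿ (twin (path (suc m)) (v m)) α
          ≡⟨ C.Xᴿ-twin-end m (v m) (end m) α refl ⟩
        P.T {N} var m α
          ≡⟨ P.twin-expansion {N} var m α refl ⟩
        (2 ⨯ S) α
          ≡⟨ ⨯-eval N 2 {S} α ⟩
        + 2 * S α
          ≡⟨ cong (+ 2 *_) (⨁-eval N (upTo M) {λ l → R.⟦ map P.⟪ P.e {N} var ⟫ (Ψ l) ⟧ M} α) ⟩
        + 2 * ∑ (upTo M) (λ l → R.⟦ map P.⟪ P.e {N} var ⟫ (Ψ l) ⟧ M α)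
          ≡⟨ cong (+ 2 *_) (⨁-cong (upTo M) λ l → ⟦⟧-words N (represents-var N (Ψ l)) M α refl) ⟩
        + 2 * ∑ (upTo M) (λ l → ∑ (words (length (Ψ l)) M) (λ w → + wt (Ψ l) w * eʷ w α)) ∎
        where
        open ≡-Reasoning
        N = length α
        M = suc (suc m)
        module P = Path (seriesRing N)
        module R = RingSums (seriesRing N)
        module C = Colour (seriesRing N) {N} var
        open import Algebra.Properties.Semiring.Mult (CommutativeRing.semiring (seriesRing N)) renaming (_×_ to _⨯_)
        S = R.⨁ (upTo M) (λ l → R.⟦ map P.⟪ P.e {N} var ⟫ (Ψ l) ⟧ M)

      -- The one relevant index ℓ(μ) - 1 lies in the range because a nonempty partition has at most
      -- as many parts as its size.
      ∑-Ψ : ∀ μ → ∑ (upTo (size μ)) (λ l → coef (Ψ l) μ) ≡ coef (Ψ (ℓ μ ∸ 1)) μ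
      ∑-Ψ μ@(mkPartition [] _ _) = refl
      ∑-Ψ μ@(mkPartition (a ∷ xs) _ _) = ⨁-single (Unique.upTo⁺ (size μ)) (∈-upTo⁺ (length≤sum (parts-positive μ)))
        λ l _ l≢ → coef-length (Ψ-unitless l) μ λ eq → l≢ (ℕₚ.suc-injective (trans (sym (Ψ-length l)) eq))

    𝒳-expansion : EExpansion (𝒳 v) cᵗ
    𝒳-expansion m α = begin
      𝒳 v m α
        ≡⟨ 𝒳-words m α ⟩
      + 2 * ∑ (upTo m) (λ l → ∑ (words (length (Ψ l)) m) (λ w → + wt (Ψ l) w * eʷ w α))
        ≡⟨ cong (+ 2 *_) (⨁-cong (upTo m) λ l → coef-expansion (Ψ l) m α) ⟩
      + 2 * ∑ (upTo m) (λ l → ∑ ps (λ μ → coef (Ψ l) μ * e μ α))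
        ≡⟨ cong (+ 2 *_) (⨁-swap (upTo m) ps {λ l μ → coef (Ψ l) μ * e μ α}) ⟩
      + 2 * ∑ ps (λ μ → ∑ (upTo m) (λ l → coef (Ψ l) μ * e μ α))
        ≡⟨ *-⨁ ps {+ 2} {λ μ → ∑ (upTo m) (λ l → coef (Ψ l) μ * e μ α)} ⟩
      ∑ ps (λ μ → + 2 * ∑ (upTo m) (λ l → coef (Ψ l) μ * e μ α))
        ≡⟨ ⨁-cong∈ ps (λ μ μ∈ → begin
             + 2 * ∑ (upTo m) (λ l → coef (Ψ l) μ * e μ α)
               ≡⟨ cong (+ 2 *_) (⨁-* (upTo m) {e μ α} {λ l → coef (Ψ l) μ}) ⟨
             + 2 * (∑ (upTo m) (λ l → coef (Ψ l) μ) * e μ α)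
               ≡⟨ ℤₚ.*-assoc (+ 2) (∑ (upTo m) (λ l → coef (Ψ l) μ)) (e μ α) ⟨
             + 2 * ∑ (upTo m) (λ l → coef (Ψ l) μ) * e μ α
               ≡⟨ cong (λ s → + 2 * s * e μ α) (trans (cong (λ n → ∑ (upTo n) (λ l → coef (Ψ l) μ)) (sym (partitionsOf-sound m μ∈))) (∑-Ψ μ)) ⟩
             cᵗ μ * e μ α ∎) ⟩
      ∑ ps (λ μ → cᵗ μ * e μ α) ∎
      where
      open ≡-Reasoning
      ps = partitionsOf m

  coef-cong : ∀ {φ ψ} → φ 0 ≡ 0 → ψ 0 ≡ 0 → ∀ Φ μ → (∀ {a} → a ∈ parts μ → φ a ≡ ψ a) → coef (φ ∷ Φ) μ ≡ coef (ψ ∷ Φ) μ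
  coef-cong {φ} {ψ} φ0 ψ0 Φ μ eq = begin
    coef (φ ∷ Φ) μ
      ≡⟨ coef-∷ φ φ0 Φ μ (supp-unique μ) (∈-supp⁺ μ) ⟩
    ∑ (supp μ) (λ a → + φ a * maybe′ (coef Φ) 0ℤ (μ ⊖ a))
      ≡⟨ ⨁-cong∈ (supp μ) (λ a a∈ → cong (λ k → + k * maybe′ (coef Φ) 0ℤ (μ ⊖ a)) (eq (∈-supp⁻ μ a∈))) ⟩
    ∑ (supp μ) (λ a → + ψ a * maybe′ (coef Φ) 0ℤ (μ ⊖ a))
      ≡⟨ coef-∷ ψ ψ0 Φ μ (supp-unique μ) (∈-supp⁺ μ) ⟨
    coef (ψ ∷ Φ) μ ∎
    where open ≡-Reasoning

  ∪-↭ : ∀ μ → parts (partition (1 ∷ []) ∪ μ) ↭ 1 ∷ parts μ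
  ∪-↭ μ = partition⁺-↭ (s≤s z≤n ∷ parts-positive μ)

  -- `g₃` and `g` both vanish at 1, so a part 1 has to be the letter of the factor `ι`, where its
  -- weight is 1. What remains is a word for `μ`.
  cᵗ-∪ : ∀ {l} μ → ℓ μ ≡ suc l → cᵗ (partition (1 ∷ []) ∪ μ) ≡ + 2 * coef (g₃ ∷ replicate l g) μ
  cᵗ-∪ {l} μ ℓ≡ = begin
    cᵗ λ′
      ≡⟨ cᵗ-ℓ λ′ (trans (↭-length (∪-↭ μ)) (cong suc ℓ≡)) ⟩
    + 2 * coef (ι ∷ Φ) λ′
      ≡⟨ cong (+ 2 *_) (coef-∷ ι refl Φ λ′ (supp-unique λ′) (∈-supp⁺ λ′)) ⟩
    + 2 * ∑ (supp λ′) (λ a → + a * maybe′ (coef Φ) 0ℤ (λ′ ⊖ a))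
      ≡⟨ cong (+ 2 *_) (⨁-single {f = λ a → + a * maybe′ (coef Φ) 0ℤ (λ′ ⊖ a)} (supp-unique λ′) (∈-supp⁺ λ′ (∈-resp-↭ (↭-sym (∪-↭ μ)) (here refl))) vanish) ⟩
    + 2 * (+ 1 * maybe′ (coef Φ) 0ℤ (λ′ ⊖ 1))
      ≡⟨ cong (λ ν → + 2 * (+ 1 * maybe′ (coef Φ) 0ℤ ν)) (⊖-just λ′ {μ} (↭-sym (∪-↭ μ))) ⟩
    + 2 * (+ 1 * coef Φ μ)
      ≡⟨ cong (+ 2 *_) (ℤₚ.*-identityˡ (coef Φ μ)) ⟩
    + 2 * coef Φ μ ∎
    where
    open ≡-Reasoning
    λ′ = partition (1 ∷ []) ∪ μ
    Φ = g₃ ∷ replicate l g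

    vanish : ∀ a → a ∈ supp λ′ → a ≢ 1 → + a * maybe′ (coef Φ) 0ℤ (λ′ ⊖ a) ≡ 0ℤ
    vanish a a∈ a≢1 with ν , eq , p ← ⊖-∈ λ′ (∈-supp⁻ λ′ a∈) rewrite eq =
      trans (cong (+ a *_) (coef-∈ (refl ∷ replicate-unitless l) (refl ∷ All.replicate⁺ l refl) ν (one∈ (∈-resp-↭ (↭-trans (↭-sym (∪-↭ μ)) (↭-sym p)) (here refl))))) (ℤₚ.*-zeroʳ (+ a))
      where
      one∈ : 1 ∈ a ∷ parts ν → 1 ∈ parts ν
      one∈ (here 1≡a)  = contradiction (sym 1≡a) a≢1
      one∈ (there 1∈)  = 1∈

  g₃-small : ∀ {a} → ¬ 3 ≤ a → g₃ a ≡ 0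
  g₃-small {zero}              _  = refl
  g₃-small {suc zero}          _  = refl
  g₃-small {suc (suc zero)}    _  = refl
  g₃-small {suc (suc (suc a))} ≰ = contradiction (s≤s (s≤s (s≤s z≤n))) ≰

  coef-g₃-large : ∀ Φ μ → coef (g₃ ∷ Φ) μ ≢ 0ℤ → ∃[ a ] (3 ≤ a × a ∈ parts μ)
  coef-g₃-large Φ μ ≢0 with Any.any? (3 ≤?_) (parts μ)
  ... | yes large with a , a∈ , 3≤a ← find large = a , 3≤a , a∈
  ... | no ¬large = contradiction (coef-∷-zero g₃ refl Φ μ λ a ν p →
    trans (cong (λ k → + k * coef Φ ν) (g₃-small λ 3≤a → ¬large (Any.map (λ where refl → 3≤a) (∈-resp-↭ p (here refl))))) (ℤₚ.*-zeroˡ (coef Φ ν))) ≢0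

  -- The first two letters are a and b, and the remaining equal factors `g` are evaluated by
  -- `coef-ε`. An impossible removal gives 0 on both sides.
  coef-pairs : ∀ {φ ψ} → φ 0 ≡ 0 → ψ 0 ≡ 0 → ∀ {l} μ → ℓ μ ≡ suc (suc l) →
    coef (φ ∷ ψ ∷ replicate l g) μ ≡ ∑ (supp μ) (λ a → ∑ (supp μ) (λ b → + (φ a ℕ.* ψ b ℕ.* ε[ μ - a - b ])))
  coef-pairs {φ} {ψ} φ0 ψ0 {l} μ ℓ≡ = trans (coef-∷ φ φ0 (ψ ∷ replicate l g) μ (supp-unique μ) (∈-supp⁺ μ)) (⨁-cong∈ (supp μ) outer)
    where
    open ≡-Reasoning
    inner : ∀ a ν → ℓ ν ≡ suc l → ∀ b →
      + φ a * (+ ψ b * maybe′ (coef (replicate l g)) 0ℤ (ν ⊖ b)) ≡ + (φ a ℕ.* ψ b ℕ.* maybe′ ε 0 (ν ⊖ b))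
    inner a ν ℓν b = begin
      + φ a * (+ ψ b * maybe′ (coef (replicate l g)) 0ℤ (ν ⊖ b))
        ≡⟨ cong (λ z → + φ a * (+ ψ b * z)) (coef-maybe b) ⟩
      + φ a * (+ ψ b * + maybe′ ε 0 (ν ⊖ b))
        ≡⟨ ℤₚ.*-assoc (+ φ a) (+ ψ b) (+ maybe′ ε 0 (ν ⊖ b)) ⟨
      + φ a * + ψ b * + maybe′ ε 0 (ν ⊖ b)
        ≡⟨ cong (_* + maybe′ ε 0 (ν ⊖ b)) (ℤₚ.pos-* (φ a) (ψ b)) ⟨
      + (φ a ℕ.* ψ b) * + maybe′ ε 0 (ν ⊖ b)
        ≡⟨ ℤₚ.pos-* (φ a ℕ.* ψ b) (maybe′ ε 0 (ν ⊖ b)) ⟨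
      + (φ a ℕ.* ψ b ℕ.* maybe′ ε 0 (ν ⊖ b)) ∎
      where
      open import Data.List.Membership.DecPropositional _≟_ using (_∈?_)
      coef-maybe : ∀ b → maybe′ (coef (replicate l g)) 0ℤ (ν ⊖ b) ≡ + maybe′ ε 0 (ν ⊖ b)
      coef-maybe b = cases (b ∈? parts ν)
        where
        cases : Dec (b ∈ parts ν) → maybe′ (coef (replicate l g)) 0ℤ (ν ⊖ b) ≡ + maybe′ ε 0 (ν ⊖ b)
        cases (yes b∈) with ξ , eq , p ← ⊖-∈ ν b∈ rewrite eq = coef-ε l ξ (ℕₚ.suc-injective (trans (↭-length p) ℓν))
        cases (no b∉) rewrite ⊖-∉ ν b∉ = refl

    outer : ∀ a → a ∈ supp μ →
      + φ a * maybe′ (coef (ψ ∷ replicate l g)) 0ℤ (μ ⊖ a) ≡ ∑ (supp μ) (λ b → + (φ a ℕ.* ψ b ℕ.* ε[ μ - a - b ]))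
    outer a a∈ with ν , eq , p ← ⊖-∈ μ (∈-supp⁻ μ a∈) rewrite eq = begin
      + φ a * coef (ψ ∷ replicate l g) ν
        -- The second letter still ranges over `supp μ` instead of `supp ν`; the values that are no
        -- longer parts contribute zero.
        ≡⟨ cong (+ φ a *_) (coef-∷ ψ ψ0 (replicate l g) ν (supp-unique μ) (∈-supp⁺ μ ∘ ∈-resp-↭ p ∘ there)) ⟩
      + φ a * ∑ (supp μ) (λ b → + ψ b * maybe′ (coef (replicate l g)) 0ℤ (ν ⊖ b))
        ≡⟨ *-⨁ (supp μ) {+ φ a} {λ b → + ψ b * maybe′ (coef (replicate l g)) 0ℤ (ν ⊖ b)} ⟩
      ∑ (supp μ) (λ b → + φ a * (+ ψ b * maybe′ (coef (replicate l g)) 0ℤ (ν ⊖ b)))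
        ≡⟨ ⨁-cong (supp μ) (inner a ν (ℕₚ.suc-injective (trans (↭-length p) ℓ≡))) ⟩
      ∑ (supp μ) (λ b → + (φ a ℕ.* ψ b ℕ.* maybe′ ε 0 (ν ⊖ b))) ∎

  -- The ranges a ≥ 2 and b ≥ 3 discard only vanishing terms. Smallness of `φ` is asked on `supp μ`
  -- alone, because `ι` does not vanish at 1 and relies on 1 not being a part.
  filtered-pairs : ∀ (φ : ℕ → ℕ) μ → (∀ {a} → a ∈ supp μ → ¬ 2 ≤ a → φ a ≡ 0) →
    ∑ (supp μ) (λ a → ∑ (supp μ) (λ b → + (φ a ℕ.* g₃ b ℕ.* ε[ μ - a - b ]))) ≡
    ∑ (filter (2 ≤?_) (supp μ)) (λ a → ∑ (filter (3 ≤?_) (supp μ)) (λ b → + (φ a ℕ.* (b ∸ 1) ℕ.* ε[ μ - a - b ])))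
  filtered-pairs φ μ small = trans (⨁-cong∈ (supp μ) outer)
    (sym (⨁-filter (2 ≤?_) (supp μ) {λ a → ∑ (filter (3 ≤?_) (supp μ)) (λ b → + (φ a ℕ.* (b ∸ 1) ℕ.* ε[ μ - a - b ]))}))
    where
    inner : ∀ a b → + (φ a ℕ.* g₃ b ℕ.* ε[ μ - a - b ]) ≡ guard (3 ≤? b) (+ (φ a ℕ.* (b ∸ 1) ℕ.* ε[ μ - a - b ]))
    inner a b = cases b (3 ≤? b)
      where
      cases : ∀ b → Dec (3 ≤ b) → + (φ a ℕ.* g₃ b ℕ.* ε[ μ - a - b ]) ≡ guard (3 ≤? b) (+ (φ a ℕ.* (b ∸ 1) ℕ.* ε[ μ - a - b ]))
      cases b@(suc (suc (suc _))) (yes 3≤b) = sym (guard-yes (3 ≤? b) 3≤b)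
      cases (suc (suc zero))      (yes (s≤s (s≤s ())))
      cases (suc zero)            (yes (s≤s ()))
      cases b                     (no 3≰b) = trans
        (cong (λ k → + (k ℕ.* ε[ μ - a - b ])) (trans (cong (φ a ℕ.*_) (g₃-small 3≰b)) (ℕₚ.*-zeroʳ (φ a))))
        (sym (guard-no (3 ≤? b) 3≰b))

    outer : ∀ a → a ∈ supp μ → ∑ (supp μ) (λ b → + (φ a ℕ.* g₃ b ℕ.* ε[ μ - a - b ])) ≡
      guard (2 ≤? a) (∑ (filter (3 ≤?_) (supp μ)) (λ b → + (φ a ℕ.* (b ∸ 1) ℕ.* ε[ μ - a - b ])))
    outer a a∈ = cases (2 ≤? a)
      where
      cases : Dec (2 ≤ a) → ∑ (supp μ) (λ b → + (φ a ℕ.* g₃ b ℕ.* ε[ μ - a - b ])) ≡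
        guard (2 ≤? a) (∑ (filter (3 ≤?_) (supp μ)) (λ b → + (φ a ℕ.* (b ∸ 1) ℕ.* ε[ μ - a - b ])))
      cases (yes 2≤a) = trans
        (trans (⨁-cong (supp μ) (inner a)) (sym (⨁-filter (3 ≤?_) (supp μ) {λ b → + (φ a ℕ.* (b ∸ 1) ℕ.* ε[ μ - a - b ])})))
        (sym (guard-yes (2 ≤? a) 2≤a))
      cases (no 2≰a) = trans
        (⨁-ε (supp μ) λ b _ → cong (λ k → + (k ℕ.* g₃ b ℕ.* ε[ μ - a - b ])) (small a∈ 2≰a))
        (sym (guard-no (2 ≤? a) 2≰a))

  coef-one : ∀ {φ} → φ 0 ≡ 0 → ∀ k → coef (φ ∷ []) (partition (suc k ∷ [])) ≡ + φ (suc k)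
  coef-one {φ} φ0 k = begin
    coef (φ ∷ []) μ
      ≡⟨ coef-∷ φ φ0 [] μ {suc k ∷ []} ([] ∷ []) (∈-resp-↭ (partition⁺-↭ pos)) ⟩
    + φ (suc k) * maybe′ (coef []) 0ℤ (μ ⊖ suc k) + 0ℤ
      ≡⟨ cong (λ ν → + φ (suc k) * maybe′ (coef []) 0ℤ ν + 0ℤ) (⊖-just μ {partition []} (↭-sym (partition⁺-↭ pos))) ⟩
    + φ (suc k) * 1ℤ + 0ℤ
      ≡⟨ trans (ℤₚ.+-identityʳ _) (ℤₚ.*-identityʳ (+ φ (suc k))) ⟩
    + φ (suc k) ∎
    where
    open ≡-Reasoning
    μ = partition (suc k ∷ [])
    pos : All (1 ≤_) (suc k ∷ [])
    pos = s≤s z≤n ∷ []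

  module _ {φ ψ : ℕ → ℕ} (φ0 : φ 0 ≡ 0) (ψ0 : ψ 0 ≡ 0) where

    private
      ⊖-one : ∀ {i j xs} → All (1 ≤_) xs → suc i ∷ suc j ∷ [] ↭ xs → maybe′ (coef (ψ ∷ [])) 0ℤ (partition xs ⊖ suc i) ≡ + ψ (suc j)
      ⊖-one {i} {j} {xs} pos p = trans (cong (maybe′ (coef (ψ ∷ [])) 0ℤ)
        (⊖-just (partition xs) {partition (suc j ∷ [])} (↭-trans (prep (suc i) (partition⁺-↭ (s≤s z≤n ∷ []))) (↭-trans p (↭-sym (partition⁺-↭ pos))))))
        (coef-one ψ0 j)

    coef-two : ∀ i j → i ≢ j → coef (φ ∷ ψ ∷ []) (partition (suc i ∷ suc j ∷ [])) ≡ + (φ (suc i) ℕ.* ψ (suc j) ℕ.+ φ (suc j) ℕ.* ψ (suc i))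
    coef-two i j i≢j = begin
      coef (φ ∷ ψ ∷ []) μ
        ≡⟨ coef-∷ φ φ0 (ψ ∷ []) μ {suc i ∷ suc j ∷ []} (((λ eq → i≢j (ℕₚ.suc-injective eq)) ∷ []) ∷ [] ∷ []) (∈-resp-↭ (partition⁺-↭ pos)) ⟩
      + φ (suc i) * maybe′ (coef (ψ ∷ [])) 0ℤ (μ ⊖ suc i) + (+ φ (suc j) * maybe′ (coef (ψ ∷ [])) 0ℤ (μ ⊖ suc j) + 0ℤ)
        ≡⟨ cong₂ (λ x y → + φ (suc i) * x + (+ φ (suc j) * y + 0ℤ)) (⊖-one pos ↭-refl) (⊖-one pos (swap (suc j) (suc i) ↭-refl)) ⟩
      + φ (suc i) * + ψ (suc j) + (+ φ (suc j) * + ψ (suc i) + 0ℤ)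
        ≡⟨ cong (λ x → + φ (suc i) * + ψ (suc j) + x) (ℤₚ.+-identityʳ (+ φ (suc j) * + ψ (suc i))) ⟩
      + φ (suc i) * + ψ (suc j) + + φ (suc j) * + ψ (suc i)
        ≡⟨ cong₂ _+_ (ℤₚ.pos-* (φ (suc i)) (ψ (suc j))) (ℤₚ.pos-* (φ (suc j)) (ψ (suc i))) ⟨
      + (φ (suc i) ℕ.* ψ (suc j) ℕ.+ φ (suc j) ℕ.* ψ (suc i)) ∎
      where
      open ≡-Reasoning
      μ = partition (suc i ∷ suc j ∷ [])
      pos : All (1 ≤_) (suc i ∷ suc j ∷ [])
      pos = s≤s z≤n ∷ s≤s z≤n ∷ []

    coef-twice : ∀ i → coef (φ ∷ ψ ∷ []) (partition (suc i ∷ suc i ∷ [])) ≡ + (φ (suc i) ℕ.* ψ (suc i))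
    coef-twice i = begin
      coef (φ ∷ ψ ∷ []) μ
        ≡⟨ coef-∷ φ φ0 (ψ ∷ []) μ {suc i ∷ []} ([] ∷ []) (once ∘ ∈-resp-↭ (partition⁺-↭ pos)) ⟩
      + φ (suc i) * maybe′ (coef (ψ ∷ [])) 0ℤ (μ ⊖ suc i) + 0ℤ
        ≡⟨ cong (λ x → + φ (suc i) * x + 0ℤ) (⊖-one pos ↭-refl) ⟩
      + φ (suc i) * + ψ (suc i) + 0ℤ
        ≡⟨ ℤₚ.+-identityʳ (+ φ (suc i) * + ψ (suc i)) ⟩
      + φ (suc i) * + ψ (suc i)
        ≡⟨ ℤₚ.pos-* (φ (suc i)) (ψ (suc i)) ⟨
      + (φ (suc i) ℕ.* ψ (suc i)) ∎
      where
      open ≡-Reasoning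
      μ = partition (suc i ∷ suc i ∷ [])
      pos : All (1 ≤_) (suc i ∷ suc i ∷ [])
      pos = s≤s z≤n ∷ s≤s z≤n ∷ []
      once : ∀ {a} → a ∈ suc i ∷ suc i ∷ [] → a ∈ suc i ∷ []
      once (here eq)         = here eq
      once (there (here eq)) = here eq

  twos : ∀ k → All (1 ≤_) (replicate k 2)
  twos k = All.replicate⁺ k (s≤s z≤n)

  ∈-twos : ∀ k {a} → a ∈ replicate k 2 → a ≡ 2
  ∈-twos (suc k) (here eq)  = eq
  ∈-twos (suc k) (there a∈) = ∈-twos k a∈

  -- There is one word, all of whose letters have weight `g 2`, which is 1.
  coef-2ᵏ : ∀ k → coef (replicate k g) (partition (replicate k 2)) ≡ 1ℤ
  coef-2ᵏ zero    = refl
  coef-2ᵏ (suc k) = begin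
    coef (replicate (suc k) g) μ
      ≡⟨ coef-∷ g refl (replicate k g) μ {2 ∷ []} ([] ∷ []) (here ∘ ∈-twos (suc k) ∘ ∈-resp-↭ (partition⁺-↭ (twos (suc k)))) ⟩
    + 1 * maybe′ (coef (replicate k g)) 0ℤ (μ ⊖ 2) + 0ℤ
      ≡⟨ cong (λ ν → + 1 * maybe′ (coef (replicate k g)) 0ℤ ν + 0ℤ)
           (⊖-just μ {partition (replicate k 2)} (↭-trans (prep 2 (partition⁺-↭ (twos k))) (↭-sym (partition⁺-↭ (twos (suc k)))))) ⟩
    + 1 * coef (replicate k g) (partition (replicate k 2)) + 0ℤ
      ≡⟨ cong (λ x → + 1 * x + 0ℤ) (coef-2ᵏ k) ⟩
    1ℤ ∎
    where
    open ≡-Reasoning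
    μ = partition (replicate (suc k) 2)

  coef-g₃-2ᵏ : ∀ Φ k → coef (g₃ ∷ Φ) (partition (replicate k 2)) ≡ 0ℤ
  coef-g₃-2ᵏ Φ k = coef-∷-zero g₃ refl Φ (partition (replicate k 2)) λ a ν p →
    trans (cong (λ b → + g₃ b * coef Φ ν) (∈-twos k (∈-resp-↭ (↭-trans p (partition⁺-↭ (twos k))) (here refl)))) (ℤₚ.*-zeroˡ (coef Φ ν))

  module _ (φ : ℕ → ℕ) (φ0 : φ 0 ≡ 0) (Φ : List (ℕ → ℕ)) where

    coef-3,2ᵏ : ∀ k → coef (φ ∷ Φ) (partition (3 ∷ replicate (suc k) 2)) ≡
      + φ 3 * coef Φ (partition (replicate (suc k) 2)) + + φ 2 * coef Φ (partition (3 ∷ replicate k 2))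
    coef-3,2ᵏ k = begin
      coef (φ ∷ Φ) μ
        ≡⟨ coef-∷ φ φ0 Φ μ {3 ∷ 2 ∷ []} (((λ ()) ∷ []) ∷ [] ∷ []) (part ∘ ∈-resp-↭ (partition⁺-↭ pos)) ⟩
      + φ 3 * maybe′ (coef Φ) 0ℤ (μ ⊖ 3) + (+ φ 2 * maybe′ (coef Φ) 0ℤ (μ ⊖ 2) + 0ℤ)
        ≡⟨ cong₂ (λ ν ξ → + φ 3 * maybe′ (coef Φ) 0ℤ ν + (+ φ 2 * maybe′ (coef Φ) 0ℤ ξ + 0ℤ))
             (⊖-just μ {partition (replicate (suc k) 2)} (↭-trans (prep 3 (partition⁺-↭ (twos (suc k)))) (↭-sym (partition⁺-↭ pos))))
             (⊖-just μ {partition (3 ∷ replicate k 2)} (↭-trans (prep 2 (partition⁺-↭ (s≤s z≤n ∷ twos k))) (↭-trans (swap 2 3 ↭-refl) (↭-sym (partition⁺-↭ pos))))) ⟩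
      + φ 3 * coef Φ (partition (replicate (suc k) 2)) + (+ φ 2 * coef Φ (partition (3 ∷ replicate k 2)) + 0ℤ)
        ≡⟨ cong (λ x → + φ 3 * coef Φ (partition (replicate (suc k) 2)) + x) (ℤₚ.+-identityʳ _) ⟩
      + φ 3 * coef Φ (partition (replicate (suc k) 2)) + + φ 2 * coef Φ (partition (3 ∷ replicate k 2)) ∎
      where
      open ≡-Reasoning
      μ = partition (3 ∷ replicate (suc k) 2)
      pos : All (1 ≤_) (3 ∷ replicate (suc k) 2)
      pos = s≤s z≤n ∷ twos (suc k)
      part : ∀ {a} → a ∈ 3 ∷ replicate (suc k) 2 → a ∈ 3 ∷ 2 ∷ []
      part (here eq)  = here eq
      part (there a∈) = there (here (∈-twos (suc k) a∈))

  -- As `g₃ 2` is 0, the first letter must be 3, of weight 2; the remaining letters 2 have weight 1.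
  coef-g₃-3,2ᵏ : ∀ k → coef (g₃ ∷ replicate (suc k) g) (partition (3 ∷ replicate (suc k) 2)) ≡ + 2
  coef-g₃-3,2ᵏ k = trans (coef-3,2ᵏ g₃ refl (replicate (suc k) g) k)
    (cong₂ (λ x y → + 2 * x + y) (coef-2ᵏ (suc k)) (ℤₚ.*-zeroˡ (coef (replicate (suc k) g) (partition (3 ∷ replicate k 2)))))

  ℓ-partition : ∀ {xs} → All (1 ≤_) xs → ℓ (partition xs) ≡ length xs
  ℓ-partition pos = ↭-length (partition⁺-↭ pos)

  partition-∪ : ∀ {xs} → All (1 ≤_) xs → partition (xs ++ 1 ∷ []) ≡ partition (1 ∷ []) ∪ partition xs
  partition-∪ {xs} pos = ≡-↭ (↭-trans (partition⁺-↭ (All.++⁺ pos (s≤s z≤n ∷ [])))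
    (↭-trans (++-comm xs (1 ∷ [])) (↭-trans (prep 1 (↭-sym (partition⁺-↭ pos))) (↭-sym (∪-↭ (partition xs))))))

-- Evaluation of the coefficients for the individual shapes.

open import Defs
open import Data.Fin.Base using (Fin)
open import Data.Integer.Base using (ℤ; +_; 0ℤ; _+_; _*_; _-_)
import Data.Integer.Properties as ℤₚ
import Data.Integer.Tactic.RingSolver as ℤSolver
open import Data.List.Base using ([]; _∷_; _++_; filter; replicate)
open import Data.List.Membership.Propositional using (_∈_; _∉_)
open import Data.List.Properties using (length-replicate)
open import Data.List.Relation.Unary.All using (All; []; _∷_)
import Data.List.Relation.Unary.All.Properties as All
open import Data.Nat.Base as ℕ using (ℕ; zero; suc; _∸_; _≤_; _<_; z≤n; s≤s)
import Data.Nat.Properties as ℕₚ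
open import Data.Nat.Properties using (_≤?_)
open import Data.Nat.Solver using (module +-*-Solver)
open import Data.Product.Base using (_×_; _,_; ∃-syntax)
open import Function.Base using (_∘_)
open import Relation.Binary.PropositionalEquality using (_≡_; _≢_; refl; sym; trans; cong; cong₂; subst; module ≡-Reasoning)
open import Relation.Nullary using (¬_; contradiction)
open SmirnovWords
open WordCoefficients
open Independence
open TwinnedPaths

corollary3p10 : (v : ∀ m → Fin (suc m)) → (∀ m → IsEnd (v m)) →
    ∃[ c ] (𝒳 v HasECoefficients c
    × (∀ k → 3 ≤ k → c (partition (k ∷ [])) ≡ + (2 ℕ.* k))
    × c (partition (2 ∷ [])) ≡ + 2
    × (∀ k → 4 ≤ k → c (partition ((k ∸ 1) ∷ 1 ∷ [])) ≡ + (2 ℕ.* (k ∸ 2)))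
    × (∀ k → 5 ≤ k → c (partition ((k ∸ 2) ∷ 2 ∷ [])) ≡ + (4 ℕ.* (k ∸ 3)))
    × (∀ i j → j < i → 3 ≤ j →
    c (partition (i ∷ j ∷ [])) ≡ + (2 ℕ.* i ℕ.* (j ∸ 1) ℕ.+ 2 ℕ.* j ℕ.* (i ∸ 1))
    × c (partition (i ∷ j ∷ [])) ≡ + 2 * (+ 2 * + i * + j - + i - + j))
    × (∀ i → 3 ≤ i → c (partition (i ∷ i ∷ [])) ≡ + (2 ℕ.* i ℕ.* (i ∸ 1)))
    × (∀ k → 2 ≤ k →
    c (partition (3 ∷ replicate k 2)) ≡ + 8
    × c (partition (3 ∷ replicate k 2 ++ 1 ∷ [])) ≡ + 4)
    × (∀ μ → 2 ≤ ℓ μ → c (partition (1 ∷ []) ∪ μ) ≢ 0ℤ →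
    1 ∉ supp μ × ∃[ a ] (3 ≤ a × a ∈ supp μ))
    × (∀ k → c (partition (replicate k 2 ++ 1 ∷ [])) ≡ 0ℤ)
    × (∀ μ → 2 ≤ ℓ μ →
    ∃[ d ] ((G ⊛ G≥3 ⊛ G ^ᶻ (ℓ μ ∸ 2)) HasECoefficients d
    × c (partition (1 ∷ []) ∪ μ) ≡ + 2 * d μ))
    × (∀ μ → 2 ≤ ℓ μ →
    c (partition (1 ∷ []) ∪ μ) ≡
    + 2 * ∑ (filter (2 ≤?_) (supp μ)) λ a →
    ∑ (filter (3 ≤?_) (supp μ)) λ b →
    + ((a ∸ 1) ℕ.* (b ∸ 1) ℕ.* ε[ μ - a - b ]))
    × (∀ μ → 1 ∉ supp μ → 2 ≤ ℓ μ → c μ ≢ 0ℤ → ∃[ a ] (3 ≤ a × a ∈ parts μ))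
    × (∀ k → 2 ≤ k → c (partition (replicate k 2)) ≡ 0ℤ)
    × (∀ μ → 1 ∉ supp μ → 2 ≤ ℓ μ →
    ∃[ d ] ((K ⊛ G≥3 ⊛ G ^ᶻ (ℓ μ ∸ 2)) HasECoefficients d
    × c μ ≡ + 2 * d μ))
    × (∀ μ → 1 ∉ supp μ → 2 ≤ ℓ μ →
    c μ ≡
    + 2 * ∑ (filter (2 ≤?_) (supp μ)) λ a →
    ∑ (filter (3 ≤?_) (supp μ)) λ b →
    + (a ℕ.* (b ∸ 1) ℕ.* ε[ μ - a - b ])))
corollary3p10 v end = cᵗ , hasECoefficients (𝒳-expansion v end)
  -- The `refl` is the coefficient of e₂, found by evaluation: the word 2 has weight `κ 2`, which is
  -- 1, and the factor 2 is the one in front of `cᵗ`.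
  , part-a , refl , part-b , part-c , part-d , part-e , part-f
  , part-g-support , part-g-2ᵏ , part-g-product , part-g-formula
  , part-h-support , part-h-2ᵏ , part-h-product , part-h-formula
  where
  open ≡-Reasoning

  part-a : ∀ k → 3 ≤ k → cᵗ (partition (k ∷ [])) ≡ + (2 ℕ.* k)
  part-a k@(suc (suc (suc n))) _ = begin
    cᵗ (partition (k ∷ []))                  ≡⟨ cᵗ-ℓ (partition (k ∷ [])) (ℓ-partition {k ∷ []} (s≤s z≤n ∷ [])) ⟩
    + 2 * coef (κ ∷ []) (partition (k ∷ [])) ≡⟨ cong (+ 2 *_) (coef-one {κ} refl (suc (suc n))) ⟩
    + 2 * + k                                ≡⟨ ℤₚ.pos-* 2 k ⟨
    + (2 ℕ.* k)                              ∎
  part-a (suc zero) (s≤s ())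
  part-a (suc (suc zero)) (s≤s (s≤s ()))

  part-b : ∀ k → 4 ≤ k → cᵗ (partition ((k ∸ 1) ∷ 1 ∷ [])) ≡ + (2 ℕ.* (k ∸ 2))
  part-b (suc j@(suc (suc (suc n)))) _ = begin
    cᵗ (partition (j ∷ 1 ∷ []))                     ≡⟨ cong cᵗ (partition-∪ {j ∷ []} (s≤s z≤n ∷ [])) ⟩
    cᵗ (partition (1 ∷ []) ∪ partition (j ∷ []))    ≡⟨ cᵗ-∪ (partition (j ∷ [])) (ℓ-partition {j ∷ []} (s≤s z≤n ∷ [])) ⟩
    + 2 * coef (g₃ ∷ []) (partition (j ∷ []))       ≡⟨ cong (+ 2 *_) (coef-one {g₃} refl (suc (suc n))) ⟩
    + 2 * + suc (suc n)                             ≡⟨ ℤₚ.pos-* 2 (suc (suc n)) ⟨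
    + (2 ℕ.* suc (suc n))                           ∎
  part-b (suc zero) (s≤s ())
  part-b (suc (suc zero)) (s≤s (s≤s ()))
  part-b (suc (suc (suc zero))) (s≤s (s≤s (s≤s ())))

  two-parts : ∀ i j → i ≢ j → cᵗ (partition (suc i ∷ suc j ∷ [])) ≡ + (2 ℕ.* (suc i ℕ.* g₃ (suc j) ℕ.+ suc j ℕ.* g₃ (suc i)))
  two-parts i j i≢j = begin
    cᵗ (partition (suc i ∷ suc j ∷ []))
      ≡⟨ cᵗ-ℓ {1} (partition (suc i ∷ suc j ∷ [])) (ℓ-partition {suc i ∷ suc j ∷ []} (s≤s z≤n ∷ s≤s z≤n ∷ [])) ⟩
    + 2 * coef (ι ∷ g₃ ∷ []) (partition (suc i ∷ suc j ∷ []))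
      ≡⟨ cong (+ 2 *_) (coef-two {ι} {g₃} refl refl i j i≢j) ⟩
    + 2 * + (suc i ℕ.* g₃ (suc j) ℕ.+ suc j ℕ.* g₃ (suc i))
      ≡⟨ ℤₚ.pos-* 2 (suc i ℕ.* g₃ (suc j) ℕ.+ suc j ℕ.* g₃ (suc i)) ⟨
    + (2 ℕ.* (suc i ℕ.* g₃ (suc j) ℕ.+ suc j ℕ.* g₃ (suc i))) ∎

  part-c : ∀ k → 5 ≤ k → cᵗ (partition ((k ∸ 2) ∷ 2 ∷ [])) ≡ + (4 ℕ.* (k ∸ 3))
  -- Of the two words, the one giving 2 to `g₃` has weight 0, written `con 0` for the solver; the
  -- other gives 2 to `ι` and k - 2 to `g₃`.
  part-c (suc (suc (suc j@(suc (suc n))))) _ = trans (two-parts j 1 λ ())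
    (cong +_ (solve 2 (λ x y → con 2 :* (x :* con 0 :+ con 2 :* y) := con 4 :* y) refl (suc j) j))
    where open +-*-Solver
  part-c (suc zero) (s≤s ())
  part-c (suc (suc zero)) (s≤s (s≤s ()))
  part-c (suc (suc (suc zero))) (s≤s (s≤s (s≤s ())))
  part-c (suc (suc (suc (suc zero)))) (s≤s (s≤s (s≤s (s≤s ()))))

  part-d : ∀ i j → j < i → 3 ≤ j →
    cᵗ (partition (i ∷ j ∷ [])) ≡ + (2 ℕ.* i ℕ.* (j ∸ 1) ℕ.+ 2 ℕ.* j ℕ.* (i ∸ 1))
    × cᵗ (partition (i ∷ j ∷ [])) ≡ + 2 * (+ 2 * + i * + j - + i - + j)
  part-d (suc i@(suc (suc _))) (suc j@(suc (suc _))) (s≤s j<i) _ = eq , trans eq symmetric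
    where
    eq : cᵗ (partition (suc i ∷ suc j ∷ [])) ≡ + (2 ℕ.* suc i ℕ.* j ℕ.+ 2 ℕ.* suc j ℕ.* i)
    eq = trans (two-parts i j (ℕₚ.>⇒≢ j<i))
      (cong +_ (solve 4 (λ x y z w → con 2 :* (x :* w :+ y :* z) := con 2 :* x :* w :+ con 2 :* y :* z) refl (suc i) (suc j) i j))
      where open +-*-Solver

    -- The second form involves subtraction and is therefore checked over the integers, with i and j
    -- written as 1 + x and 1 + y, which is what the successors compute to.
    polynomial : ∀ x y → + 2 * (+ 1 + x) * y + + 2 * (+ 1 + y) * x ≡ + 2 * (+ 2 * (+ 1 + x) * (+ 1 + y) - (+ 1 + x) - (+ 1 + y))
    polynomial = ℤSolver.solve-∀

    symmetric : + (2 ℕ.* suc i ℕ.* j ℕ.+ 2 ℕ.* suc j ℕ.* i) ≡ + 2 * (+ 2 * + suc i * + suc j - + suc i - + suc j)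
    symmetric = begin
      + (2 ℕ.* suc i ℕ.* j) + + (2 ℕ.* suc j ℕ.* i)
        ≡⟨ cong₂ _+_ (ℤₚ.pos-* (2 ℕ.* suc i) j) (ℤₚ.pos-* (2 ℕ.* suc j) i) ⟩
      + (2 ℕ.* suc i) * + j + + (2 ℕ.* suc j) * + i
        ≡⟨ cong₂ (λ x y → x * + j + y * + i) (ℤₚ.pos-* 2 (suc i)) (ℤₚ.pos-* 2 (suc j)) ⟩
      + 2 * + suc i * + j + + 2 * + suc j * + i
        ≡⟨ polynomial (+ i) (+ j) ⟩
      + 2 * (+ 2 * + suc i * + suc j - + suc i - + suc j) ∎
  part-d _ (suc zero) _ (s≤s ())
  part-d _ (suc (suc zero)) _ (s≤s (s≤s ()))
  part-d (suc zero) (suc (suc (suc _))) (s≤s ()) _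
  part-d (suc (suc zero)) (suc (suc (suc _))) (s≤s (s≤s ())) _

  part-e : ∀ i → 3 ≤ i → cᵗ (partition (i ∷ i ∷ [])) ≡ + (2 ℕ.* i ℕ.* (i ∸ 1))
  part-e (suc i@(suc (suc _))) _ = begin
    cᵗ (partition (suc i ∷ suc i ∷ []))
      ≡⟨ cᵗ-ℓ {1} (partition (suc i ∷ suc i ∷ [])) (ℓ-partition {suc i ∷ suc i ∷ []} (s≤s z≤n ∷ s≤s z≤n ∷ [])) ⟩
    + 2 * coef (ι ∷ g₃ ∷ []) (partition (suc i ∷ suc i ∷ []))
      ≡⟨ cong (+ 2 *_) (coef-twice {ι} {g₃} refl refl i) ⟩
    + 2 * + (suc i ℕ.* i)
      ≡⟨ ℤₚ.pos-* 2 (suc i ℕ.* i) ⟨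
    + (2 ℕ.* (suc i ℕ.* i))
      ≡⟨ cong +_ (ℕₚ.*-assoc 2 (suc i) i) ⟨
    + (2 ℕ.* suc i ℕ.* i) ∎
  part-e (suc zero) (s≤s ())
  part-e (suc (suc zero)) (s≤s (s≤s ()))

  part-f : ∀ k → 2 ≤ k → cᵗ (partition (3 ∷ replicate k 2)) ≡ + 8 × cᵗ (partition (3 ∷ replicate k 2 ++ 1 ∷ [])) ≡ + 4
  part-f (suc zero) (s≤s ())
  part-f k@(suc (suc n)) _ = (begin
    cᵗ (partition (3 ∷ replicate k 2))
      ≡⟨ cᵗ-ℓ {k} (partition (3 ∷ replicate k 2)) ℓ≡ ⟩
    + 2 * coef (Ψ k) (partition (3 ∷ replicate k 2))
      ≡⟨ cong (+ 2 *_) (coef-3,2ᵏ ι refl (g₃ ∷ replicate (suc n) g) (suc n)) ⟩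
    + 2 * (+ 3 * coef (g₃ ∷ replicate (suc n) g) (partition (replicate k 2)) + + 2 * coef (g₃ ∷ replicate (suc n) g) (partition (3 ∷ replicate (suc n) 2)))
      -- If 3 is the letter of `ι`, nothing but 2 is left for `g₃` and the weight is 0. If it is 2,
      -- the rest has weight 2, so the total is 2 · 2 · 2.
      ≡⟨ cong₂ (λ x y → + 2 * (+ 3 * x + + 2 * y)) (coef-g₃-2ᵏ (replicate (suc n) g) k) (coef-g₃-3,2ᵏ n) ⟩
    + 8 ∎) , (begin
    cᵗ (partition (3 ∷ replicate k 2 ++ 1 ∷ []))
      ≡⟨ cong cᵗ (partition-∪ {3 ∷ replicate k 2} pos) ⟩
    cᵗ (partition (1 ∷ []) ∪ partition (3 ∷ replicate k 2))
      ≡⟨ cᵗ-∪ {k} (partition (3 ∷ replicate k 2)) ℓ≡ ⟩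
    + 2 * coef (g₃ ∷ replicate k g) (partition (3 ∷ replicate k 2))
      ≡⟨ cong (+ 2 *_) (coef-g₃-3,2ᵏ (suc n)) ⟩
    + 4 ∎)
    where
    pos : All (1 ≤_) (3 ∷ replicate k 2)
    pos = s≤s z≤n ∷ twos k
    ℓ≡ : ℓ (partition (3 ∷ replicate k 2)) ≡ suc k
    ℓ≡ = trans (ℓ-partition pos) (cong suc (length-replicate k))

  ℓ-split : ∀ μ → 2 ≤ ℓ μ → ℓ μ ≡ suc (suc (ℓ μ ∸ 2))
  ℓ-split μ 2≤ℓ = sym (ℕₚ.m+[n∸m]≡n 2≤ℓ)

  *-nonzero : ∀ {x} → + 2 * x ≢ 0ℤ → x ≢ 0ℤ
  *-nonzero 2x≢0 x≡0 = 2x≢0 (cong (+ 2 *_) x≡0)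

  part-g-support : ∀ μ → 2 ≤ ℓ μ → cᵗ (partition (1 ∷ []) ∪ μ) ≢ 0ℤ → 1 ∉ supp μ × ∃[ a ] (3 ≤ a × a ∈ supp μ)
  part-g-support μ 2≤ℓ c≢0 =
    (λ 1∈ → coef≢0 (coef-∈ (refl ∷ replicate-unitless l) (refl ∷ All.replicate⁺ l refl) μ (∈-supp⁻ μ 1∈))) ,
    (let a , 3≤a , a∈ = coef-g₃-large (replicate l g) μ coef≢0 in a , 3≤a , ∈-supp⁺ μ a∈)
    where
    l = suc (ℓ μ ∸ 2)
    coef≢0 : coef (g₃ ∷ replicate l g) μ ≢ 0ℤ
    coef≢0 = *-nonzero (subst (_≢ 0ℤ) (cᵗ-∪ μ (ℓ-split μ 2≤ℓ)) c≢0)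

  part-g-2ᵏ : ∀ k → cᵗ (partition (replicate k 2 ++ 1 ∷ [])) ≡ 0ℤ
  -- This is the partition with the single part 1, where `κ 1` is 0; `cᵗ-∪` needs a nonempty rest
  -- and does not cover it.
  part-g-2ᵏ zero    = refl
  part-g-2ᵏ k@(suc n) = begin
    cᵗ (partition (replicate k 2 ++ 1 ∷ []))
      ≡⟨ cong cᵗ (partition-∪ (twos k)) ⟩
    cᵗ (partition (1 ∷ []) ∪ partition (replicate k 2))
      ≡⟨ cᵗ-∪ {n} (partition (replicate k 2)) (trans (ℓ-partition (twos k)) (length-replicate k)) ⟩
    + 2 * coef (g₃ ∷ replicate n g) (partition (replicate k 2))
      ≡⟨ cong (+ 2 *_) (coef-g₃-2ᵏ (replicate n g) k) ⟩
    0ℤ ∎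

  -- The factor `g₃` comes first after the removal of `ι`; the swap with a factor `g` produces the
  -- order G, G≥3 of the stated product.
  c-∪ : ∀ μ → 2 ≤ ℓ μ → cᵗ (partition (1 ∷ []) ∪ μ) ≡ + 2 * coef (g ∷ g₃ ∷ replicate (ℓ μ ∸ 2) g) μ
  c-∪ μ 2≤ℓ = trans (cᵗ-∪ μ (ℓ-split μ 2≤ℓ)) (cong (+ 2 *_) (coef-swap g₃ g (replicate (ℓ μ ∸ 2) g) μ))

  part-g-product : ∀ μ → 2 ≤ ℓ μ →
    ∃[ d ] ((G ⊛ G≥3 ⊛ G ^ᶻ (ℓ μ ∸ 2)) HasECoefficients d × cᵗ (partition (1 ∷ []) ∪ μ) ≡ + 2 * d μ)
  part-g-product μ 2≤ℓ = coef (g ∷ g₃ ∷ replicate (ℓ μ ∸ 2) g) , hasECoefficients (⊛-expansion G g represents-G (ℓ μ ∸ 2)) , c-∪ μ 2≤ℓ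

  part-g-formula : ∀ μ → 2 ≤ ℓ μ →
    cᵗ (partition (1 ∷ []) ∪ μ) ≡ + 2 * ∑ (filter (2 ≤?_) (supp μ)) λ a → ∑ (filter (3 ≤?_) (supp μ)) λ b → + ((a ∸ 1) ℕ.* (b ∸ 1) ℕ.* ε[ μ - a - b ])
  part-g-formula μ 2≤ℓ = trans (c-∪ μ 2≤ℓ) (cong (+ 2 *_)
    (trans (coef-pairs {g} {g₃} refl refl μ (ℓ-split μ 2≤ℓ)) (filtered-pairs g μ λ _ → small)))
    where
    small : ∀ {a} → ¬ 2 ≤ a → g a ≡ 0
    small {zero}        _   = refl
    small {suc zero}    _   = refl
    small {suc (suc a)} 2≰a = contradiction (s≤s (s≤s z≤n)) 2≰a

  c-pair : ∀ μ → 2 ≤ ℓ μ → cᵗ μ ≡ + 2 * coef (ι ∷ g₃ ∷ replicate (ℓ μ ∸ 2) g) μ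
  c-pair μ 2≤ℓ = cᵗ-ℓ {suc (ℓ μ ∸ 2)} μ (ℓ-split μ 2≤ℓ)

  part-h-support : ∀ μ → 1 ∉ supp μ → 2 ≤ ℓ μ → cᵗ μ ≢ 0ℤ → ∃[ a ] (3 ≤ a × a ∈ parts μ)
  -- With `g₃` moved to the front, a nonzero coefficient requires a first letter on which `g₃` does
  -- not vanish.
  part-h-support μ _ 2≤ℓ c≢0 = coef-g₃-large (ι ∷ replicate (ℓ μ ∸ 2) g) μ
    (*-nonzero (subst (_≢ 0ℤ) (trans (c-pair μ 2≤ℓ) (cong (+ 2 *_) (coef-swap ι g₃ (replicate (ℓ μ ∸ 2) g) μ))) c≢0))

  part-h-2ᵏ : ∀ k → 2 ≤ k → cᵗ (partition (replicate k 2)) ≡ 0ℤ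
  part-h-2ᵏ (suc zero) (s≤s ())
  part-h-2ᵏ k@(suc (suc n)) _ = begin
    cᵗ (partition (replicate k 2))
      ≡⟨ cᵗ-ℓ {suc n} (partition (replicate k 2)) (trans (ℓ-partition (twos k)) (length-replicate k)) ⟩
    + 2 * coef (ι ∷ g₃ ∷ replicate n g) (partition (replicate k 2))
      ≡⟨ cong (+ 2 *_) (trans (coef-swap ι g₃ (replicate n g) (partition (replicate k 2))) (coef-g₃-2ᵏ (ι ∷ replicate n g) k)) ⟩
    0ℤ ∎

  part-h-product : ∀ μ → 1 ∉ supp μ → 2 ≤ ℓ μ →
    ∃[ d ] ((K ⊛ G≥3 ⊛ G ^ᶻ (ℓ μ ∸ 2)) HasECoefficients d × cᵗ μ ≡ + 2 * d μ)
  part-h-product μ 1∉ 2≤ℓ = coef (k₂ ∷ g₃ ∷ replicate (ℓ μ ∸ 2) g) , hasECoefficients (⊛-expansion K k₂ represents-K (ℓ μ ∸ 2)) ,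
    -- Among the parts of `μ` the factor of K agrees with `ι`: they differ at 1 only, which is not a
    -- part.
    trans (c-pair μ 2≤ℓ) (cong (+ 2 *_) (coef-cong {ι} {k₂} refl refl (g₃ ∷ replicate (ℓ μ ∸ 2) g) μ (agree ∘ ∈-supp⁺ μ)))
    where
    agree : ∀ {a} → a ∈ supp μ → ι a ≡ k₂ a
    agree {zero}        _  = refl
    agree {suc zero}    1∈ = contradiction 1∈ 1∉
    agree {suc (suc a)} _  = refl

  part-h-formula : ∀ μ → 1 ∉ supp μ → 2 ≤ ℓ μ →
    cᵗ μ ≡ + 2 * ∑ (filter (2 ≤?_) (supp μ)) λ a → ∑ (filter (3 ≤?_) (supp μ)) λ b → + (a ℕ.* (b ∸ 1) ℕ.* ε[ μ - a - b ])
  part-h-formula μ 1∉ 2≤ℓ = trans (c-pair μ 2≤ℓ) (cong (+ 2 *_)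
    (trans (coef-pairs {ι} {g₃} refl refl μ (ℓ-split μ 2≤ℓ)) (filtered-pairs ι μ small)))
    where
    small : ∀ {a} → a ∈ supp μ → ¬ 2 ≤ a → ι a ≡ 0
    small {zero}        _  _   = refl
    small {suc zero}    1∈ _   = contradiction 1∈ 1∉
    small {suc (suc a)} _  2≰a = contradiction (s≤s (s≤s z≤n)) 2≰a
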